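{- Assume $RP([\omega_2]^\omega)$ holds. Whenever $\vec I$ is a tower of ideals which concentrates on the class $GIC_{\omega_1}$ of $\omega_1$-guessing, internally club sets, then $\vec I$ is not presaturated.
   Context: The base theory is ZFC. $[X]^\omega$ is the set of countable subsets of $X$; a club in $[X]^\omega$ is a $\subseteq$-cofinal subset closed under unions of countable increasing chains, and stationary means meeting every club. $RP([\omega_2]^\omega)$: for every stationary $S\subseteq[\omega_2]^\omega$ there is $X\subseteq\omega_2$ with $\omega_1\subseteq X$, $|X|=\omega_1$ and $S\cap[X]^\omega$ stationary in $[X]^\omega$. $GIC_{\omega_1}$. $ZF^-$ is ZF without Power Set. A transitive $ZF^-$ model $H$ with $\omega_1\in H$ has the $\omega_1$-approximation property iff for every $\eta\in H$ and $A\subseteq\eta$: if $z\cap A\in H$ for every $z\in H$ which is countable in $H$, then $A\in H$. A set $M$ with $\omega_1\subset M\prec H_\theta$ for some regular uncountable $\theta$ is $\omega_1$-guessing iff its transitive collapse has the $\omega_1$-approximation property. $G_{\omega_1}$ is the class of $\omega_1$-guessing $M$ with $|M|=\omega_1\subset M$. $IC_{\omega_1}$ (internally club sets) is the class of $M$ with $(M,\in)\models ZF^-$, $\omega_1\subseteq M$, $|M|=\omega_1$, such that $M\cap[M]^\omega$ contains a club in $[M]^\omega$. $GIC_{\omega_1}=G_{\omega_1}\cap IC_{\omega_1}$. Ideals. For a set $Z$, an ideal $I\subset\wp(Z)$ is always proper, countably complete, fine (for every $b\in\bigcup Z$, $\{M\in Z: b\notin M\}\in I$) and normal (if $S\notin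 I$ and $g$ is a function on $S$ with $g(M)\in M$ for all $M\in S$, then $g$ is constant on some $S'\subseteq S$ with $S'\notin I$). $I^+=\wp(Z)\setminus I$. $I$ concentrates on a class $\Gamma$ iff some $A\subseteq\Gamma$ belongs to the dual filter of $I$. If $I\subset\wp(Z)$, $I'\subset\wp(Z')$ and $\bigcup Z\subseteq\bigcup Z'$, then $I$ is the canonical projection of $I'$ to $Z$ iff $I=\{A\subseteq Z:\{M'\in Z': M'\cap\bigcup Z\in A\}\in I'\}$. Towers. A tower of ideals of height $\delta$ is a sequence $\vec I=\langle I_\lambda : \lambda\in U\rangle$, where the index set $U$ is an unbounded subset of $\delta$, each $I_\lambda$ is an ideal on $Z_\lambda=\wp_\kappa(H_\lambda)$ (the set of subsets of $H_\lambda$ of size $<\kappa$) for a fixed regular $\kappa\le\lambda$, all $I_\lambda$ have the same completeness, and for $\lambda\le\lambda'$ in $U$, $I_\lambda$ is the canonical projection of $I_{\lambda'}$ to $Z_\lambda$. $\vec I$ concentrates on $\Gamma$ iff every $I_\lambda$ does. $\mathbb P_{\vec I}$ is the poset of pairs $(\lambda,S)$ with $\lambda\in U$ and $S\in I_\lambda^+$, ordered by $(\lambda',S')\le(\lambda,S)$ iff $\lambda'\ge\lambda$ and $S'\subseteq\{M'\in Z_{\lambda'}: M'\cap H_\lambda\in S\}$. A tower $\vec I$ of height $\delta$ is presaturated iff $\delta$ always remains a regular cardinal in generic extensions of $V$ by $\mathbb P_{\vec I}$. -}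

module Defs where

open import Level using (Level; Lift; _⊔_) renaming (suc to lsuc)
open import Data.Fin.Base using (Fin; zero; suc)
open import Data.Nat.Base using (ℕ) renaming (suc to 1+_)
open import Data.Product.Base using (Σ; ∃; _×_; _,_; proj₁; proj₂; map₂)
open import Data.Sum.Base using (_⊎_)
open import Data.Vec.Functional using (_∷_; [])
open import Function.Base using (_∘_)
open import Function.Bundles using (Func; Injection; Inverse; _⇔_)
open import Relation.Binary.Bundles using (Setoid)
open import Relation.Binary.Construct.Closure.Transitive using (TransClosure)
open import Relation.Binary.PropositionalEquality.Properties using () renaming (setoid to ≡-setoid)
open import Relation.Nullary.Negation.Core using (¬_)
open import Relation.Unary using (Pred; U; ∅; _⊆_; _∩_; _≐_)
import Relation.Binary.Construct.Add.Supremum.NonStrict as Sup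
import Relation.Binary.Construct.On as On
open import Relation.Nullary.Construct.Add.Supremum using (_⁺; ⊤⁺)

------------------------------------------------------------------------
-- First-order formulas of the language {∈, =}, with de Bruijn variables.
-- The logic is classical, so the other connectives are abbreviations.

infix  9 _∈̇_ _≈̇_
infix  8 ¬̇_ ∀̇_ ∃̇_
infixr 7 _∧̇_
infixr 6 _∨̇_
infixr 5 _⇒̇_ _⇔̇_

data Formula (n : ℕ) : Set where
  _∈̇_ _≈̇_ : Fin n → Fin n → Formula n
  ¬̇_      : Formula n → Formula n
  _∧̇_     : Formula n → Formula n → Formula n
  ∀̇_      : Formula (1+ n) → Formula n

private variable n : ℕ

_∨̇_ _⇒̇_ _⇔̇_ : Formula n → Formula n → Formula n
φ ∨̇ ψ = ¬̇ (¬̇ φ ∧̇ ¬̇ ψ)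
φ ⇒̇ ψ = ¬̇ (φ ∧̇ ¬̇ ψ)
φ ⇔̇ ψ = (φ ⇒̇ ψ) ∧̇ (ψ ⇒̇ φ)

∃̇_ : Formula (1+ n) → Formula n
∃̇ φ = ¬̇ (∀̇ (¬̇ φ))

∀∈̇ ∃∈̇ : Fin n → Formula (1+ n) → Formula n
∀∈̇ x φ = ∀̇ (zero ∈̇ suc x ⇒̇ φ)
∃∈̇ x φ = ∃̇ (zero ∈̇ suc x ∧̇ φ)

private
  pattern v0 = zero
  pattern v1 = suc zero
  pattern v2 = suc (suc zero)

  ↑1 : Fin n → Fin (1+ n)
  ↑1 x = suc x

  ↑2 : Fin n → Fin (1+ (1+ n))
  ↑2 x = suc (suc x)

  ↑3 : Fin n → Fin (1+ (1+ (1+ n)))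
  ↑3 x = suc (suc (suc x))

-- z = {x , y}
isUPair : (z x y : Fin n) → Formula n
isUPair z x y = ∀̇ (v0 ∈̇ ↑1 z ⇔̇ (v0 ≈̇ ↑1 x ∨̇ v0 ≈̇ ↑1 y))

-- z = ⟨ x , y ⟩ (Kuratowski)
isPair : (z x y : Fin n) → Formula n
isPair z x y =
  ∃̇ ∃̇ (isUPair v1 (↑2 x) (↑2 x) ∧̇ isUPair v0 (↑2 x) (↑2 y) ∧̇ isUPair (↑2 z) v1 v0)

-- ⟨ x , y ⟩ ∈ f
maps : (f x y : Fin n) → Formula n
maps f x y = ∃∈̇ f (isPair v0 (↑1 x) (↑1 y))

-- f is a function from a to b
isFunction : (f a b : Fin n) → Formula n
isFunction f a b =
    ∀∈̇ f (∃∈̇ (↑1 a) (∃∈̇ (↑2 b) (isPair v2 v1 v0)))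
  ∧̇ ∀∈̇ a (∃∈̇ (↑1 b) (maps (↑2 f) v1 v0 ∧̇ ∀̇ (maps (↑3 f) v2 v0 ⇒̇ v0 ≈̇ v1)))

isTransitive : Fin n → Formula n
isTransitive x = ∀∈̇ x (∀∈̇ v0 (v0 ∈̇ ↑2 x))

-- Foundation makes the order ∈ on a transitive set of transitive sets a
-- well-order.
isOrdinal : Fin n → Formula n
isOrdinal x = isTransitive x ∧̇ ∀∈̇ x (isTransitive v0)

-- y = x ∪ {x}
isSuccessor : (y x : Fin n) → Formula n
isSuccessor y x = ∀̇ (v0 ∈̇ ↑1 y ⇔̇ (v0 ∈̇ ↑1 x ∨̇ v0 ≈̇ ↑1 x))

-- Nonzero limit ordinals.
isLimit : Fin n → Formula n
isLimit x =
  isOrdinal x ∧̇ ∃̇ (v0 ∈̇ ↑1 x) ∧̇ ∀∈̇ x (∃∈̇ (↑1 x) (isSuccessor v0 v1))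

isOmega : Fin n → Formula n
isOmega x = isLimit x ∧̇ ∀∈̇ x (¬̇ isLimit v0)

-- There is an injective function from x to ω.
isCountable : Fin n → Formula n
isCountable x =
  ∃̇ ∃̇ ( isOmega v1 ∧̇ isFunction v0 (↑2 x) v1
      ∧̇ ∀∈̇ (↑2 x) (∀∈̇ (↑3 x)
          (∀̇ (maps (↑3 v0) v2 v0 ∧̇ maps (↑3 v0) v1 v0 ⇒̇ v2 ≈̇ v1))))

-- δ is a limit ordinal with cf δ = δ: every function from some γ ∈ δ to δ
-- is bounded by some β ∈ δ.
isRegular : Fin n → Formula n
isRegular δ =
    isLimit δ
  ∧̇ ∀∈̇ δ (∀̇ (isFunction v0 v1 (↑2 δ) ⇒̇
      ∃∈̇ (↑2 δ) (∀∈̇ v2 (∀̇ (maps (↑3 v0) v1 v0 ⇒̇ v0 ∈̇ v2)))))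

------------------------------------------------------------------------
-- The universe of sets is Aczel's type of iterative sets over Set ℓ.  With
-- excluded middle it satisfies ZF; Choice (below) then makes it satisfy ZFC.

module SetTheory (ℓ : Level) where

  data 𝕍 : Set (lsuc ℓ) where
    sup : (A : Set ℓ) → (A → 𝕍) → 𝕍

  infix 4 _≈_ _∈_ _∈ᶜ_ _≼_ _≅_

  _≈_ : 𝕍 → 𝕍 → Set ℓ
  sup A f ≈ sup B g =
    (∀ a → Σ B λ b → f a ≈ g b) × (∀ b → Σ A λ a → f a ≈ g b)

  _∈_ : 𝕍 → 𝕍 → Set ℓ
  x ∈ sup B g = Σ B λ b → x ≈ g b

  ≈-refl : ∀ x → x ≈ x
  ≈-refl (sup A f) = (λ a → a , ≈-refl (f a)) , (λ a → a , ≈-refl (f a))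

  ≈-sym : ∀ x y → x ≈ y → y ≈ x
  ≈-sym (sup A f) (sup B g) (p , q) =
      (λ b → proj₁ (q b) , ≈-sym (f (proj₁ (q b))) (g b) (proj₂ (q b)))
    , (λ a → proj₁ (p a) , ≈-sym (f a) (g (proj₁ (p a))) (proj₂ (p a)))

  ≈-trans : ∀ x y z → x ≈ y → y ≈ z → x ≈ z
  ≈-trans (sup A f) (sup B g) (sup C h) (p , q) (r , s) =
      (λ a → let b , ab = p a ; c , bc = r b in c , ≈-trans (f a) (g b) (h c) ab bc)
    , (λ c → let b , bc = s c ; a , ab = q b in a , ≈-trans (f a) (g b) (h c) ab bc)

  𝕍-setoid : Setoid (lsuc ℓ) ℓ
  𝕍-setoid = record
    { Carrier = 𝕍
    ; _≈_ = _≈_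
    ; isEquivalence = record
      { refl = λ {x} → ≈-refl x
      ; sym = λ {x} {y} → ≈-sym x y
      ; trans = λ {x} {y} {z} → ≈-trans x y z
      }
    }

  private variable
    a b : Level

  -- The class of elements of a set.
  El : 𝕍 → Pred 𝕍 ℓ
  El x z = z ∈ x

  -- C is (the extension of) a set belonging to y.
  _∈ᶜ_ : Pred 𝕍 a → 𝕍 → Set (lsuc ℓ ⊔ a)
  C ∈ᶜ y = ∃ λ x → x ∈ y × El x ≐ C

  ⋃ᶜ : Pred 𝕍 a → Pred 𝕍 (lsuc ℓ ⊔ a)
  ⋃ᶜ C z = ∃ λ x → C x × z ∈ x

  ∣_∣ : Pred 𝕍 a → Setoid (lsuc ℓ ⊔ a) ℓ
  ∣ C ∣ = On.setoid {B = ∃ C} 𝕍-setoid proj₁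

  _≼_ _≅_ : Pred 𝕍 a → Pred 𝕍 b → Set (lsuc ℓ ⊔ a ⊔ b)
  C ≼ D = Injection ∣ C ∣ ∣ D ∣
  C ≅ D = Inverse ∣ C ∣ ∣ D ∣

  Countable : Pred 𝕍 a → Set (lsuc ℓ ⊔ a)
  Countable C = Injection ∣ C ∣ (≡-setoid ℕ)

  Choice : Set (lsuc ℓ)
  Choice = ∀ X → (∀ x → x ∈ X → ∃ (El x)) →
    Σ (Func ∣ El X ∣ 𝕍-setoid) λ f → ∀ x → Func.to f x ∈ proj₁ x

  ----------------------------------------------------------------------
  -- Satisfaction in (D , ∈)

  infix 3 _⊨_[_]

  _⊨_[_] : (D : Pred 𝕍 a) → Formula n → (Fin n → ∃ D) → Set (lsuc ℓ ⊔ a)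
  _⊨_[_] {a} D (i ∈̇ j) ρ = Lift (lsuc ℓ ⊔ a) (proj₁ (ρ i) ∈ proj₁ (ρ j))
  _⊨_[_] {a} D (i ≈̇ j) ρ = Lift (lsuc ℓ ⊔ a) (proj₁ (ρ i) ≈ proj₁ (ρ j))
  D ⊨ ¬̇ φ    [ ρ ] = ¬ (D ⊨ φ [ ρ ])
  D ⊨ φ ∧̇ ψ  [ ρ ] = (D ⊨ φ [ ρ ]) × (D ⊨ ψ [ ρ ])
  D ⊨ ∀̇ φ    [ ρ ] = ∀ d → D ⊨ φ [ d ∷ ρ ]

  IsOrdinal IsRegular : 𝕍 → Set (lsuc ℓ)
  IsOrdinal x = U ⊨ isOrdinal zero [ (x , _) ∷ [] ]
  IsRegular x = U ⊨ isRegular zero [ (x , _) ∷ [] ]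

  IsTransitive : 𝕍 → Set (lsuc ℓ)
  IsTransitive x = ∀ y → y ∈ x → El y ⊆ El x

  _≺_ : Pred 𝕍 a → Pred 𝕍 b → Set (lsuc ℓ ⊔ a ⊔ b)
  M ≺ N = Σ (M ⊆ N) λ M⊆N → ∀ {n} (φ : Formula n) ρ →
    (M ⊨ φ [ ρ ]) ⇔ (N ⊨ φ [ map₂ M⊆N ∘ ρ ])

  module _ {a} (D : Pred 𝕍 a) where

    private
      infix 4 _ε_ _≋_

      M : Set (lsuc ℓ ⊔ a)
      M = ∃ D

      _ε_ _≋_ : M → M → Set ℓ
      x ε y = proj₁ x ∈ proj₁ y
      x ≋ y = proj₁ x ≈ proj₁ y

    -- (D , ∈) satisfies ZF without Power Set.
    record _⊨ZF⁻ : Set (lsuc ℓ ⊔ a) where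
      field
        nonempty       : M
        extensionality : ∀ x y → (∀ z → z ε x ⇔ z ε y) → x ≋ y
        foundation     : ∀ x → (Σ M λ y → y ε x) →
                         Σ M λ y → y ε x × (∀ z → z ε y → ¬ z ε x)
        pairing        : ∀ x y → Σ M λ z → ∀ w → w ε z ⇔ (w ≋ x ⊎ w ≋ y)
        union          : ∀ x → Σ M λ u → ∀ w → w ε u ⇔ (Σ M λ y → y ε x × w ε y)
        infinity       : Σ M λ x →
                           (Σ M λ e → e ε x × (∀ z → ¬ z ε e))
                         × (∀ y → y ε x → Σ M λ s → s ε x × (∀ w → w ε s ⇔ (w ε y ⊎ w ≋ y)))
        separation     : ∀ {n} (φ : Formula (1+ n)) ρ x →
                         Σ M λ y → ∀ z → z ε y ⇔ (z ε x × (D ⊨ φ [ z ∷ ρ ]))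
        replacement    : ∀ {n} (φ : Formula (1+ (1+ n))) ρ →
                         (∀ x y y′ → D ⊨ φ [ x ∷ y ∷ ρ ] → D ⊨ φ [ x ∷ y′ ∷ ρ ] → y ≋ y′) →
                         ∀ u → Σ M λ v → ∀ y → y ε v ⇔ (Σ M λ x → x ε u × (D ⊨ φ [ x ∷ y ∷ ρ ]))

  ----------------------------------------------------------------------
  -- Cardinality.  An initial ordinal is the set of smaller ordinals, so
  -- ω₁ and ω₂ are given by their elements.

  ω₁ ω₂ : Pred 𝕍 (lsuc ℓ)
  ω₁ α = IsOrdinal α × Countable (El α)
  ω₂ α = IsOrdinal α × El α ≼ ω₁

  -- |C| < α, for an ordinal α which need not be a cardinal.
  _hasSize<_ : Pred 𝕍 a → 𝕍 → Set (lsuc ℓ ⊔ a)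
  C hasSize< α = ∃ λ β → β ∈ α × C ≼ El β

  IsCardinal : 𝕍 → Set (lsuc ℓ)
  IsCardinal α = IsOrdinal α × ¬ El α hasSize< α

  trcl : 𝕍 → Pred 𝕍 (lsuc ℓ)
  trcl x y = TransClosure _∈_ y x

  H : 𝕍 → Pred 𝕍 (lsuc ℓ)
  H θ x = trcl x hasSize< θ

  ----------------------------------------------------------------------
  -- Clubs, stationarity and reflection

  [_]^ω : Pred 𝕍 a → Pred 𝕍 (lsuc ℓ ⊔ a)
  [ X ]^ω z = El z ⊆ X × Countable (El z)

  record IsClub (X : Pred 𝕍 a) (C : 𝕍) : Set (lsuc ℓ ⊔ a) where
    field
      subset  : El C ⊆ [ X ]^ω
      cofinal : ∀ y → [ X ]^ω y → ∃ λ z → z ∈ C × El y ⊆ El z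
      closed  : (c : ℕ → 𝕍) → (∀ i → c i ∈ C) → (∀ i → El (c i) ⊆ El (c (1+ i))) →
                (λ b → ∃ λ i → b ∈ c i) ∈ᶜ C

  IsStationary : Pred 𝕍 a → Pred 𝕍 b → Set (lsuc ℓ ⊔ a ⊔ b)
  IsStationary X S = S ⊆ [ X ]^ω × (∀ C → IsClub X C → ∃ λ z → z ∈ C × S z)

  RP[ω₂]^ω : Set (lsuc ℓ)
  RP[ω₂]^ω = ∀ S → IsStationary ω₂ (El S) →
    ∃ λ X → El X ⊆ ω₂ × ω₁ ⊆ El X × El X ≅ ω₁ × IsStationary (El X) (El S ∩ [ El X ]^ω)

  ----------------------------------------------------------------------
  -- Guessing and internally club sets

  -- The transitive collapse π_M(x) = {π_M(y) : y ∈ M ∩ x}.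
  π : 𝕍 → 𝕍 → 𝕍
  π M (sup A f) = sup (Σ A λ i → f i ∈ M) λ (i , _) → π M (f i)

  collapse : 𝕍 → 𝕍
  collapse M@(sup A f) = sup A λ i → π M (f i)

  record Hasω₁Approximation (K : 𝕍) : Set (lsuc ℓ) where
    field
      transitive  : IsTransitive K
      zf⁻         : El K ⊨ZF⁻
      ω₁∈         : ω₁ ∈ᶜ K
      approximate : ∀ η A → η ∈ K → El A ⊆ El η →
        (∀ z (z∈K : z ∈ K) → El K ⊨ isCountable zero [ (z , z∈K) ∷ [] ] → (El z ∩ El A) ∈ᶜ K) →
        A ∈ K

  IsGuessing : 𝕍 → Set (lsuc ℓ)
  IsGuessing M =
      ω₁ ⊆ El M
    × (∃ λ θ → IsRegular θ × ¬ Countable (El θ) × El M ≺ H θ)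
    × Hasω₁Approximation (collapse M)

  G IC GIC : Pred 𝕍 (lsuc ℓ)
  G M = IsGuessing M × El M ≅ ω₁ × ω₁ ⊆ El M
  IC M = El M ⊨ZF⁻ × ω₁ ⊆ El M × El M ≅ ω₁ × ∃ λ C → El C ⊆ El M × IsClub (El M) C
  GIC = G ∩ IC

  ----------------------------------------------------------------------
  -- Ideals and towers

  record IsIdeal (Z : Pred 𝕍 a) (I : 𝕍) : Set (lsuc ℓ ⊔ a) where
    field
      subsets  : ∀ S → S ∈ I → El S ⊆ Z
      empty    : ∅ ∈ᶜ I
      downward : ∀ S T → S ∈ I → El T ⊆ El S → T ∈ I
      σ-closed : (S : ℕ → 𝕍) → (∀ i → S i ∈ I) → (λ M → ∃ λ i → M ∈ S i) ∈ᶜ I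
      proper   : ¬ Z ∈ᶜ I
      fine     : ∀ b → ⋃ᶜ Z b → (λ M → Z M × ¬ b ∈ M) ∈ᶜ I
      normal   : ∀ S → El S ⊆ Z → ¬ S ∈ I →
                 (g : Func ∣ El S ∣ 𝕍-setoid) → (∀ M → Func.to g M ∈ proj₁ M) →
                 ∃ λ S′ → El S′ ⊆ El S × ¬ S′ ∈ I ×
                 ∃ λ c → ∀ M → proj₁ M ∈ S′ → Func.to g M ≈ c

  -- The completeness of I is the least cardinal μ such that some μ-sized
  -- subfamily of I has its union outside I.
  IsCompleteness : 𝕍 → 𝕍 → Set (lsuc ℓ)
  IsCompleteness I μ =
      IsCardinal μ
    × (∀ F → El F ⊆ El I → El F hasSize< μ → ⋃ᶜ (El F) ∈ᶜ I)
    × (∃ λ F → El F ⊆ El I × El F ≼ El μ × ¬ ⋃ᶜ (El F) ∈ᶜ I)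

  -- Some subset of Γ lies in the dual filter of the ideal I on Z.
  ConcentratesOn : (Z : Pred 𝕍 a) (I : 𝕍) (Γ : Pred 𝕍 b) → Set (lsuc ℓ ⊔ a ⊔ b)
  ConcentratesOn Z I Γ =
    ∃ λ A → El A ⊆ Z × El A ⊆ Γ × (λ M → Z M × ¬ M ∈ A) ∈ᶜ I

  IsProjection : (Z : Pred 𝕍 a) (I : 𝕍) (Z′ : Pred 𝕍 b) (I′ : 𝕍) → Set (lsuc ℓ ⊔ a ⊔ b)
  IsProjection Z I Z′ I′ =
      ⋃ᶜ Z ⊆ ⋃ᶜ Z′
    × (∀ A → A ∈ I ⇔ (El A ⊆ Z × (λ M′ → Z′ M′ × (El M′ ∩ ⋃ᶜ Z) ∈ᶜ A) ∈ᶜ I′))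

  -- ℘_κ(H_ν).
  ℘H : 𝕍 → 𝕍 → Pred 𝕍 (lsuc ℓ)
  ℘H κ ν M = El M ⊆ H ν × El M hasSize< κ

  record Tower : Set (lsuc ℓ) where
    field
      δ κ index    : 𝕍
      ideal        : Func ∣ El index ∣ 𝕍-setoid

    Index : Set (lsuc ℓ)
    Index = ∃ (El index)

    I : Index → 𝕍
    I = Func.to ideal

    Z : Index → Pred 𝕍 (lsuc ℓ)
    Z (ν , _) = ℘H κ ν

    -- The order of ordinals.
    _≤_ : Index → Index → Set (lsuc ℓ)
    (ν , _) ≤ (ν′ , _) = El ν ⊆ El ν′

    field
      δ-ordinal    : IsOrdinal δ
      index⊆δ      : El index ⊆ El δ
      unbounded    : ∀ α → α ∈ δ → ∃ λ ν → ν ∈ index × El α ⊆ El ν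
      κ-regular    : IsRegular κ
      κ≤           : ((ν , _) : Index) → El κ ⊆ El ν
      ideals       : ∀ ν → IsIdeal (Z ν) (I ν)
      completeness : ∃ λ μ → ∀ ν → IsCompleteness (I ν) μ
      projections  : ∀ ν ν′ → ν ≤ ν′ → IsProjection (Z ν) (I ν) (Z ν′) (I ν′)

  TowerConcentratesOn : Tower → Pred 𝕍 a → Set (lsuc ℓ ⊔ a)
  TowerConcentratesOn T Γ = ∀ ν → ConcentratesOn (Z ν) (I ν) Γ
    where open Tower T

  record Condition (T : Tower) : Set (lsuc ℓ) where
    open Tower T
    field
      ν        : Index
      S        : 𝕍
      S⊆Z      : El S ⊆ Z ν
      positive : ¬ S ∈ I ν

  _≤ᴾ_ : {T : Tower} → Condition T → Condition T → Set (lsuc ℓ)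
  _≤ᴾ_ {T} p q =
      q.ν ≤ p.ν
    × (∀ M′ → M′ ∈ p.S → Z p.ν M′ × (El M′ ∩ H (proj₁ q.ν)) ∈ᶜ q.S)
    where
    open Tower T
    module p = Condition p
    module q = Condition q

  ----------------------------------------------------------------------
  -- Forcing.  A largest condition ⊤⁺ is adjoined to the poset, which gives
  -- check names their usual form and does not affect the generic extensions
  -- of a nonempty poset.  A statement holds in all generic extensions iff ⊤⁺
  -- forces it.

  module Forcing {P : Set (lsuc ℓ)} (_≤₀_ : P → P → Set (lsuc ℓ)) where

    open Sup _≤₀_ using () renaming (_≤⁺_ to _≤_)

    -- name A τ s is the name {(τ i , s i) : i ∈ A}.
    data Name : Set (lsuc ℓ) where
      name : (A : Set ℓ) → (A → Name) → (A → P ⁺) → Name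

    check : 𝕍 → Name
    check (sup A f) = name A (λ i → check (f i)) (λ _ → ⊤⁺)

    infix 3 _⊩_≈_ _⊩_∈_ _⊩_[_]

    _⊩_≈_ _⊩_∈_ : P ⁺ → Name → Name → Set (lsuc ℓ)
    p ⊩ x@(name A σ s) ≈ y@(name B τ t) =
        (∀ i q → q ≤ p → q ≤ s i → q ⊩ σ i ∈ y)
      × (∀ j q → q ≤ p → q ≤ t j → q ⊩ τ j ∈ x)
    p ⊩ x ∈ name B τ t =
      ∀ q → q ≤ p → ∃ λ r → r ≤ q × Σ B λ j → r ≤ t j × (r ⊩ x ≈ τ j)

    _⊩_[_] : P ⁺ → Formula n → (Fin n → Name) → Set (lsuc ℓ)
    p ⊩ i ∈̇ j  [ ρ ] = p ⊩ ρ i ∈ ρ j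
    p ⊩ i ≈̇ j  [ ρ ] = p ⊩ ρ i ≈ ρ j
    p ⊩ ¬̇ φ    [ ρ ] = ∀ q → q ≤ p → ¬ (q ⊩ φ [ ρ ])
    p ⊩ φ ∧̇ ψ  [ ρ ] = (p ⊩ φ [ ρ ]) × (p ⊩ ψ [ ρ ])
    p ⊩ ∀̇ φ    [ ρ ] = ∀ τ → p ⊩ φ [ τ ∷ ρ ]

  -- δ remains a regular cardinal in every generic extension.  The poset of T
  -- is empty only if δ = 0, and then T is not presaturated.
  IsPresaturated : Tower → Set (lsuc ℓ)
  IsPresaturated T = ⊤⁺ ⊩ isRegular zero [ check (Tower.δ T) ∷ [] ]
    where open Forcing (_≤ᴾ_ {T})

{-# OPTIONS --safe #-}
module Submission where

-- Suppose δ stays regular.  If the heights of the collapses of M ∈ GIC with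
-- given bounded subsets of ω₁ were bounded below ω₂, the tower would add a
-- function of ω₁ onto δ.  So some M has a family of collapses with its bounded
-- subsets of ω₁ and heights unbounded in ω₂.  These collapses are internally
-- club, hence cohere on countable sets of ordinals: they yield W ⊆ [ω₂]^ω that
-- has at most ω₁ members below each α < ω₂ and contains a club in [η]^ω for
-- each η with ω₁ ≤ η < ω₂.  The part of [ω₂]^ω outside W (closed under fixed
-- injections α → ω₁) does not reflect, so by RP it misses a club.  A
-- perfect tree in that club, as in Baumgartner and Taylor's theorem on clubs in
-- [ω₂]^ω, embeds the reals in W below some α < ω₂, so CH holds.  But then
-- by normality and fineness some M ∈ GIC contains all bounded subsets of ω₁,
-- and by approximation its collapse, of size ω₁, contains all subsets of ω₁.

open import Defs
open import Level using (Level; Lift; lift; lower; _⊔_) renaming (suc to lsuc)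
open import Axiom.ExcludedMiddle using (ExcludedMiddle)
open import Data.Bool.Base using (Bool; true; false)
open import Data.Empty using (⊥)
open import Data.Product.Base using (Σ; ∃; _×_; _,_; proj₁; proj₂)
open import Data.Sum.Base using (_⊎_; inj₁; inj₂; [_,_]′)
open import Function.Base using (_∘_; id; case_of_)
open import Function.Bundles using (Func; Injection; Inverse; Equivalence; mk⇔)
open import Relation.Binary.Construct.Closure.Transitive using () renaming (transitive to transitiveᵗ; [_] to [_]ᵗ; _∷_ to _∷ᵗ_)
open import Relation.Binary.Definitions using (Reflexive; Transitive)
open import Relation.Binary.PropositionalEquality.Core using (_≡_; refl; sym; trans; cong; cong₂; subst)
open import Relation.Nullary using (¬_)
open import Relation.Nullary.Construct.Add.Supremum using (_⁺; ⊤⁺)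
open import Relation.Nullary.Decidable using (decidable-stable)
open import Relation.Nullary.Decidable.Core using (yes; no; map′; isYes; True; toWitness; fromWitness)
open import Relation.Nullary.Negation.Core using (contradiction)
open import Relation.Unary using (Pred; _⊆_; _∩_; _≐_)
import Relation.Binary.Construct.Add.Supremum.NonStrict as Sup

-- The code i < ω₁ of an ordinal must be readable from M ∩ H_ν, where ν is the index of a condition,
-- because stronger conditions preserve only this trace. The height of the collapse of M need not be
-- readable there, but the bounded subsets of ω₁ in M are. So heights are bounded over all N with
-- the same bounded subsets, and if no bound below ω₂ exists, these N are the family to work with.
-- The same subsets make the family coherent: two internally club models share a countable cover y
-- of a given countable set of ordinals, and collapsing y turns its subsets into bounded subsets of
-- ω₁. RP may return an X that is not an ordinal. Closing the sets under the fixed injections makes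
-- X transitive, hence an ordinal below ω₂ and a member of some model of the family. CH is what
-- pressing down requires at the end, since it chooses among ω₁ many alternatives only: it first
-- fixes a bound β < ω₁ of an omitted subset, and then, through an injection of the reals into ω₁,
-- the omitted subset itself.

-- Basic set theory up to extensional equality, with excluded middle.

module Sets (ℓ : Level) (em : ExcludedMiddle (lsuc ℓ)) where
  open import Data.Bool.Base using (T)
  open SetTheory ℓ

  L : Level
  L = lsuc ℓ

  emℓ : ExcludedMiddle ℓ
  emℓ {P} = map′ lower lift (em {Lift L P})

  stable : {P : Set L} → ¬ ¬ P → P
  stable = decidable-stable em

  stableℓ : {P : Set ℓ} → ¬ ¬ P → P
  stableℓ = decidable-stable emℓ

  ¬∀⇒∃¬ : {A : Set L} {P : A → Set L} → ¬ (∀ x → P x) → ∃ λ x → ¬ P x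
  ¬∀⇒∃¬ ¬p = stable λ ¬e → ¬p λ x → stable λ ¬px → ¬e (x , ¬px)

  ¬∀¬⇒∃ : {A : Set L} {P : A → Set L} → ¬ (∀ x → ¬ P x) → ∃ P
  ¬∀¬⇒∃ ¬p = stable λ ¬e → ¬p λ x px → ¬e (x , px)

  ¬×¬⇒→ : {A B : Set L} → ¬ (A × ¬ B) → A → B
  ¬×¬⇒→ n a = stable λ ¬b → n (a , ¬b)

  →⇒¬×¬ : ∀ {a b} {A : Set a} {B : Set b} → (A → B) → ¬ (A × ¬ B)
  →⇒¬×¬ f (a , ¬b) = ¬b (f a)

  -- Sets are indexed by types in `Set ℓ`, while the defining predicates live in `Set L`. Excluded
  -- middle replaces a proposition by its truth value, which fits into the smaller universe.
  Squash : Set L → Set ℓ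
  Squash P = Lift ℓ (True (em {P}))

  squash : {P : Set L} → P → Squash P
  squash p = lift (fromWitness p)

  unsquash : {P : Set L} → Squash P → P
  unsquash (lift t) = toWitness t

  private variable
    x y z x′ y′ : 𝕍

  ≈refl : x ≈ x
  ≈refl {x} = ≈-refl x

  ≈sym : x ≈ y → y ≈ x
  ≈sym {x} {y} = ≈-sym x y

  ≈trans : x ≈ y → y ≈ z → x ≈ z
  ≈trans {x} {y} {z} = ≈-trans x y z

  ∈-respˡ : x ≈ y → x ∈ z → y ∈ z
  ∈-respˡ {z = sup A f} e (a , p) = a , ≈trans (≈sym e) p

  ∈-respʳ : x ≈ y → z ∈ x → z ∈ y
  ∈-respʳ {sup A f} {sup B g} (p , _) (a , q) = proj₁ (p a) , ≈trans q (proj₂ (p a))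

  ext : El x ⊆ El y → El y ⊆ El x → x ≈ y
  ext {sup A f} {sup B g} p q =
      (λ a → p {f a} (a , ≈refl))
    , (λ b → let a , e = q {g b} (b , ≈refl) in a , ≈sym e)

  Resp : ∀ {p} → Pred 𝕍 p → Set (L ⊔ p)
  Resp P = ∀ {x y} → x ≈ y → P x → P y

  ∈-ind : ∀ {p} (P : Pred 𝕍 p) → (∀ x → (∀ y → y ∈ x → P y) → P x) → ∀ x → P x
  ∈-ind P step x = go x x ≈refl
    where
    -- The recursion is on x, but the conclusion is about a copy y of x: members of y equal
    -- components of x only up to `≈`, and `P` is not assumed to respect `≈`.
    go : ∀ x y → y ≈ x → P y
    go (sup A f) y e = step y λ z z∈y → case ∈-respʳ e z∈y of λ (a , q) → go (f a) z q

  ∈-irrefl : ¬ x ∈ x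
  ∈-irrefl {x} = ∈-ind (λ x → ¬ x ∈ x) (λ x ih x∈x → ih x x∈x x∈x) x

  ∈-min : {P : 𝕍 → Set L} → ∃ P → ∃ λ x → P x × (∀ y → y ∈ x → ¬ P y)
  ∈-min {P} (x , px) = stable λ ¬m →
    ∈-ind (λ x → ¬ P x) (λ x ih px → ¬m (x , px , ih)) x px

  abstract
    Ix : 𝕍 → Set ℓ
    Ix (sup A f) = A

    at : (x : 𝕍) → Ix x → 𝕍
    at (sup A f) = f

    at∈ : ∀ x i → at x i ∈ x
    at∈ (sup A f) i = i , ≈refl

    ix : z ∈ x → Σ (Ix x) λ i → z ≈ at x i
    ix {x = sup A f} p = p

    fam : {A : Set ℓ} → (A → 𝕍) → 𝕍
    fam = sup _

    fam⁺ : {A : Set ℓ} (f : A → 𝕍) (a : A) → f a ∈ fam f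
    fam⁺ f a = a , ≈refl

    fam⁻ : {A : Set ℓ} {f : A → 𝕍} → z ∈ fam f → Σ A λ a → z ≈ f a
    fam⁻ p = p

  abstract
    sep : 𝕍 → (𝕍 → Set L) → 𝕍
    sep x P = fam {Σ (Ix x) λ i → Squash (P (at x i))} λ (i , _) → at x i

    sep⊆ : {P : 𝕍 → Set L} → El (sep x P) ⊆ El x
    sep⊆ {x} p = let (i , _) , e = fam⁻ p in ∈-respˡ (≈sym e) (at∈ x i)

    sep⁻ : {P : 𝕍 → Set L} → Resp P → z ∈ sep x P → P z
    sep⁻ r p = let (i , s) , e = fam⁻ p in r (≈sym e) (unsquash s)

    sep⁺ : {P : 𝕍 → Set L} → Resp P → z ∈ x → P z → z ∈ sep x P
    sep⁺ r z∈x pz = let i , e = ix z∈x in ∈-respˡ (≈sym e) (fam⁺ _ (i , squash (r e pz)))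

    ⋃ : 𝕍 → 𝕍
    ⋃ x = fam {Σ (Ix x) λ i → Ix (at x i)} λ (i , j) → at (at x i) j

    ⋃⁺ : y ∈ x → z ∈ y → z ∈ ⋃ x
    ⋃⁺ y∈x z∈y =
      let i , e = ix y∈x ; j , e′ = ix (∈-respʳ e z∈y) in ∈-respˡ (≈sym e′) (fam⁺ _ (i , j))

    ⋃⁻ : z ∈ ⋃ x → ∃ λ y → y ∈ x × z ∈ y
    ⋃⁻ {x = x} p = let (i , j) , e = fam⁻ p in at x i , at∈ x i , ∈-respˡ (≈sym e) (at∈ _ j)

    -- Classically every subset has a characteristic function on the indices, and these functions
    -- form a type in `Set ℓ`.
    𝒫 : 𝕍 → 𝕍
    𝒫 x = fam {Ix x → Bool} λ χ → fam {Σ (Ix x) (T ∘ χ)} λ (i , _) → at x i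

    𝒫⁺ : El z ⊆ El x → z ∈ 𝒫 x
    𝒫⁺ {z} {x} sub = ∈-respˡ (ext bwd fwd) (fam⁺ _ χ)
      where
      χ : Ix x → Bool
      χ i = isYes (emℓ {at x i ∈ z})
      fwd : El z ⊆ El (fam {Σ (Ix x) (T ∘ χ)} λ (i , _) → at x i)
      fwd w∈z = let i , e = ix (sub w∈z) in ∈-respˡ (≈sym e) (fam⁺ _ (i , fromWitness {a? = emℓ} (∈-respˡ e w∈z)))
      bwd : El (fam {Σ (Ix x) (T ∘ χ)} λ (i , _) → at x i) ⊆ El z
      bwd p = let (i , t) , e = fam⁻ p in ∈-respˡ (≈sym e) (toWitness {a? = emℓ} t)

    𝒫⁻ : z ∈ 𝒫 x → El z ⊆ El x
    𝒫⁻ {x = x} p w∈z = let χ , e = fam⁻ p ; (i , _) , e′ = fam⁻ (∈-respʳ e w∈z)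
                       in ∈-respˡ (≈sym e′) (at∈ x i)

    upair : 𝕍 → 𝕍 → 𝕍
    upair x y = fam {Lift ℓ Bool} λ { (lift true) → x ; (lift false) → y }

    upair⁺ˡ : x ∈ upair x y
    upair⁺ˡ = fam⁺ _ (lift true)

    upair⁺ʳ : y ∈ upair x y
    upair⁺ʳ = fam⁺ _ (lift false)

    upair⁻ : z ∈ upair x y → z ≈ x ⊎ z ≈ y
    upair⁻ p with fam⁻ p
    ... | lift true  , e = inj₁ e
    ... | lift false , e = inj₂ e

  upair-cong : x ≈ x′ → y ≈ y′ → upair x y ≈ upair x′ y′
  upair-cong e f = ext (h e f) (h (≈sym e) (≈sym f))
    where
    h : x ≈ x′ → y ≈ y′ → El (upair x y) ⊆ El (upair x′ y′)
    h e f p with upair⁻ p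
    ... | inj₁ q = ∈-respˡ (≈sym (≈trans q e)) upair⁺ˡ
    ... | inj₂ q = ∈-respˡ (≈sym (≈trans q f)) upair⁺ʳ

  sing⁻ : z ∈ upair x x → z ≈ x
  sing⁻ p = [ id , id ]′ (upair⁻ p)

  infixr 6 _∪_
  _∪_ : 𝕍 → 𝕍 → 𝕍
  x ∪ y = ⋃ (upair x y)

  ∪⁺ˡ : El x ⊆ El (x ∪ y)
  ∪⁺ˡ = ⋃⁺ upair⁺ˡ

  ∪⁺ʳ : El y ⊆ El (x ∪ y)
  ∪⁺ʳ = ⋃⁺ upair⁺ʳ

  ∪⁻ : z ∈ x ∪ y → z ∈ x ⊎ z ∈ y
  ∪⁻ p with ⋃⁻ p
  ... | u , u∈ , z∈u with upair⁻ u∈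
  ...   | inj₁ e = inj₁ (∈-respʳ e z∈u)
  ...   | inj₂ e = inj₂ (∈-respʳ e z∈u)

  ⌊_⌋⁺ : 𝕍 → 𝕍
  ⌊ x ⌋⁺ = x ∪ upair x x

  suc⁻ : z ∈ ⌊ x ⌋⁺ → z ∈ x ⊎ z ≈ x
  suc⁻ p with ∪⁻ p
  ... | inj₁ q = inj₁ q
  ... | inj₂ q = inj₂ (sing⁻ q)

  self∈suc : x ∈ ⌊ x ⌋⁺
  self∈suc = ∪⁺ʳ upair⁺ˡ

  pair : 𝕍 → 𝕍 → 𝕍
  pair x y = upair (upair x x) (upair x y)

  pair-cong : x ≈ x′ → y ≈ y′ → pair x y ≈ pair x′ y′
  pair-cong e f = upair-cong (upair-cong e e) (upair-cong e f)

  pair-injˡ : pair x y ≈ pair x′ y′ → x ≈ x′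
  pair-injˡ {x} {y} {x′} {y′} e with upair⁻ {z = upair x x} (∈-respʳ e upair⁺ˡ)
  ... | inj₁ p = ≈sym (sing⁻ (∈-respʳ (≈sym p) upair⁺ˡ))
  ... | inj₂ p = ≈sym (sing⁻ (∈-respʳ (≈sym p) upair⁺ˡ))

  pair-injʳ : pair x y ≈ pair x′ y′ → y ≈ y′
  pair-injʳ {x} {y} {x′} {y′} e = go
    where
    x≈x′ = pair-injˡ e
    -- When {x , y} is matched with the singleton {x′}, so that y = x, only the reverse inclusion
    -- tells where y′ is.
    back : y′ ≈ y ⊎ y′ ≈ x
    back with upair⁻ {z = upair x′ y′} (∈-respʳ (≈sym e) upair⁺ʳ)
    ... | inj₁ p = inj₂ (sing⁻ (∈-respʳ p upair⁺ʳ))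
    ... | inj₂ p = [ inj₂ , inj₁ ]′ (upair⁻ (∈-respʳ p upair⁺ʳ))
    go : y ≈ y′
    go with upair⁻ {z = upair x y} (∈-respʳ e upair⁺ʳ) | back
    ... | _      | inj₁ q = ≈sym q
    ... | inj₁ p | inj₂ q = ≈trans (sing⁻ (∈-respʳ p upair⁺ʳ)) (≈trans (≈sym x≈x′) (≈sym q))
    ... | inj₂ p | inj₂ q with upair⁻ (∈-respʳ p (upair⁺ʳ {y} {x}))
    ...   | inj₁ r = ≈trans r (≈trans (≈sym x≈x′) (≈sym q))
    ...   | inj₂ r = r

  ∈ᶜ⇒∈ : ∀ {c} {C : Pred 𝕍 c} → El x ≐ C → C ∈ᶜ z → x ∈ z
  ∈ᶜ⇒∈ (p , q) (u , u∈z , r , s) = ∈-respˡ (ext (q ∘ r) (s ∘ p)) u∈z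

-- The forcing relation, and bounds for names of functions into a regular ordinal.

module ForcingRelation (ℓ : Level) (em : ExcludedMiddle (lsuc ℓ))
  {P : Set (lsuc ℓ)} (_≤₀_ : P → P → Set (lsuc ℓ))
  (refl₀ : Reflexive _≤₀_) (trans₀ : Transitive _≤₀_) where
  open import Data.Fin.Base using (Fin; zero; suc)
  open import Data.Maybe.Base using (just; nothing)
  open import Data.Nat.Base using (ℕ)
  open import Data.Vec.Functional using (_∷_; [])
  open SetTheory ℓ
  open Sets ℓ em
  open Forcing _≤₀_ public
  open Sup _≤₀_ using (≤⁺-trans) renaming (_≤⁺_ to _≤_; _≤⊤⁺ to ≤⊤; [_] to ⟦_⟧) public

  private variable
    n : ℕ
    p q r : P ⁺
    x y z x′ y′ z′ : Name

  ≤refl : p ≤ p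
  ≤refl {just p}  = ⟦ refl₀ ⟧
  ≤refl {nothing} = ≤⊤ nothing

  ≤trans : p ≤ q → q ≤ r → p ≤ r
  ≤trans = ≤⁺-trans trans₀

  Dense : P ⁺ → (P ⁺ → Set L) → Set L
  Dense p Q = ∀ q → q ≤ p → ∃ λ r → r ≤ q × Q r

  ∈-mono : q ≤ p → p ⊩ x ∈ y → q ⊩ x ∈ y
  ∈-mono {y = name B τ t} q≤p f r r≤q = f r (≤trans r≤q q≤p)

  ≈-mono : q ≤ p → p ⊩ x ≈ y → q ⊩ x ≈ y
  ≈-mono {x = name A σ s} {y = name B τ t} q≤p (f , g) =
      (λ i r r≤q → f i r (≤trans r≤q q≤p))
    , (λ j r r≤q → g j r (≤trans r≤q q≤p))

  ∈-dense : Dense p (λ r → r ⊩ x ∈ y) → p ⊩ x ∈ y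
  ∈-dense {y = name B τ t} d q q≤p =
    let r , r≤q , f = d q q≤p ; r′ , r′≤r , j = f r ≤refl in r′ , ≤trans r′≤r r≤q , j

  ≈-dense : Dense p (λ r → r ⊩ x ≈ y) → p ⊩ x ≈ y
  ≈-dense {x = name A σ s} {y = name B τ t} d =
      (λ i q q≤p q≤s → ∈-dense {y = name B τ t} λ q′ q′≤q →
        let r , r≤q′ , f , _ = d q′ (≤trans q′≤q q≤p)
        in r , r≤q′ , f i r ≤refl (≤trans r≤q′ (≤trans q′≤q q≤s)))
    , (λ j q q≤p q≤t → ∈-dense {y = name A σ s} λ q′ q′≤q →
        let r , r≤q′ , _ , g = d q′ (≤trans q′≤q q≤p)
        in r , r≤q′ , g j r ≤refl (≤trans r≤q′ (≤trans q′≤q q≤t)))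

  ⊩refl : ∀ x → p ⊩ x ≈ x
  ⊩refl (name A σ s) = (λ i q _ q≤s q′ q′≤q → q′ , ≤refl , i , ≤trans q′≤q q≤s , ⊩refl (σ i))
                     , (λ i q _ q≤s q′ q′≤q → q′ , ≤refl , i , ≤trans q′≤q q≤s , ⊩refl (σ i))

  ⊩sym : p ⊩ x ≈ y → p ⊩ y ≈ x
  ⊩sym {x = name A σ s} {y = name B τ t} (f , g) = g , f

  ⊩trans : ∀ x y z → p ⊩ x ≈ y → p ⊩ y ≈ z → p ⊩ x ≈ z
  ⊩trans (name A σ s) (name B τ t) (name C υ u) (f , f′) (g , g′) =
      (λ i q q≤p q≤s q′ q′≤q →
        let r  , r≤q′ , j , r≤t  , e  = f i q q≤p q≤s q′ q′≤q
            r′ , r′≤r , k , r′≤u , e′ = g j r (≤trans r≤q′ (≤trans q′≤q q≤p)) r≤t r ≤refl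
        in r′ , ≤trans r′≤r r≤q′ , k , r′≤u ,
           ⊩trans (σ i) (τ j) (υ k) (≈-mono {x = σ i} {y = τ j} r′≤r e) e′)
    , (λ k q q≤p q≤u q′ q′≤q →
        let r  , r≤q′ , j , r≤t  , e  = g′ k q q≤p q≤u q′ q′≤q
            r′ , r′≤r , i , r′≤s , e′ = f′ j r (≤trans r≤q′ (≤trans q′≤q q≤p)) r≤t r ≤refl
        in r′ , ≤trans r′≤r r≤q′ , i , r′≤s ,
           ⊩trans (υ k) (τ j) (σ i) (≈-mono {x = υ k} {y = τ j} r′≤r e) e′)

  ∈-congʳ : p ⊩ y ≈ y′ → p ⊩ x ∈ y → p ⊩ x ∈ y′
  ∈-congʳ {y = name B τ t} {name C υ u} {x} (f , _) g q q≤p =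
    let r  , r≤q , j , r≤t , e = g q q≤p
        r′ , r′≤r , k , r′≤u , e′ = f j r (≤trans r≤q q≤p) r≤t r ≤refl
    in r′ , ≤trans r′≤r r≤q , k , r′≤u , ⊩trans x (τ j) (υ k) (≈-mono {x = x} {τ j} r′≤r e) e′

  ⊩mono : ∀ (φ : Formula n) {ρ} → q ≤ p → p ⊩ φ [ ρ ] → q ⊩ φ [ ρ ]
  ⊩mono (i ∈̇ j) {ρ} le f = ∈-mono {x = ρ i} {ρ j} le f
  ⊩mono (i ≈̇ j) {ρ} le f = ≈-mono {x = ρ i} {ρ j} le f
  ⊩mono (¬̇ φ) le f r r≤q = f r (≤trans r≤q le)
  ⊩mono (φ ∧̇ ψ) le (f , g) = ⊩mono φ le f , ⊩mono ψ le g
  ⊩mono (∀̇ φ) le f τ = ⊩mono φ le (f τ)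

  ⊩dense : ∀ (φ : Formula n) {ρ} → Dense p (λ r → r ⊩ φ [ ρ ]) → p ⊩ φ [ ρ ]
  ⊩dense (i ∈̇ j) {ρ} d = ∈-dense {x = ρ i} {ρ j} d
  ⊩dense (i ≈̇ j) {ρ} d = ≈-dense {x = ρ i} {ρ j} d
  ⊩dense (¬̇ φ) d q q≤p f = let r , r≤q , g = d q q≤p in g r ≤refl (⊩mono φ r≤q f)
  ⊩dense (φ ∧̇ ψ) d = ⊩dense φ (λ q le → let r , l , f , g = d q le in r , l , f)
                   , ⊩dense ψ (λ q le → let r , l , f , g = d q le in r , l , g)
  ⊩dense (∀̇ φ) d τ = ⊩dense φ (λ q le → let r , l , f = d q le in r , l , f τ)

  ⇒-intro : ∀ (φ ψ : Formula n) {ρ} → (∀ q → q ≤ p → q ⊩ φ [ ρ ] → q ⊩ ψ [ ρ ]) → p ⊩ φ ⇒̇ ψ [ ρ ]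
  ⇒-intro φ ψ f q q≤p (g , ¬ψ) = ¬ψ q ≤refl (f q q≤p g)

  -- An implication abbreviates a negation, so it yields ψ only densely below p; but what is forced
  -- densely is forced.
  ⇒-elim : ∀ (φ ψ : Formula n) {ρ} → p ⊩ φ ⇒̇ ψ [ ρ ] → p ⊩ φ [ ρ ] → p ⊩ ψ [ ρ ]
  ⇒-elim φ ψ f g = ⊩dense ψ λ q q≤p → stable λ n →
    f q q≤p (⊩mono φ q≤p g , λ r r≤q h → n (r , r≤q , h))

  ∃-intro : ∀ (φ : Formula _) {ρ : Fin n → Name} →
            Dense p (λ r → ∃ λ τ → r ⊩ φ [ τ ∷ ρ ]) → p ⊩ ∃̇ φ [ ρ ]
  ∃-intro φ d q q≤p n = let r , r≤q , τ , f = d q q≤p in n τ r r≤q f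

  ∃-elim : ∀ (φ : Formula _) {ρ : Fin n → Name} →
           p ⊩ ∃̇ φ [ ρ ] → Dense p (λ r → ∃ λ τ → r ⊩ φ [ τ ∷ ρ ])
  ∃-elim φ f q q≤p = stable λ n → f q q≤p λ τ r r≤q g → n (r , r≤q , τ , g)

  ∨-intro : ∀ (φ ψ : Formula n) {ρ} →
            Dense p (λ r → (r ⊩ φ [ ρ ]) ⊎ (r ⊩ ψ [ ρ ])) → p ⊩ φ ∨̇ ψ [ ρ ]
  ∨-intro φ ψ d q q≤p (n , m) =
    let r , r≤q , s = d q q≤p in [ n r r≤q , m r r≤q ]′ s

  ∨-elim : ∀ (φ ψ : Formula n) {ρ} →
           p ⊩ φ ∨̇ ψ [ ρ ] → Dense p (λ r → (r ⊩ φ [ ρ ]) ⊎ (r ⊩ ψ [ ρ ]))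
  ∨-elim φ ψ f q q≤p = stable λ n →
    f q q≤p ((λ r r≤q g → n (r , r≤q , inj₁ g)) , (λ r r≤q g → n (r , r≤q , inj₂ g)))

  -- p forces that z = {x , y}.
  record UP (p : P ⁺) (z x y : Name) : Set L where
    field
      out : ∀ {q} w → q ≤ p → q ⊩ w ∈ z → Dense q (λ r → (r ⊩ w ≈ x) ⊎ (r ⊩ w ≈ y))
      inˡ : ∀ {q} w → q ≤ p → q ⊩ w ≈ x → q ⊩ w ∈ z
      inʳ : ∀ {q} w → q ≤ p → q ⊩ w ≈ y → q ⊩ w ∈ z
  open UP

  module _ {i j k : Fin n} {ρ : Fin n → Name} where

    private
      ∈z = zero ∈̇ suc i
      ≈x = zero ≈̇ suc j
      ≈y = zero ≈̇ suc k

    UP-elim : p ⊩ isUPair i j k [ ρ ] → UP p (ρ i) (ρ j) (ρ k)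
    UP-elim f .out w le g = ∨-elim ≈x ≈y {w ∷ ρ} (⇒-elim ∈z (≈x ∨̇ ≈y) {w ∷ ρ} (⊩mono (∈z ⇒̇ ≈x ∨̇ ≈y) {w ∷ ρ} le (proj₁ (f w))) g)
    UP-elim f .inˡ w le g = ⇒-elim (≈x ∨̇ ≈y) ∈z {w ∷ ρ} (⊩mono (≈x ∨̇ ≈y ⇒̇ ∈z) {w ∷ ρ} le (proj₂ (f w)))
      (∨-intro ≈x ≈y {w ∷ ρ} λ r r≤ → r , ≤refl , inj₁ (≈-mono {x = w} {ρ j} r≤ g))
    UP-elim f .inʳ w le g = ⇒-elim (≈x ∨̇ ≈y) ∈z {w ∷ ρ} (⊩mono (≈x ∨̇ ≈y ⇒̇ ∈z) {w ∷ ρ} le (proj₂ (f w)))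
      (∨-intro ≈x ≈y {w ∷ ρ} λ r r≤ → r , ≤refl , inj₂ (≈-mono {x = w} {ρ k} r≤ g))

    UP-intro : UP p (ρ i) (ρ j) (ρ k) → p ⊩ isUPair i j k [ ρ ]
    UP-intro u w =
        ⇒-intro ∈z (≈x ∨̇ ≈y) {w ∷ ρ} (λ q le g → ∨-intro ≈x ≈y {w ∷ ρ} (out u w le g))
      , ⇒-intro (≈x ∨̇ ≈y) ∈z {w ∷ ρ} (λ q le g → ∈-dense {x = w} {ρ i} λ q′ q′≤q →
          case ∨-elim ≈x ≈y {w ∷ ρ} g q′ q′≤q of λ
            { (r , r≤ , inj₁ h) → r , r≤ , inˡ u w (≤trans r≤ (≤trans q′≤q le)) h
            ; (r , r≤ , inj₂ h) → r , r≤ , inʳ u w (≤trans r≤ (≤trans q′≤q le)) h })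

  UP-cong : p ⊩ z ≈ z′ → UP p z x y → UP p z′ x y
  UP-cong {z = z} {z′} e u .out w le f = out u w le (∈-congʳ {y = z′} {z} {w} (⊩sym {x = z} (≈-mono {x = z} {z′} le e)) f)
  UP-cong {z = z} {z′} e u .inˡ w le f = ∈-congʳ {y = z} {z′} {w} (≈-mono {x = z} {z′} le e) (inˡ u w le f)
  UP-cong {z = z} {z′} e u .inʳ w le f = ∈-congʳ {y = z} {z′} {w} (≈-mono {x = z} {z′} le e) (inʳ u w le f)

  upairⁿ : Name → Name → Name
  upairⁿ x y = name (Lift ℓ Bool) (λ { (lift true) → x ; (lift false) → y }) (λ _ → ⊤⁺)

  upairⁿ-UP : UP p (upairⁿ x y) x y
  upairⁿ-UP .out w le f q q≤ = case f q q≤ of λ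
    { (r , r≤ , lift true  , _ , e) → r , r≤ , inj₁ e
    ; (r , r≤ , lift false , _ , e) → r , r≤ , inj₂ e }
  upairⁿ-UP {x = x} .inˡ w le e q q≤ = q , ≤refl , lift true , ≤⊤ q , ≈-mono {x = w} {x} q≤ e
  upairⁿ-UP {y = y} .inʳ w le e q q≤ = q , ≤refl , lift false , ≤⊤ q , ≈-mono {x = w} {y} q≤ e

  upairⁿ-cong : p ⊩ x ≈ x′ → p ⊩ y ≈ y′ → p ⊩ upairⁿ x y ≈ upairⁿ x′ y′
  upairⁿ-cong {x = x} {x′} {y} {y′} e f =
      (λ { (lift true)  q q≤ _ → inˡ {z = upairⁿ x′ y′} {x′} {y′} upairⁿ-UP x q≤ (≈-mono {x = x} {x′} q≤ e)
         ; (lift false) q q≤ _ → inʳ {z = upairⁿ x′ y′} {x′} {y′} upairⁿ-UP y q≤ (≈-mono {x = y} {y′} q≤ f) })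
    , (λ { (lift true)  q q≤ _ → inˡ {z = upairⁿ x y} {x} {y} upairⁿ-UP x′ q≤ (⊩sym {x = x} (≈-mono {x = x} {x′} q≤ e))
         ; (lift false) q q≤ _ → inʳ {z = upairⁿ x y} {x} {y} upairⁿ-UP y′ q≤ (⊩sym {x = y} (≈-mono {x = y} {y′} q≤ f)) })

  pairⁿ : Name → Name → Name
  pairⁿ x y = upairⁿ (upairⁿ x x) (upairⁿ x y)

  isPair-intro : {i j k : Fin n} {ρ : Fin n → Name} → p ⊩ ρ i ≈ pairⁿ (ρ j) (ρ k) → p ⊩ isPair i j k [ ρ ]
  isPair-intro {i = i} {j} {k} {ρ} e =
    ∃-intro (∃̇ body) {ρ} λ q q≤ → q , ≤refl , s ,
    ∃-intro body {s ∷ ρ} λ q′ q′≤ → q′ , ≤refl , d ,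
    UP-intro {i = suc zero} {suc (suc j)} {suc (suc j)} {ρ₂} upairⁿ-UP ,
    UP-intro {i = zero} {suc (suc j)} {suc (suc k)} {ρ₂} upairⁿ-UP ,
    UP-intro {i = suc (suc i)} {suc zero} {zero} {ρ₂}
      (UP-cong {z = pairⁿ (ρ j) (ρ k)} {ρ i} (⊩sym {x = ρ i} (≈-mono {x = ρ i} {pairⁿ (ρ j) (ρ k)} (≤trans q′≤ q≤) e)) upairⁿ-UP)
    where
    s = upairⁿ (ρ j) (ρ j)
    d = upairⁿ (ρ j) (ρ k)
    ρ₂ = d ∷ s ∷ ρ
    body = isUPair (suc zero) (suc (suc j)) (suc (suc j))
         ∧̇ isUPair zero (suc (suc j)) (suc (suc k)) ∧̇ isUPair (suc (suc i)) (suc zero) zero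

  module _ {z s d a b s′ d′ a′ b′ : Name} where

    -- The argument of `pair-injˡ` and `pair-injʳ`, carried out below p. Every case distinction
    -- costs an extension of the condition, so the equalities are reached only at some r ≤ p.
    UP-pair-inj : UP p z s d → UP p s a a → UP p d a b → UP p z s′ d′ → UP p s′ a′ a′ → UP p d′ a′ b′ →
                  ∃ λ r → r ≤ p × (r ⊩ a ≈ a′) × (r ⊩ b ≈ b′)
    UP-pair-inj {p} uz us ud uz′ us′ ud′ =
      let q , q≤ , e = a≈a′ ; r , r≤ , f = b≈b′ q q≤ e
      in r , ≤trans r≤ q≤ , ≈-mono {x = a} {a′} r≤ e , f
      where
      sgl : ∀ {q S c w} → UP p S c c → q ≤ p → q ⊩ w ∈ S → ∃ λ r → r ≤ q × (r ⊩ w ≈ c)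
      sgl {q} {S} {c} {w} u le f with out u w le f q ≤refl
      ... | r , r≤ , inj₁ e = r , r≤ , e
      ... | r , r≤ , inj₂ e = r , r≤ , e

      flip∈ : ∀ {q A B w} → q ⊩ A ≈ B → q ⊩ w ∈ B → q ⊩ w ∈ A
      flip∈ {A = A} {B} {w} e f = ∈-congʳ {y = B} {A} {w} (⊩sym {x = A} e) f

      a≈a′ : ∃ λ r → r ≤ p × (r ⊩ a ≈ a′)
      a≈a′ with out uz′ s ≤refl (inˡ uz s ≤refl (⊩refl s)) p ≤refl
      ... | q , q≤ , inj₁ e =
        let r , r≤ , f = sgl us q≤ (flip∈ {A = s} {s′} {a′} e (inˡ us′ a′ q≤ (⊩refl a′)))
        in r , ≤trans r≤ q≤ , ⊩sym {x = a′} f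
      ... | q , q≤ , inj₂ e =
        let r , r≤ , f = sgl us q≤ (flip∈ {A = s} {d′} {a′} e (inˡ ud′ a′ q≤ (⊩refl a′)))
        in r , ≤trans r≤ q≤ , ⊩sym {x = a′} f

      module _ (q : P ⁺) (q≤ : q ≤ p) (e : q ⊩ a ≈ a′) where
        Back : P ⁺ → Set L
        Back r = (r ⊩ b′ ≈ b) ⊎ (r ⊩ b′ ≈ a)

        back : ∃ λ r → r ≤ q × Back r
        back with out uz d′ q≤ (inʳ uz′ d′ q≤ (⊩refl d′)) q ≤refl
        ... | r , r≤ , inj₁ f =
          let r′ , r′≤ , g = sgl us (≤trans r≤ q≤) (∈-congʳ {y = d′} {s} {b′} f (inʳ ud′ b′ (≤trans r≤ q≤) (⊩refl b′)))
          in r′ , ≤trans r′≤ r≤ , inj₂ g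
        ... | r , r≤ , inj₂ f with out ud b′ (≤trans r≤ q≤) (∈-congʳ {y = d′} {d} {b′} f (inʳ ud′ b′ (≤trans r≤ q≤) (⊩refl b′))) r ≤refl
        ...   | r′ , r′≤ , inj₁ g = r′ , ≤trans r′≤ r≤ , inj₂ g
        ...   | r′ , r′≤ , inj₂ g = r′ , ≤trans r′≤ r≤ , inj₁ g

        b≈b′ : ∃ λ r → r ≤ q × (r ⊩ b ≈ b′)
        b≈b′ with back
        ... | r , r≤ , inj₁ g = r , r≤ , ⊩sym {x = b′} g
        ... | r , r≤ , inj₂ g with out uz′ d (≤trans r≤ q≤) (inʳ uz d (≤trans r≤ q≤) (⊩refl d)) r ≤refl
        ...   | r₁ , r₁≤ , inj₁ h =
          let le = ≤trans r₁≤ (≤trans r≤ q≤)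
              r₂ , r₂≤ , k = sgl us′ le (∈-congʳ {y = d} {s′} {b} h (inʳ ud b le (⊩refl b)))
              le′ = ≤trans r₂≤ r₁≤
          in r₂ , ≤trans le′ r≤ , ⊩trans b a′ b′ k (⊩trans a′ a b′
               (⊩sym {x = a} (≈-mono {x = a} {a′} (≤trans le′ r≤) e)) (⊩sym {x = b′} (≈-mono {x = b′} {a} le′ g)))
        ...   | r₁ , r₁≤ , inj₂ h with out ud′ b (≤trans r₁≤ (≤trans r≤ q≤))
                                          (∈-congʳ {y = d} {d′} {b} h (inʳ ud b (≤trans r₁≤ (≤trans r≤ q≤)) (⊩refl b))) r₁ ≤refl
        ...     | r₂ , r₂≤ , inj₂ k = r₂ , ≤trans r₂≤ (≤trans r₁≤ r≤) , k
        ...     | r₂ , r₂≤ , inj₁ k =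
          let le′ = ≤trans r₂≤ r₁≤
          in r₂ , ≤trans le′ r≤ , ⊩trans b a′ b′ k (⊩trans a′ a b′
               (⊩sym {x = a} (≈-mono {x = a} {a′} (≤trans le′ r≤) e)) (⊩sym {x = b′} (≈-mono {x = b′} {a} le′ g)))

  isPair-elim : {i j k : Fin n} {ρ : Fin n → Name} {a b : Name} →
                p ⊩ isPair i j k [ ρ ] → p ⊩ ρ i ≈ pairⁿ a b → Dense p (λ r → (r ⊩ a ≈ ρ j) × (r ⊩ b ≈ ρ k))
  isPair-elim {i = i} {j} {k} {ρ} {a} {b} f e q q≤ =
    let q₁ , q₁≤ , s , f₁ = ∃-elim (∃̇ body) {ρ} f q q≤
        q₂ , q₂≤ , d , g , h , l = ∃-elim body {s ∷ ρ} f₁ q₁ ≤refl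
        le = ≤trans q₂≤ (≤trans q₁≤ q≤)
        r , r≤ , u , v = UP-pair-inj {z = ρ i} (UP-cong {z = pairⁿ a b} {ρ i} (⊩sym {x = ρ i} (≈-mono {x = ρ i} {pairⁿ a b} le e)) upairⁿ-UP)
                           upairⁿ-UP upairⁿ-UP
                           (UP-elim {i = suc (suc i)} {suc zero} {zero} {d ∷ s ∷ ρ} l)
                           (UP-elim {i = suc zero} {suc (suc j)} {suc (suc j)} {d ∷ s ∷ ρ} g)
                           (UP-elim {i = zero} {suc (suc j)} {suc (suc k)} {d ∷ s ∷ ρ} h)
    in r , ≤trans r≤ (≤trans q₂≤ q₁≤) , u , v
    where
    body = isUPair (suc zero) (suc (suc j)) (suc (suc j))
         ∧̇ isUPair zero (suc (suc j)) (suc (suc k)) ∧̇ isUPair (suc (suc i)) (suc zero) zero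

  check-≈⁺ : ∀ x y → x ≈ y → p ⊩ check x ≈ check y
  check-≈⁺ (sup A f) (sup B g) (h , k) =
      (λ i q _ _ q′ _ → q′ , ≤refl , proj₁ (h i) , ≤⊤ q′ , check-≈⁺ (f i) (g (proj₁ (h i))) (proj₂ (h i)))
    , (λ j q _ _ q′ _ → q′ , ≤refl , proj₁ (k j) , ≤⊤ q′ ,
         check-≈⁺ (g j) (f (proj₁ (k j))) (≈sym {x = f (proj₁ (k j))} (proj₂ (k j))))

  check-∈⁺ : ∀ x y → x ∈ y → p ⊩ check x ∈ check y
  check-∈⁺ x (sup B g) (b , e) q q≤ = q , ≤refl , b , ≤⊤ q , check-≈⁺ x (g b) e

  -- All labels in a check name are `⊤⁺`, so every condition produces an actual index of a matching
  -- member, and the claim reduces to the members.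
  check-≈⁻ : ∀ x y → p ⊩ check x ≈ check y → x ≈ y
  check-≈⁻ {p} (sup A f) (sup B g) (h , k) =
      (λ i → let r , _ , j , _ , e = h i p ≤refl (≤⊤ p) p ≤refl in j , check-≈⁻ (f i) (g j) e)
    , (λ j → let r , _ , i , _ , e = k j p ≤refl (≤⊤ p) p ≤refl
             in i , ≈sym {x = g j} (check-≈⁻ (g j) (f i) e))

  check-∈⁻ : ∀ x y → p ⊩ check x ∈ check y → x ∈ y
  check-∈⁻ {p} x (sup B g) f = let r , _ , j , _ , e = f p ≤refl in j , check-≈⁻ x (g j) e

  check-∈-elim : ∀ {p τ} x → p ⊩ τ ∈ check x → Dense p (λ r → ∃ λ y → y ∈ x × (r ⊩ τ ≈ check y))
  check-∈-elim (sup A f) g q le = let r , r≤ , j , _ , e = g q le in r , r≤ , f j , (j , ≈refl) , e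

  -- D i α q says that q decides the value at i of a name for a partial
  -- function to be α; it is made total with the default value o.
  module Bound {Ω δ o : 𝕍} (Ω∈δ : Ω ∈ δ) (o∈δ : o ∈ δ)
    (regular : ⊤⁺ ⊩ isRegular zero [ check δ ∷ [] ])
    (p₀ : P) {C : Set ℓ} (c : C → P) (cover : ∀ q → ∃ λ j → q ≤₀ c j × c j ≤₀ q)
    (D : 𝕍 → 𝕍 → P → Set L)
    (D-resp : ∀ {i i′ α α′ q} → i ≈ i′ → α ≈ α′ → D i α q → D i′ α′ q)
    (D-mono : ∀ {i α q q′} → q′ ≤₀ q → D i α q → D i α q′)
    (D-func : ∀ {i α α′ q} → α ∈ δ → α′ ∈ δ → D i α q → D i α′ q → α ≈ α′)
    where

    private
      E : 𝕍 → 𝕍 → P → Set L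
      E i α q = D i α q ⊎ (α ≈ o × ∀ q′ → q′ ≤₀ q → ∀ α′ → α′ ∈ δ → ¬ D i α′ q′)

      E-resp : ∀ {i i′ α α′ q} → i ≈ i′ → α ≈ α′ → E i α q → E i′ α′ q
      E-resp e f (inj₁ d) = inj₁ (D-resp e f d)
      E-resp e f (inj₂ (g , n)) = inj₂ (≈trans (≈sym f) g , λ q′ le α′ α′∈ d → n q′ le α′ α′∈ (D-resp (≈sym e) ≈refl d))

      E-mono : ∀ {i α q q′} → q′ ≤₀ q → E i α q → E i α q′
      E-mono le (inj₁ d) = inj₁ (D-mono le d)
      E-mono le (inj₂ (e , n)) = inj₂ (e , λ q″ le′ → n q″ (trans₀ le′ le))

      E-func : ∀ {i α α′ q} → α ∈ δ → α′ ∈ δ → E i α q → E i α′ q → α ≈ α′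
      E-func a a′ (inj₁ d) (inj₁ d′) = D-func a a′ d d′
      E-func a a′ (inj₁ d) (inj₂ (_ , n)) = contradiction d (n _ refl₀ _ a)
      E-func a a′ (inj₂ (_ , n)) (inj₁ d) = contradiction d (n _ refl₀ _ a′)
      E-func a a′ (inj₂ (e , _)) (inj₂ (e′ , _)) = ≈trans e (≈sym e′)

      E-dense : ∀ i q → ∃ λ r → r ≤₀ q × ∃ λ α → α ∈ δ × E i α r
      E-dense i q with em {∃ λ r → r ≤₀ q × ∃ λ α → α ∈ δ × D i α r}
      ... | yes (r , le , α , a , d) = r , le , α , a , inj₁ d
      ... | no n = q , refl₀ , o , o∈δ , inj₂ (≈refl , λ q′ le α′ a d → n (q′ , le , α′ , a , d))

      -- `D` and `E` speak of conditions in `P` only, so the adjoined `⊤⁺` has to be strengthened,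
      -- and `p₀` is at hand for this.
      below : ∀ q → ∃ λ r → just r ≤ q
      below (just q) = q , ≤refl
      below nothing  = p₀ , ≤⊤ _

      -- The name contains ⟨i , α⟩ with label `c j` whenever E i α holds at `c j`. The small family
      -- `c` of representatives stands for `P`, because names are indexed by types in `Set ℓ`.
      J : Set ℓ
      J = Σ (Ix Ω) λ i → Σ (Ix δ) λ α → Σ C λ j → Squash (E (at Ω i) (at δ α) (c j))

      ḟ : Name
      ḟ = name J (λ (i , α , _) → pairⁿ (check (at Ω i)) (check (at δ α))) (λ (_ , _ , j , _) → just (c j))

      Ω̌ δ̌ : Name
      Ω̌ = check Ω
      δ̌ = check δ

      ∈ḟ : ∀ {i α q} → i ∈ Ω → α ∈ δ → E i α q → just q ⊩ pairⁿ (check i) (check α) ∈ ḟ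
      ∈ḟ {i} {α} {q} i∈ α∈ e q′ le =
        let i′ , ei = ix i∈ ; α′ , eα = ix α∈ ; j , q≤ , ≤q = cover q
            s = squash (E-resp ei eα (E-mono ≤q e))
            ěi = check-≈⁺ i (at Ω i′) ei
            ěα = check-≈⁺ α (at δ α′) eα
        in q′ , ≤refl , (i′ , α′ , j , s) , ≤trans le ⟦ q≤ ⟧ ,
           upairⁿ-cong (upairⁿ-cong ěi ěi) (upairⁿ-cong ěi ěα)

      maps⁺ : ∀ {n i α q} {ρ : Fin n → Name} {a b k : Fin n} → i ∈ Ω → α ∈ δ → E i α q →
              just q ⊩ ρ k ≈ ḟ → just q ⊩ ρ a ≈ check i → just q ⊩ ρ b ≈ check α →
              just q ⊩ maps k a b [ ρ ]
      maps⁺ {i = i} {α} {q} {ρ} {a} {b} {k} i∈ α∈ e ek ea eb =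
        ∃-intro (zero ∈̇ suc k ∧̇ isPair zero (suc a) (suc b)) {ρ} λ r le →
          r , ≤refl , u ,
          ∈-congʳ {y = ḟ} {ρ k} {u} (⊩sym {x = ρ k} (≈-mono {x = ρ k} {ḟ} le ek)) (∈-mono {x = u} {ḟ} le (∈ḟ i∈ α∈ e)) ,
          isPair-intro {i = zero} {suc a} {suc b} {u ∷ ρ}
            (upairⁿ-cong (upairⁿ-cong (ea′ le) (ea′ le)) (upairⁿ-cong (ea′ le) (eb′ le)))
        where
        u = pairⁿ (check i) (check α)
        ea′ : ∀ {r} → r ≤ just q → r ⊩ check i ≈ ρ a
        ea′ le = ⊩sym {x = ρ a} (≈-mono {x = ρ a} {check i} le ea)
        eb′ : ∀ {r} → r ≤ just q → r ⊩ check α ≈ ρ b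
        eb′ le = ⊩sym {x = ρ b} (≈-mono {x = ρ b} {check α} le eb)

      ∈ḟ⁻ : ∀ {p z} → p ⊩ z ∈ ḟ → Dense p (λ r → ∃ λ q → r ≤ just q × ∃ λ i → ∃ λ α →
            i ∈ Ω × α ∈ δ × E i α q × (r ⊩ z ≈ pairⁿ (check i) (check α)))
      ∈ḟ⁻ f q le = let r , r≤ , (i , α , j , s) , r≤c , e = f q le
                   in r , r≤ , c j , r≤c , at Ω i , at δ α , at∈ Ω i , at∈ δ α , unsquash s , e

      maps⁻ : ∀ {n p} {ρ : Fin n → Name} {a b k : Fin n} → p ⊩ ρ k ≈ ḟ → p ⊩ maps k a b [ ρ ] →
              Dense p (λ r → ∃ λ q → r ≤ just q × ∃ λ i → ∃ λ α →
              i ∈ Ω × α ∈ δ × E i α q × (r ⊩ check i ≈ ρ a) × (r ⊩ check α ≈ ρ b))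
      maps⁻ {ρ = ρ} {a} {b} {k} ek f q le =
        let q₁ , q₁≤ , z , z∈ , zp = ∃-elim (zero ∈̇ suc k ∧̇ isPair zero (suc a) (suc b)) {ρ} f q le
            ek′ = ≈-mono {x = ρ k} {ḟ} (≤trans q₁≤ le) ek
            q₂ , q₂≤ , u , q₂≤u , i , α , i∈ , α∈ , e , ez = ∈ḟ⁻ (∈-congʳ {y = ρ k} {ḟ} {z} ek′ z∈) q₁ ≤refl
            zp′ = ⊩mono (isPair zero (suc a) (suc b)) {z ∷ ρ} q₂≤ zp
            r , r≤ , e₁ , e₂ = isPair-elim {i = zero} {suc a} {suc b} {z ∷ ρ} {check i} {check α} zp′ ez q₂ ≤refl
        in r , ≤trans r≤ (≤trans q₂≤ q₁≤) , u , ≤trans r≤ q₂≤u , i , α , i∈ , α∈ , e , e₁ , e₂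

      ρ₀ : Fin 3 → Name
      ρ₀ = ḟ ∷ Ω̌ ∷ δ̌ ∷ []

      pairs-φ : Formula 3
      pairs-φ = ∀∈̇ zero (∃∈̇ (suc (suc zero)) (∃∈̇ (suc (suc (suc (suc zero)))) (isPair (suc (suc zero)) (suc zero) zero)))

      total-φ : Formula 3
      total-φ = ∀∈̇ (suc zero) (∃∈̇ (suc (suc (suc zero))) (maps (suc (suc zero)) (suc zero) zero
                  ∧̇ ∀̇ (maps (suc (suc (suc zero))) (suc (suc zero)) zero ⇒̇ zero ≈̇ suc zero)))

      pairs : ⊤⁺ ⊩ pairs-φ [ ρ₀ ]
      pairs z = ⇒-intro (zero ∈̇ suc zero) φ₁ {z ∷ ρ₀} λ p _ f → ⊩dense φ₁ {z ∷ ρ₀} λ p′ p′≤ →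
        let r , r≤ , _ , _ , i , α , i∈ , α∈ , _ , e = ∈ḟ⁻ f p′ p′≤
        in r , r≤ , ∃-intro (zero ∈̇ suc (suc (suc zero)) ∧̇ φ₂) {z ∷ ρ₀} λ q q≤ → q , ≤refl , check i , check-∈⁺ i Ω i∈ ,
           ∃-intro (zero ∈̇ suc (suc (suc (suc (suc zero)))) ∧̇ φ₃) {check i ∷ z ∷ ρ₀} λ q′ q′≤ → q′ , ≤refl , check α , check-∈⁺ α δ α∈ ,
           isPair-intro {i = suc (suc zero)} {suc zero} {zero} {check α ∷ check i ∷ z ∷ ρ₀}
             (≈-mono {x = z} {pairⁿ (check i) (check α)} (≤trans q′≤ q≤) e)
        where
        φ₃ = isPair (suc (suc zero)) (suc zero) zero
        φ₂ = ∃∈̇ (suc (suc (suc (suc zero)))) φ₃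
        φ₁ = ∃∈̇ (suc (suc zero)) φ₂

      total : ⊤⁺ ⊩ total-φ [ ρ₀ ]
      total x = ⇒-intro (zero ∈̇ suc (suc zero)) φ₁ {x ∷ ρ₀} λ p _ f → ⊩dense φ₁ {x ∷ ρ₀} λ p′ p′≤ →
        let p₁ , p₁≤ , i , i∈ , ex = check-∈-elim Ω f p′ p′≤
            b , b≤ = below p₁
            r , r≤ , α , α∈ , d = E-dense i b
            r≤p₁ = ≤trans ⟦ r≤ ⟧ b≤
        in just r , ≤trans r≤p₁ p₁≤ ,
           ∃-intro (zero ∈̇ suc (suc (suc (suc zero))) ∧̇ φ₂) {x ∷ ρ₀} λ q q≤ → q , ≤refl , check α , check-∈⁺ α δ α∈ ,
           ⊩mono φ₃ {check α ∷ x ∷ ρ₀} q≤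
             (maps⁺ {ρ = check α ∷ x ∷ ρ₀} {suc zero} {zero} {suc (suc zero)} i∈ α∈ d (⊩refl ḟ)
               (≈-mono {x = x} {check i} r≤p₁ ex) (⊩refl (check α))) ,
           λ y → ⇒-intro φ₄ (zero ≈̇ suc zero) {y ∷ check α ∷ x ∷ ρ₀} λ s s≤ g →
             ≈-dense {x = y} {check α} λ s′ s′≤ →
               let t , t≤ , u , t≤u , i′ , α′ , i′∈ , α′∈ , e′ , ei , eα =
                     maps⁻ {ρ = y ∷ check α ∷ x ∷ ρ₀} {suc (suc zero)} {zero} {suc (suc (suc zero))} (⊩refl ḟ) g s′ s′≤
                   t≤r  = ≤trans t≤ (≤trans s′≤ (≤trans s≤ q≤))
                   i′≈i = check-≈⁻ i′ i (⊩trans (check i′) x (check i) ei (≈-mono {x = x} {check i} (≤trans t≤r r≤p₁) ex))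
               in t , t≤ , ⊩trans y (check α′) (check α) (⊩sym {x = check α′} eα)
                    (check-≈⁺ α′ α (agree t≤u t≤r α′∈ α∈ (E-resp i′≈i ≈refl e′) d))
        where
        φ₄ = maps (suc (suc (suc zero))) (suc (suc zero)) zero
        φ₃ = maps (suc (suc zero)) (suc zero) zero
        φ₂ = φ₃ ∧̇ ∀̇ (φ₄ ⇒̇ zero ≈̇ suc zero)
        φ₁ = ∃∈̇ (suc (suc (suc zero))) φ₂
        agree : ∀ {t u r i α′ α} → t ≤ just u → t ≤ just r → α′ ∈ δ → α ∈ δ → E i α′ u → E i α r → α′ ≈ α
        agree {just t} ⟦ t≤u ⟧ ⟦ t≤r ⟧ a a′ d d′ = E-func a a′ (E-mono t≤u d) (E-mono t≤r d′)

      fun-φ bdd-φ : Formula 3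
      fun-φ = isFunction zero (suc zero) (suc (suc zero))
      bdd₂-φ : Formula 4
      bdd₃-φ : Formula 5
      bdd₃-φ = ∀̇ (maps (suc (suc (suc zero))) (suc zero) zero ⇒̇ zero ∈̇ suc (suc zero))
      bdd₂-φ = ∀∈̇ (suc (suc zero)) bdd₃-φ
      bdd-φ = ∃∈̇ (suc (suc zero)) bdd₂-φ

    -- Regularity in the extension, applied to `ḟ`, gives a bound of its range. Some condition p
    -- decides this bound as β, and below p every decided value is a value of `ḟ`.
    bound : ∃ λ β → β ∈ δ × ∃ λ p → ∀ q → q ≤₀ p → ∀ i α → i ∈ Ω → α ∈ δ → D i α q → α ∈ β
    bound =
      let f₁ = ⇒-elim (zero ∈̇ suc zero) (∀̇ (fun-φ ⇒̇ bdd-φ)) {Ω̌ ∷ δ̌ ∷ []} (proj₂ regular Ω̌) (check-∈⁺ Ω δ Ω∈δ)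
          f₂ = ⇒-elim fun-φ bdd-φ {ρ₀} (f₁ ḟ) (pairs , total)
          q , _ , τ , τ∈ , f₃ = ∃-elim (zero ∈̇ suc (suc (suc zero)) ∧̇ bdd₂-φ) {ρ₀} f₂ ⊤⁺ ≤refl
          q′ , q′≤ , β , β∈ , e = check-∈-elim δ τ∈ q ≤refl
          p , p≤ = below q′
      in β , β∈ , p , λ r r≤ i α i∈ α∈ d →
        let r≤′ = ≤trans ⟦ r≤ ⟧ p≤
            f₄ = ⇒-elim (zero ∈̇ suc (suc (suc zero))) bdd₃-φ {check i ∷ τ ∷ ρ₀}
                   (⊩mono bdd₂-φ {τ ∷ ρ₀} (≤trans r≤′ q′≤) f₃ (check i)) (check-∈⁺ i Ω i∈)
            f₅ = ⇒-elim (maps (suc (suc (suc zero))) (suc zero) zero) (zero ∈̇ suc (suc zero)) {check α ∷ check i ∷ τ ∷ ρ₀}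
                   (f₄ (check α))
                   (maps⁺ {ρ = check α ∷ check i ∷ τ ∷ ρ₀} {suc zero} {zero} {suc (suc (suc zero))} i∈ α∈ (inj₁ d)
                     (⊩refl ḟ) (⊩refl (check i)) (⊩refl (check α)))
        in check-∈⁻ α β (∈-congʳ {y = τ} {check β} {check α} (≈-mono {x = τ} {check β} r≤′ e) f₅)

-- Injective codes for pairs of numbers and for finite binary sequences.

module Coding where
  open import Data.List.Base using (List; []; _∷_)
  open import Data.Nat.Base using (ℕ; zero; suc)
  open import Data.Nat.Properties using (suc-injective)
  double : ℕ → ℕ
  double zero    = zero
  double (suc n) = suc (suc (double n))

  double-injective : ∀ {m n} → double m ≡ double n → m ≡ n
  double-injective {zero}  {zero}  _ = refl
  double-injective {suc m} {suc n} e = cong suc (double-injective (suc-injective (suc-injective e)))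

  double≢odd : ∀ {m n} → ¬ double m ≡ suc (double n)
  double≢odd {suc m} {suc n} e = double≢odd {m} {n} (suc-injective (suc-injective e))

  -- 2ᵐ (2n + 1)
  code : ℕ → ℕ → ℕ
  code zero    n = suc (double n)
  code (suc m) n = double (code m n)

  code-injective : ∀ {m n m′ n′} → code m n ≡ code m′ n′ → m ≡ m′ × n ≡ n′
  code-injective {zero}  {m′ = zero}  e = refl , double-injective (suc-injective e)
  code-injective {zero}  {n} {suc m′} {n′} e = contradiction (sym e) (double≢odd {code m′ n′} {n})
  code-injective {suc m} {n} {zero}   {n′} e = contradiction e (double≢odd {code m n} {n′})
  code-injective {suc m} {m′ = suc m′} e =
    let p , q = code-injective {m} {m′ = m′} (double-injective e) in cong suc p , q

  code≢0 : ∀ {m n} → ¬ code m n ≡ zero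
  code≢0 {suc m} {n} e = code≢0 {m} {n} (double-injective {n = zero} e)

  bit : Bool → ℕ
  bit false = zero
  bit true  = suc zero

  codeList : List Bool → ℕ
  codeList []       = zero
  codeList (b ∷ bs) = code (suc (bit b)) (codeList bs)

  codeList-injective : ∀ {bs bs′} → codeList bs ≡ codeList bs′ → bs ≡ bs′
  codeList-injective {[]} {[]} e = refl
  codeList-injective {[]} {b ∷ bs} e = contradiction (sym e) (code≢0 {suc (bit b)} {codeList bs})
  codeList-injective {b ∷ bs} {[]} e = contradiction e (code≢0 {suc (bit b)} {codeList bs})
  codeList-injective {false ∷ bs} {false ∷ bs′} e = cong (false ∷_) (codeList-injective (proj₂ (code-injective {1} {codeList bs} {1} e)))
  codeList-injective {true ∷ bs} {true ∷ bs′} e = cong (true ∷_) (codeList-injective (proj₂ (code-injective {2} {codeList bs} {2} e)))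
  codeList-injective {false ∷ bs} {true ∷ bs′} e with () ← proj₁ (code-injective {1} {codeList bs} {2} e)
  codeList-injective {true ∷ bs} {false ∷ bs′} e with () ← proj₁ (code-injective {2} {codeList bs} {1} e)

-- Ordinals, countable sets, and the cardinals ω₁ and ω₂.

module Ordinals (ℓ : Level) (em : ExcludedMiddle (lsuc ℓ)) where
  open import Data.Unit.Base using (tt)
  open import Data.Nat.Base using (ℕ; zero; suc; _<_)
  open import Data.Nat.Induction using (<-rec)
  open import Data.Nat.Properties using (<-cmp; m<1+n⇒m<n∨m≡n)
  open import Relation.Binary.Definitions using (tri<; tri≈; tri>)
  open SetTheory ℓ
  open Sets ℓ em
  open Coding

  private variable
    a b c d : Level
    x y z α β : 𝕍
    C : Pred 𝕍 a
    D : Pred 𝕍 b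

  Ord : 𝕍 → Set L
  Ord x = IsTransitive x × (∀ y → y ∈ x → IsTransitive y)

  IsOrdinal⇒Ord : IsOrdinal x → Ord x
  IsOrdinal⇒Ord (t , e) =
      (λ y y∈x z∈y → lower (¬×¬⇒→ (¬×¬⇒→ (t (y , tt)) (lift y∈x) (_ , tt)) (lift z∈y)))
    , (λ y y∈x z z∈y w∈z → lower (¬×¬⇒→ (¬×¬⇒→ (¬×¬⇒→ (e (y , tt)) (lift y∈x) (z , tt)) (lift z∈y) (_ , tt)) (lift w∈z)))

  Ord⇒IsOrdinal : Ord x → IsOrdinal x
  Ord⇒IsOrdinal (t , e) =
      (λ (y , _) → →⇒¬×¬ λ (lift y∈x) (z , _) → →⇒¬×¬ λ (lift z∈y) → lift (t y y∈x z∈y))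
    , (λ (y , _) → →⇒¬×¬ λ (lift y∈x) (z , _) → →⇒¬×¬ λ (lift z∈y) (w , _) → →⇒¬×¬ λ (lift w∈z) →
         lift (e y y∈x z z∈y w∈z))

  IsTransitive-resp : Resp IsTransitive
  IsTransitive-resp e t y y∈ z∈ = ∈-respʳ e (t y (∈-respʳ (≈sym e) y∈) z∈)

  Ord-resp : Resp Ord
  Ord-resp e (t , h) = IsTransitive-resp e t , λ y y∈ → h y (∈-respʳ (≈sym e) y∈)

  Ord-∈ : Ord x → y ∈ x → Ord y
  Ord-∈ {y = y} (t , h) y∈x = h y y∈x , λ z z∈y → h z (t y y∈x z∈y)

  Ord-trans : Ord x → y ∈ x → z ∈ y → z ∈ x
  Ord-trans (t , _) y∈ z∈ = t _ y∈ z∈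

  Tri : 𝕍 → 𝕍 → Set ℓ
  Tri x y = x ∈ y ⊎ x ≈ y ⊎ y ∈ x

  tri : Ord x → Ord y → Tri x y
  tri {x} {y} ox oy = ∈-ind (λ x → Ord x → ∀ y → Ord y → Tri x y) outer x ox y oy
    where
    outer : ∀ x → (∀ z → z ∈ x → Ord z → ∀ y → Ord y → Tri z y) → Ord x → ∀ y → Ord y → Tri x y
    outer x ihx ox = ∈-ind (λ y → Ord y → Tri x y) inner
      where
      inner : ∀ y → (∀ w → w ∈ y → Ord w → Tri x w) → Ord y → Tri x y
      inner y ihy oy with em {∃ λ z → z ∈ x × ¬ z ∈ y} | em {∃ λ w → w ∈ y × ¬ w ∈ x}
      ... | yes (z , z∈x , z∉y) | _ = inj₂ (inj₂ (case ihx z z∈x (Ord-∈ ox z∈x) y oy of λ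
              { (inj₁ z∈y) → contradiction z∈y z∉y
              ; (inj₂ (inj₁ z≈y)) → ∈-respˡ z≈y z∈x
              ; (inj₂ (inj₂ y∈z)) → Ord-trans ox z∈x y∈z }))
      ... | no _ | yes (w , w∈y , w∉x) = inj₁ (case ihy w w∈y (Ord-∈ oy w∈y) of λ
              { (inj₁ x∈w) → Ord-trans oy w∈y x∈w
              ; (inj₂ (inj₁ x≈w)) → ∈-respˡ (≈sym x≈w) w∈y
              ; (inj₂ (inj₂ w∈x)) → contradiction w∈x w∉x })
      ... | no n | no m = inj₂ (inj₁ (ext (λ p → stableℓ λ q → n (_ , p , q)) (λ p → stableℓ λ q → m (_ , p , q))))

  ∉⇒⊇ : Ord x → Ord y → ¬ x ∈ y → El y ⊆ El x
  ∉⇒⊇ ox oy n with tri ox oy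
  ... | inj₁ p        = contradiction p n
  ... | inj₂ (inj₁ e) = ∈-respʳ (≈sym e)
  ... | inj₂ (inj₂ p) = Ord-trans ox p

  ⊆⇒∈⊎≈ : Ord x → Ord y → El x ⊆ El y → x ∈ y ⊎ x ≈ y
  ⊆⇒∈⊎≈ ox oy s with tri ox oy
  ... | inj₁ p        = inj₁ p
  ... | inj₂ (inj₁ e) = inj₂ e
  ... | inj₂ (inj₂ p) = contradiction (s p) ∈-irrefl

  Ord-⋃ : (∀ y → y ∈ x → Ord y) → Ord (⋃ x)
  Ord-⋃ h = (λ z z∈ w∈z → let y , y∈ , z∈y = ⋃⁻ z∈ in ⋃⁺ y∈ (Ord-trans (h y y∈) z∈y w∈z))
          , (λ z z∈ → let y , y∈ , z∈y = ⋃⁻ z∈ in proj₁ (Ord-∈ (h y y∈) z∈y))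

  Ord-suc : Ord x → Ord ⌊ x ⌋⁺
  Ord-suc {x} ox = (λ y y∈ z∈y → ∪⁺ˡ (case suc⁻ y∈ of λ
      { (inj₁ p) → Ord-trans ox p z∈y ; (inj₂ e) → ∈-respʳ e z∈y }))
    , (λ y y∈ → case suc⁻ y∈ of λ
      { (inj₁ p) → proj₁ (Ord-∈ ox p) ; (inj₂ e) → IsTransitive-resp (≈sym e) (proj₁ ox) })

  ∅ᵛ : 𝕍
  ∅ᵛ = fam {Lift ℓ ⊥} λ ()

  ∉∅ : ¬ x ∈ ∅ᵛ
  ∉∅ p with () ← lower (proj₁ (fam⁻ p))

  Ord-∅ : Ord ∅ᵛ
  Ord-∅ = (λ y y∈ → contradiction y∈ ∉∅) , (λ y y∈ → contradiction y∈ ∉∅)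

  Least : (𝕍 → Set L) → 𝕍 → Set L
  Least P x = P x × (∀ y → y ∈ x → ¬ P y)

  Least-unique : {P Q : 𝕍 → Set L} → Resp Q → (∀ {x} → P x → Ord x) → (∀ {x} → Q x → Ord x) →
                 (∀ {x} → P x → Q x) → (∀ {x} → Q x → P x) →
                 Least P x → Least Q y → x ≈ y
  Least-unique r op oq f g (px , mx) (qy , my) with tri (op px) (oq qy)
  ... | inj₁ x∈y        = contradiction (f px) (my _ x∈y)
  ... | inj₂ (inj₁ e)   = e
  ... | inj₂ (inj₂ y∈x) = contradiction (g qy) (mx _ y∈x)

  ω₁-Ord : ω₁ x → Ord x
  ω₁-Ord = IsOrdinal⇒Ord ∘ proj₁

  ω₂-Ord : ω₂ x → Ord x
  ω₂-Ord = IsOrdinal⇒Ord ∘ proj₁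

  ≼-by : (f : ∃ C → ∃ D) → (∀ p q → proj₁ p ≈ proj₁ q → proj₁ (f p) ≈ proj₁ (f q)) →
         (∀ p q → proj₁ (f p) ≈ proj₁ (f q) → proj₁ p ≈ proj₁ q) → C ≼ D
  ≼-by f g h = record { to = f ; cong = λ {p} {q} → g p q ; injective = λ {p} {q} → h p q }

  ≼-⊆ : C ⊆ D → C ≼ D
  ≼-⊆ s = ≼-by (λ (x , c) → x , s c) (λ _ _ e → e) (λ _ _ e → e)

  ≼-trans : {E : Pred 𝕍 c} → C ≼ D → D ≼ E → C ≼ E
  ≼-trans f g = ≼-by (g.to ∘ f.to) (λ _ _ e → g.cong (f.cong e)) (λ _ _ e → f.injective (g.injective e))
    where
    module f = Injection f
    module g = Injection g

  ≅⇒≼ : C ≅ D → C ≼ D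
  ≅⇒≼ f = ≼-by to (λ _ _ → to-cong) λ p q e →
    ≈trans (≈sym (inverseʳ {p} {to p} ≈refl)) (≈trans (from-cong e) (inverseʳ {q} {to q} ≈refl))
    where open Inverse f

  ω₁-resp : Resp ω₁
  ω₁-resp e (o , f) = Ord⇒IsOrdinal (Ord-resp e (IsOrdinal⇒Ord o)) ,
    record { to = λ (z , p) → Injection.to f (z , ∈-respʳ (≈sym e) p)
           ; cong = Injection.cong f ; injective = Injection.injective f }

  ω₂-resp : Resp ω₂
  ω₂-resp e (o , f) = Ord⇒IsOrdinal (Ord-resp e (IsOrdinal⇒Ord o)) , ≼-trans (≼-⊆ (∈-respʳ (≈sym e))) f

  -- The least y related to x depends on x only up to `≈`. This turns a relation into a setoid map
  -- without an appeal to choice.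
  rel-ω₁ : (R : 𝕍 → 𝕍 → Set L) → (∀ {x x′ y} → x ≈ x′ → R x y → R x′ y) → (∀ {x y y′} → y ≈ y′ → R x y → R x y′) →
           (∀ x → C x → ∃ λ y → ω₁ y × R x y) →
           (∀ {x x′ y} → C x → C x′ → R x y → R x′ y → x ≈ x′) → C ≼ ω₁
  rel-ω₁ {C = C} R rˡ rʳ tot inj = ≼-by f
      (λ p q e → Least-unique {P = P (proj₁ p)} {P (proj₁ q)} (P-resp _) (ω₁-Ord ∘ proj₁) (ω₁-Ord ∘ proj₁)
        (λ (o , r) → o , rˡ e r) (λ (o , r) → o , rˡ (≈sym e) r) (proj₂ (least p)) (proj₂ (least q)))
      (λ p q e → inj (proj₂ p) (proj₂ q) (rʳ e (proj₂ (proj₁ (proj₂ (least p))))) (proj₂ (proj₁ (proj₂ (least q)))))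
    where
    P : 𝕍 → 𝕍 → Set L
    P x y = ω₁ y × R x y
    P-resp : ∀ x → Resp (P x)
    P-resp x e (o , r) = ω₁-resp e o , rʳ e r
    least : (p : ∃ C) → ∃ (Least (P (proj₁ p)))
    least (x , c) = ∈-min (tot x c)
    f : ∃ C → ∃ ω₁
    f p = let y , (o , _) , _ = least p in y , o

  LeastN : (ℕ → Set L) → ℕ → Set L
  LeastN P n = P n × (∀ m → m < n → ¬ P m)

  leastN : (P : ℕ → Set L) → ∃ P → ∃ (LeastN P)
  leastN P (n , p) = stable λ ¬l → <-rec (λ n → ¬ P n) (λ n ih p → ¬l (n , p , λ m m<n → ih m<n)) n p

  LeastN-unique : ∀ {P Q : ℕ → Set L} {m n} → (∀ {x} → P x → Q x) → (∀ {x} → Q x → P x) →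
                  LeastN P m → LeastN Q n → m ≡ n
  LeastN-unique {m = m} {n} f g (p , pm) (q , qm) with <-cmp m n
  ... | tri< lt _ _ = contradiction (f p) (qm m lt)
  ... | tri≈ _ e _  = e
  ... | tri> _ _ gt = contradiction (g q) (pm n gt)

  rel-ℕ : (R : 𝕍 → ℕ → Set L) → (∀ {x x′ n} → x ≈ x′ → R x n → R x′ n) → (∀ x → C x → ∃ (R x)) →
          (∀ {x x′ n} → C x → C x′ → R x n → R x′ n → x ≈ x′) → Countable C
  rel-ℕ {C = C} R r tot inj = record
    { to = proj₁ ∘ least
    ; cong = λ {p} {q} e → LeastN-unique (r e) (r (≈sym e)) (proj₂ (least p)) (proj₂ (least q))
    ; injective = λ {p} {q} e → inj (proj₂ p) (proj₂ q)
        (subst (R (proj₁ p)) e (proj₁ (proj₂ (least p)))) (proj₁ (proj₂ (least q))) }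
    where
    least : (p : ∃ C) → ∃ (LeastN (R (proj₁ p)))
    least (x , c) = leastN (R x) (tot x c)

  countable-⊆ : C ⊆ D → Countable D → Countable C
  countable-⊆ s f = record { to = λ (x , c) → to (x , s c) ; cong = cong′ ; injective = injective }
    where open Injection f renaming (cong to cong′)

  ≼-countable : C ≼ D → Countable D → Countable C
  ≼-countable f g = record { to = g.to ∘ f.to ; cong = λ e → g.cong (f.cong e) ; injective = λ e → f.injective (g.injective e) }
    where
    module f = Injection f
    module g = Injection g

  countable-∅ : (∀ {x} → ¬ C x) → Countable C
  countable-∅ n = record { to = λ _ → zero ; cong = λ _ → refl ; injective = λ {p} _ → contradiction (proj₂ p) n }

  countable-sing : Countable (El (upair x x))
  countable-sing = record { to = λ _ → zero ; cong = λ _ → refl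
                          ; injective = λ {p} {q} _ → ≈trans (sing⁻ (proj₂ p)) (≈sym (sing⁻ (proj₂ q))) }

  countable-img : {C : Pred 𝕍 L} (F : 𝕍 → 𝕍 → Set L) → (∀ {x y y′} → y ≈ y′ → F x y → F x y′) →
                  (∀ {x x′ y y′} → C x → C x′ → x ≈ x′ → F x y → F x′ y′ → y ≈ y′) →
                  Countable C → (∀ y → D y → ∃ λ x → C x × F x y) → Countable D
  countable-img {C = C} F Fʳ func f sur = rel-ℕ
      (λ y n → ∃ λ x → Σ (C x) λ c → F x y × to (x , c) ≡ n)
      (λ e (x , c , p , q) → x , c , Fʳ e p , q)
      (λ y d → let x , c , p = sur y d in _ , x , c , p , refl)
      (λ _ _ (x , c , p , q) (x′ , c′ , p′ , q′) → func c c′ (injective (trans q (sym q′))) p p′)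
    where open Injection f

  countable-⋃-ix : {J : Set} (j : J → ℕ) → (∀ {i i′} → j i ≡ j i′ → i ≡ i′) →
                   {C : J → Pred 𝕍 L} → (∀ i → Resp (C i)) → (∀ i → Countable (C i)) → Countable (λ z → ∃ λ i → C i z)
  countable-⋃-ix {J} j j-inj {C} r f = rel-ℕ
      (λ z n → ∃ λ i → Σ (C i z) λ c → code (j i) (Injection.to (f i) (z , c)) ≡ n)
      (λ e (i , c , p) → i , r i e c , trans (cong (code (j i)) (Injection.cong (f i) (≈sym e))) p)
      (λ z (i , c) → _ , i , c , refl)
      (λ { _ _ (i , c , p) (i′ , c′ , p′) → case code-injective {j i} {_} {j i′} (trans p (sym p′)) of λ
             { (e , e′) → same i i′ (j-inj e) c c′ e′ } })
    where
    same : ∀ {z z′} i i′ → i ≡ i′ → (c : C i z) (c′ : C i′ z′) →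
           Injection.to (f i) (z , c) ≡ Injection.to (f i′) (z′ , c′) → z ≈ z′
    same i .i refl c c′ e = Injection.injective (f i) e

  countable-⋃ℕ : {C : ℕ → Pred 𝕍 L} → (∀ i → Resp (C i)) → (∀ i → Countable (C i)) → Countable (λ z → ∃ λ i → C i z)
  countable-⋃ℕ = countable-⋃-ix id id

  -- `Countable` is an injection and not its mere existence, so the second hypothesis already
  -- selects an enumeration of each member; the number of a member under the first one then singles
  -- out one representative.
  countable-⋃ : Countable (El x) → (∀ y → y ∈ x → Countable (El y)) → Countable (El (⋃ x))
  countable-⋃ {x} f h = countable-⊆ incl (countable-⋃ℕ {C = Piece} resp cnt)
    where
    open Injection f
    Piece : ℕ → Pred 𝕍 L
    Piece n z = ∃ λ y → Σ (y ∈ x) λ p → to (y , p) ≡ n × z ∈ y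
    resp : ∀ n → Resp (Piece n)
    resp n e (y , p , q , r) = y , p , q , ∈-respˡ e r
    cnt : ∀ n → Countable (Piece n)
    cnt n with em {∃ λ y → Σ (y ∈ x) λ p → to (y , p) ≡ n}
    ... | yes (y , p , q) = countable-⊆ (λ (y′ , p′ , q′ , r) → ∈-respʳ (injective {y′ , p′} {y , p} (trans q′ (sym q))) r) (h y p)
    ... | no ¬e = countable-∅ λ (y , p , q , _) → ¬e (y , p , q)
    incl : El (⋃ x) ⊆ λ z → ∃ λ n → Piece n z
    incl p = let y , y∈ , z∈ = ⋃⁻ p in _ , y , y∈ , refl , z∈

  countable-upair : Countable (El (upair x y))
  countable-upair {x} {y} = rel-ℕ
    (λ z n → Lift L (z ≈ x × n ≡ 0 ⊎ z ≈ y × n ≡ 1))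
    (λ { e (lift (inj₁ (p , q))) → lift (inj₁ (≈trans (≈sym e) p , q)) ; e (lift (inj₂ (p , q))) → lift (inj₂ (≈trans (≈sym e) p , q)) })
    (λ z p → case upair⁻ p of λ { (inj₁ e) → 0 , lift (inj₁ (e , refl)) ; (inj₂ e) → 1 , lift (inj₂ (e , refl)) })
    (λ { _ _ (lift (inj₁ (p , refl))) (lift (inj₁ (q , _))) → ≈trans p (≈sym q)
       ; _ _ (lift (inj₂ (p , refl))) (lift (inj₂ (q , _))) → ≈trans p (≈sym q)
       ; _ _ (lift (inj₁ (p , refl))) (lift (inj₂ (q , ())))
       ; _ _ (lift (inj₂ (p , refl))) (lift (inj₁ (q , ()))) })

  countable-∪ : Countable (El x) → Countable (El y) → Countable (El (x ∪ y))
  countable-∪ f g = countable-⋃ countable-upair λ z z∈ → case upair⁻ z∈ of λ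
    { (inj₁ e) → countable-⊆ (∈-respʳ e) f ; (inj₂ e) → countable-⊆ (∈-respʳ e) g }

  ω₁-∈ : ω₁ α → β ∈ α → ω₁ β
  ω₁-∈ (o , f) β∈α = Ord⇒IsOrdinal (Ord-∈ (IsOrdinal⇒Ord o) β∈α) , countable-⊆ (Ord-trans (IsOrdinal⇒Ord o) β∈α) f

  ω₁-suc : ω₁ α → ω₁ ⌊ α ⌋⁺
  ω₁-suc (o , f) = Ord⇒IsOrdinal (Ord-suc (IsOrdinal⇒Ord o)) , countable-∪ f countable-sing

  ω₁-⋃ : Countable (El x) → El x ⊆ ω₁ → ω₁ (⋃ x)
  ω₁-⋃ f s = Ord⇒IsOrdinal (Ord-⋃ λ y y∈ → ω₁-Ord (s y∈)) , countable-⋃ f λ y y∈ → proj₂ (s y∈)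

  ω₂-∈ : ω₂ α → β ∈ α → ω₂ β
  ω₂-∈ (o , f) β∈α = Ord⇒IsOrdinal (Ord-∈ (IsOrdinal⇒Ord o) β∈α) , ≼-trans (≼-⊆ (Ord-trans (IsOrdinal⇒Ord o) β∈α)) f

  -- α + n
  suc^ : ℕ → 𝕍 → 𝕍
  suc^ zero    x = x
  suc^ (suc n) x = ⌊ suc^ n x ⌋⁺

  suc-cong : x ≈ y → ⌊ x ⌋⁺ ≈ ⌊ y ⌋⁺
  suc-cong e = ext (h e) (h (≈sym e))
    where
    h : x ≈ y → El ⌊ x ⌋⁺ ⊆ El ⌊ y ⌋⁺
    h e p with suc⁻ p
    ... | inj₁ q = ∪⁺ˡ (∈-respʳ e q)
    ... | inj₂ q = ∈-respˡ (≈sym (≈trans q e)) self∈suc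

  suc^-cong : ∀ n → x ≈ y → suc^ n x ≈ suc^ n y
  suc^-cong zero    e = e
  suc^-cong (suc n) e = suc-cong (suc^-cong n e)

  suc^-⊆ : ∀ n → El x ⊆ El (suc^ n x)
  suc^-⊆ zero    p = p
  suc^-⊆ (suc n) p = ∪⁺ˡ (suc^-⊆ n p)

  suc^-< : ∀ {m n} → m < n → suc^ m x ∈ suc^ n x
  suc^-< {n = suc n} lt with m<1+n⇒m<n∨m≡n lt
  ... | inj₁ lt′  = ∪⁺ˡ (suc^-< lt′)
  ... | inj₂ refl = self∈suc

  suc^-injective : ∀ {m n} → suc^ m x ≈ suc^ n x → m ≡ n
  suc^-injective {m = m} {n} e with <-cmp m n
  ... | tri< lt _ _  = contradiction (∈-respʳ (≈sym e) (suc^-< lt)) ∈-irrefl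
  ... | tri≈ _ m≡n _ = m≡n
  ... | tri> _ _ gt  = contradiction (∈-respʳ e (suc^-< gt)) ∈-irrefl

  ω₁-suc^ : ∀ n → ω₁ x → ω₁ (suc^ n x)
  ω₁-suc^ zero    o = o
  ω₁-suc^ (suc n) o = ω₁-suc (ω₁-suc^ n o)

  -- ω · α, as the union of the ordinals ω · β + n for β < α.
  ω·-parts ω·_ : 𝕍 → 𝕍
  ω·-parts (sup A f) = fam {A × Lift ℓ ℕ} λ (a , lift n) → suc^ n (⋃ (ω·-parts (f a)))
  ω· x = ⋃ (ω·-parts x)

  ω·-cong : x ≈ y → ω· x ≈ ω· y
  ω·-cong {x} {y} e = go x y e
    where
    go : ∀ x y → x ≈ y → ω· x ≈ ω· y
    go (sup A f) (sup B g) (p , q) = ext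
      (λ r → let u , u∈ , z∈u = ⋃⁻ r ; (a , lift n) , e = fam⁻ {A = A × Lift ℓ ℕ} {f = λ (a , lift n) → suc^ n (ω· (f a))} u∈ ; b , e′ = p a
             in ⋃⁺ (fam⁺ _ (b , lift n)) (∈-respʳ (≈trans e (suc^-cong n (go (f a) (g b) e′))) z∈u))
      (λ r → let u , u∈ , z∈u = ⋃⁻ r ; (b , lift n) , e = fam⁻ {A = B × Lift ℓ ℕ} {f = λ (b , lift n) → suc^ n (ω· (g b))} u∈ ; a , e′ = q b
             in ⋃⁺ (fam⁺ _ (a , lift n)) (∈-respʳ (≈trans e (≈sym (suc^-cong n (go (f a) (g b) e′)))) z∈u))

  ω·-parts⁺ : ∀ n → β ∈ α → suc^ n (ω· β) ∈ ω·-parts α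
  ω·-parts⁺ {α = sup A f} n (a , e) = ∈-respˡ (≈sym (suc^-cong n (ω·-cong e))) (fam⁺ _ (a , lift n))

  ω·-parts⁻ : z ∈ ω·-parts α → ∃ λ β → β ∈ α × ∃ λ n → z ≈ suc^ n (ω· β)
  ω·-parts⁻ {α = sup A f} p = let (a , lift n) , e = fam⁻ p in f a , (a , ≈-refl (f a)) , n , e

  ω·-< : ∀ n → β ∈ α → suc^ n (ω· β) ∈ ω· α
  ω·-< n β∈α = ⋃⁺ (ω·-parts⁺ (suc n) β∈α) self∈suc

  -- By linearity: if α < β then ω · α + m < ω · β. So ω · α + n serves as the code of the pair of α
  -- and n.
  ω·-injective : ∀ {m n} → Ord α → Ord β → suc^ m (ω· α) ≈ suc^ n (ω· β) → α ≈ β × m ≡ n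
  ω·-injective {α} {β} {m} {n} oα oβ e with tri oα oβ
  ... | inj₁ α∈β        = contradiction (∈-respˡ e (suc^-⊆ n (ω·-< m α∈β))) ∈-irrefl
  ... | inj₂ (inj₁ α≈β) = α≈β , suc^-injective {ω· β} (≈trans (suc^-cong m (≈sym (ω·-cong α≈β))) e)
  ... | inj₂ (inj₂ β∈α) = contradiction (∈-respˡ (≈sym e) (suc^-⊆ m (ω·-< n β∈α))) ∈-irrefl

  ω₁-ω· : ω₁ α → ω₁ (ω· α)
  ω₁-ω· {α} = ∈-ind (λ α → ω₁ α → ω₁ (ω· α)) step α
    where
    Part : 𝕍 → ℕ → Pred 𝕍 L
    Part α n z = ∃ λ β → β ∈ α × z ≈ suc^ n (ω· β)
    step : ∀ α → (∀ β → β ∈ α → ω₁ β → ω₁ (ω· β)) → ω₁ α → ω₁ (ω· α)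
    step α ih o = ω₁-⋃
      (countable-⊆ {D = λ z → ∃ λ n → Part α n z} (λ p → let β , β∈ , n , e = ω·-parts⁻ p in n , β , β∈ , e)
        (countable-⋃ℕ (λ n e (β , β∈ , e′) → β , β∈ , ≈trans (≈sym e) e′) λ n →
          countable-img {C = λ β → Lift L (β ∈ α)} (λ β z → Lift L (z ≈ suc^ n (ω· β)))
            (λ e (lift e′) → lift (≈trans (≈sym e) e′))
            (λ _ _ e (lift p) (lift q) → ≈trans p (≈trans (suc^-cong n (ω·-cong e)) (≈sym q)))
            (countable-⊆ lower (proj₂ o)) (λ z (β , β∈ , e) → β , lift β∈ , lift e)))
      (λ p → let β , β∈ , n , e = ω·-parts⁻ p in ω₁-resp (≈sym e) (ω₁-suc^ n (ih β β∈ (ω₁-∈ o β∈))))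

  ω₁-∅ : ω₁ ∅ᵛ
  ω₁-∅ = Ord⇒IsOrdinal Ord-∅ , countable-∅ ∉∅

  countable⇒≼ω₁ : Countable C → C ≼ ω₁
  countable⇒≼ω₁ {C = C} f = ≼-by (λ p → suc^ (to p) ∅ᵛ , ω₁-suc^ (to p) ω₁-∅)
      (λ p q e → subst (λ n → suc^ (to p) ∅ᵛ ≈ suc^ n ∅ᵛ) (cong′ e) ≈refl)
      (λ p q e → injective (suc^-injective {∅ᵛ} e))
    where open Injection f renaming (cong to cong′)

  ≼ω₁-⋃ℕ : {C : ℕ → Pred 𝕍 L} → (∀ i → Resp (C i)) → (∀ i → C i ≼ ω₁) → (λ z → ∃ λ i → C i z) ≼ ω₁
  ≼ω₁-⋃ℕ {C} r f = rel-ω₁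
      (λ z γ → ∃ λ n → Σ (C n z) λ c → γ ≈ suc^ n (ω· (proj₁ (Injection.to (f n) (z , c)))))
      (λ e (n , c , p) → n , r n e c , ≈trans p (suc^-cong n (ω·-cong (Injection.cong (f n) e))))
      (λ e (n , c , p) → n , c , ≈trans (≈sym e) p)
      (λ z (n , c) → _ , ω₁-suc^ n (ω₁-ω· (proj₂ (Injection.to (f n) (z , c)))) , n , c , ≈refl)
      (λ { _ _ (n , c , p) (n′ , c′ , p′) → same n n′ c c′ (≈trans (≈sym p) p′) })
    where
    same : ∀ {z z′} n n′ (c : C n z) (c′ : C n′ z′) →
           suc^ n (ω· (proj₁ (Injection.to (f n) (z , c)))) ≈ suc^ n′ (ω· (proj₁ (Injection.to (f n′) (z′ , c′)))) → z ≈ z′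
    same n n′ c c′ e with ω·-injective {m = n} {n′} (ω₁-Ord (proj₂ (Injection.to (f n) (_ , c)))) (ω₁-Ord (proj₂ (Injection.to (f n′) (_ , c′)))) e
    ... | e′ , refl = Injection.injective (f n) e′

  ω₂-suc : ω₂ α → ω₂ ⌊ α ⌋⁺
  ω₂-suc {α} (o , f) = Ord⇒IsOrdinal (Ord-suc (IsOrdinal⇒Ord o)) , ≼-trans (≼-⊆ incl) (≼ω₁-⋃ℕ resp parts)
    where
    Part : ℕ → Pred 𝕍 L
    Part zero    z = Lift L (z ∈ α)
    Part (suc _) z = Lift L (z ≈ α)
    resp : ∀ n → Resp (Part n)
    resp zero    e (lift p) = lift (∈-respˡ e p)
    resp (suc n) e (lift p) = lift (≈trans (≈sym e) p)
    parts : ∀ n → Part n ≼ ω₁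
    parts zero    = ≼-trans (≼-⊆ lower) f
    parts (suc n) = ≼-by (λ _ → ∅ᵛ , ω₁-∅) (λ _ _ _ → ≈refl) (λ (_ , lift p) (_ , lift q) _ → ≈trans p (≈sym q))
    incl : El ⌊ α ⌋⁺ ⊆ λ z → ∃ λ n → Part n z
    incl p with suc⁻ p
    ... | inj₁ q = 0 , lift q
    ... | inj₂ q = 1 , lift q

  ω₁⊆ω₂ : ω₁ ⊆ ω₂
  ω₁⊆ω₂ (o , f) = o , countable⇒≼ω₁ f

-- The transitive collapse.

module Collapse (ℓ : Level) (em : ExcludedMiddle (lsuc ℓ)) where
  open SetTheory ℓ
  open Sets ℓ em
  open Ordinals ℓ em

  private variable
    x y z w M N α β : 𝕍

  π⁺ : w ∈ x → w ∈ M → π M w ∈ π M x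
  π-cong : M ≈ N → x ≈ y → π M x ≈ π N y

  π-cong {M} {N} {sup A f} {sup B g} e (p , q) =
      (λ (i , i∈) → let j , e′ = p i in (j , ∈-respʳ e (∈-respˡ e′ i∈)) , π-cong {M} {N} {f i} {g j} e e′)
    , (λ (j , j∈) → let i , e′ = q j in (i , ∈-respʳ (≈sym e) (∈-respˡ (≈sym e′) j∈)) , π-cong {M} {N} {f i} {g j} e e′)

  π⁺ {x = sup A f} (i , e) w∈M = (i , ∈-respˡ e w∈M) , π-cong ≈refl e

  π⁻ : z ∈ π M x → ∃ λ w → w ∈ x × w ∈ M × z ≈ π M w
  π⁻ {x = sup A f} ((i , i∈) , e) = f i , (i , ≈-refl (f i)) , i∈ , e

  collapse⁺ : x ∈ M → π M x ∈ collapse M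
  collapse⁺ {M = sup A f} (i , e) = i , π-cong (≈-refl (sup A f)) e

  collapse⁻ : z ∈ collapse M → ∃ λ x → x ∈ M × z ≈ π M x
  collapse⁻ {M = sup A f} (i , e) = f i , (i , ≈-refl (f i)) , e

  collapse-transitive : IsTransitive (collapse M)
  collapse-transitive y y∈ z∈y =
    let x , x∈ , e = collapse⁻ y∈ ; w , _ , w∈M , e′ = π⁻ (∈-respʳ e z∈y)
    in ∈-respˡ (≈sym e′) (collapse⁺ w∈M)

  -- The recursion for `π M α` visits only members of α, as α is transitive. This is what lets
  -- decided values survive in stronger conditions.
  π-local : Ord α → (∀ w → w ∈ α → w ∈ M → w ∈ N) → (∀ w → w ∈ α → w ∈ N → w ∈ M) → π M α ≈ π N α
  π-local {α} {M} {N} = ∈-ind (λ α → Ord α → (∀ w → w ∈ α → w ∈ M → w ∈ N) → (∀ w → w ∈ α → w ∈ N → w ∈ M) → π M α ≈ π N α)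
    (λ α ih o f g → ext
      (λ p → let w , w∈ , w∈M , e = π⁻ p
             in ∈-respˡ (≈sym (≈trans e (ih w w∈ (Ord-∈ o w∈) (λ v v∈ → f v (Ord-trans o w∈ v∈)) (λ v v∈ → g v (Ord-trans o w∈ v∈)))))
                        (π⁺ w∈ (f w w∈ w∈M)))
      (λ p → let w , w∈ , w∈N , e = π⁻ p
             in ∈-respˡ (≈sym (≈trans e (≈sym (ih w w∈ (Ord-∈ o w∈) (λ v v∈ → f v (Ord-trans o w∈ v∈)) (λ v v∈ → g v (Ord-trans o w∈ v∈))))))
                        (π⁺ w∈ (g w w∈ w∈N)))) α

  π-id : Ord α → El α ⊆ El M → π M α ≈ α
  π-id {α} {M} = ∈-ind (λ α → Ord α → El α ⊆ El M → π M α ≈ α) (λ α ih o s →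
    let fix : ∀ w → w ∈ α → π M w ≈ w
        fix w w∈ = ih w w∈ (Ord-∈ o w∈) (λ v∈ → s (Ord-trans o w∈ v∈))
    in ext (λ p → let w , w∈ , _ , e = π⁻ p in ∈-respˡ (≈sym (≈trans e (fix w w∈))) w∈)
           (λ {w} p → ∈-respˡ (fix w p) (π⁺ p (s p)))) α

  π-id-⊆ : Ord β → El β ⊆ El M → El x ⊆ El β → π M x ≈ x
  π-id-⊆ o s x⊆β = ext
    (λ p → let w , w∈ , _ , e = π⁻ p in ∈-respˡ (≈sym (≈trans e (fix w (x⊆β w∈)))) w∈)
    (λ {w} p → ∈-respˡ (fix w (x⊆β p)) (π⁺ p (s (x⊆β p))))
    where fix = λ w w∈ → π-id (Ord-∈ o w∈) (λ v∈ → s (Ord-trans o w∈ v∈))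

  Ord-π : Ord α → Ord (π M α)
  Ord-π {α} {M} = ∈-ind (λ α → Ord α → Ord (π M α)) (λ α ih o →
      (λ y y∈ z∈y → let w , w∈ , _ , e = π⁻ y∈ ; v , v∈ , v∈M , e′ = π⁻ (∈-respʳ e z∈y)
                    in ∈-respˡ (≈sym e′) (π⁺ (Ord-trans o w∈ v∈) v∈M))
    , (λ y y∈ → let w , w∈ , _ , e = π⁻ y∈ in IsTransitive-resp (≈sym e) (proj₁ (ih w w∈ (Ord-∈ o w∈))))) α

  π-inj : Ord α → Ord β → α ∈ M → β ∈ M → π M α ≈ π M β → α ≈ β
  π-inj oα oβ α∈ β∈ e with tri oα oβ
  ... | inj₁ p        = contradiction (∈-respˡ e (π⁺ p α∈)) ∈-irrefl
  ... | inj₂ (inj₁ q) = q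
  ... | inj₂ (inj₂ p) = contradiction (∈-respˡ (≈sym e) (π⁺ p β∈)) ∈-irrefl

-- Choice for relations, fixed families of injections, and regularity of ω₂.

module Choosing (ℓ : Level) (em : ExcludedMiddle (lsuc ℓ)) (ac : SetTheory.Choice ℓ) where
  open import Data.Nat.Base using (ℕ)
  open SetTheory ℓ
  open Sets ℓ em
  open Ordinals ℓ em
  open Coding

  private variable
    x y x′ X : 𝕍

  opaque
    choose : (X : 𝕍) (R : 𝕍 → 𝕍 → Set L) → (∀ {x x′ y} → x ≈ x′ → R x y → R x′ y) →
             (∀ {x y y′} → y ≈ y′ → R x y → R x y′) → (∀ x → x ∈ X → ∃ (R x)) →
             Σ (Func ∣ El X ∣ 𝕍-setoid) λ g → ∀ p → R (proj₁ p) (Func.to g p)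
    choose X R rˡ rʳ tot = record { to = λ p → to (val p) ; cong = λ e → cong′ (choices-cong e) } , spec
      where
      -- All indices that represent x contribute their witnesses, so the set depends on x only up to
      -- `≈` and `Choice` can select from it.
      choices : 𝕍 → 𝕍
      choices x = fam {Σ (Ix X) λ i → at X i ≈ x} λ (i , _) → proj₁ (tot (at X i) (at∈ X i))
      choices-⊆ : x ≈ x′ → El (choices x) ⊆ El (choices x′)
      choices-⊆ e p = let (i , q) , e′ = fam⁻ p in ∈-respˡ (≈sym e′) (fam⁺ _ (i , ≈trans q e))
      choices-cong : x ≈ x′ → choices x ≈ choices x′
      choices-cong e = ext (choices-⊆ e) (choices-⊆ (≈sym e))
      chosen : Σ (Func ∣ El (fam {Ix X} (choices ∘ at X)) ∣ 𝕍-setoid) λ f → ∀ x → Func.to f x ∈ proj₁ x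
      chosen = ac _ λ x x∈ → let i , e = fam⁻ x∈ in _ , ∈-respʳ (≈sym e) (fam⁺ _ (i , ≈refl))
      open Func (proj₁ chosen) renaming (cong to cong′)
      val : ∃ (El X) → ∃ (El (fam {Ix X} (choices ∘ at X)))
      val (x , x∈) = let i , e = ix x∈ in choices x , ∈-respˡ (choices-cong (≈sym e)) (fam⁺ _ i)
      spec : ∀ p → R (proj₁ p) (to (val p))
      spec p = let (i , q) , e = fam⁻ (proj₂ chosen (val p)) in rˡ q (rʳ (≈sym e) (proj₂ (tot (at X i) (at∈ X i))))

  -- E x y z says that z is the value at y of a chosen injection of x into D.
  record Codes (X : 𝕍) (D : Pred 𝕍 L) : Set (lsuc L) where
    field
      E     : 𝕍 → 𝕍 → 𝕍 → Set ℓ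
      respˣ : ∀ {x x′ y z} → x ≈ x′ → E x y z → E x′ y z
      respʸ : ∀ {x y y′ z} → y ≈ y′ → E x y z → E x y′ z
      respᶻ : ∀ {x y z z′} → z ≈ z′ → E x y z → E x y z′
      total : ∀ {x y} → x ∈ X → y ∈ x → ∃ λ z → D z × E x y z
      inj   : ∀ {x y y′ z} → x ∈ X → y ∈ x → y′ ∈ x → E x y z → E x y′ z → y ≈ y′

  opaque
    -- The given injections may depend on the representative of x. Choosing for each x a graph,
    -- which is a set, makes the relation respect `≈`.
    codes : {D : Pred 𝕍 L} → (∀ x → x ∈ X → El x ≼ D) → Codes X D
    codes {X} {D} h = record
      { E     = λ x y z → Σ (x ∈ X) λ p → pair y z ∈ to (x , p)
      ; respˣ = λ e (p , q) → ∈-respˡ e p , ∈-respʳ (cong′ e) q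
      ; respʸ = λ e (p , q) → p , ∈-respˡ (pair-cong e ≈refl) q
      ; respᶻ = λ e (p , q) → p , ∈-respˡ (pair-cong ≈refl e) q
      ; total = λ {x} {y} p y∈ → let z , d , q = proj₁ (proj₂ graph (x , p)) y y∈ in z , d , p , q
      ; inj   = λ {x} p y∈ y′∈ (_ , q) (_ , q′) →
          proj₂ (proj₂ graph (x , p)) y∈ y′∈ (∈-respʳ (cong′ {x = x , _} {y = x , _} ≈refl) q) (∈-respʳ (cong′ {x = x , _} {y = x , _} ≈refl) q′)
      }
      where
      IsGraph : 𝕍 → 𝕍 → Set L
      IsGraph x g = (∀ y → y ∈ x → ∃ λ z → D z × pair y z ∈ g)
                  × (∀ {y y′ z} → y ∈ x → y′ ∈ x → pair y z ∈ g → pair y′ z ∈ g → y ≈ y′)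
      graph : Σ (Func ∣ El X ∣ 𝕍-setoid) λ g → ∀ p → IsGraph (proj₁ p) (Func.to g p)
      graph = choose X IsGraph
        (λ e (f , g) → (λ y y∈ → f y (∈-respʳ (≈sym e) y∈)) , λ y∈ y′∈ → g (∈-respʳ (≈sym e) y∈) (∈-respʳ (≈sym e) y′∈))
        (λ e (f , g) → (λ y y∈ → let z , d , p = f y y∈ in z , d , ∈-respʳ e p)
                     , λ y∈ y′∈ p p′ → g y∈ y′∈ (∈-respʳ (≈sym e) p) (∈-respʳ (≈sym e) p′))
        exists
        where
        exists : ∀ x → x ∈ X → ∃ (IsGraph x)
        exists x x∈ = fam {Ix x} gr , (λ y y∈ → let i , e = ix y∈
                                                in proj₁ (f.to (at x i , at∈ x i)) , proj₂ (f.to (at x i , at∈ x i)) ,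
                                                   ∈-respˡ (pair-cong (≈sym e) ≈refl) (fam⁺ gr i))
          , λ {y} {y′} {z} y∈ y′∈ p p′ →
              let i , e = fam⁻ p ; i′ , e′ = fam⁻ p′
              in ≈trans (pair-injˡ e) (≈trans (f.injective (≈trans (≈sym (pair-injʳ e)) (pair-injʳ e′))) (≈sym (pair-injˡ e′)))
          where
          module f = Injection (h x x∈)
          gr : Ix x → 𝕍
          gr i = pair (at x i) (proj₁ (f.to (at x i , at∈ x i)))
      open Func (proj₁ graph) renaming (cong to cong′)

  Numeral : Pred 𝕍 L
  Numeral z = Lift L (∃ λ n → z ≈ suc^ n ∅ᵛ)

  countable⇒≼Numeral : {C : Pred 𝕍 ℓ} → Countable C → C ≼ Numeral
  countable⇒≼Numeral f = ≼-by (λ p → suc^ (to p) ∅ᵛ , lift (to p , ≈refl))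
      (λ p q e → subst (λ n → suc^ (to p) ∅ᵛ ≈ suc^ n ∅ᵛ) (cong′ e) ≈refl)
      (λ p q e → injective (suc^-injective {∅ᵛ} e))
    where open Injection f renaming (cong to cong′)

  module Regularity {Ω : 𝕍} (Ω≐ : El Ω ≐ ω₁) where

    private
      N : Codes Ω Numeral
      N = codes λ x x∈ → countable⇒≼Numeral (proj₂ (proj₁ Ω≐ x∈))
      module N = Codes N

      top : 𝕍 → 𝕍 → 𝕍
      top i j = ⌊ i ∪ j ⌋⁺

      ω₁-∪ : ω₁ x → ω₁ y → ω₁ (x ∪ y)
      ω₁-∪ o o′ = ω₁-⋃ countable-upair λ p → case upair⁻ p of λ
        { (inj₁ e) → ω₁-resp (≈sym e) o ; (inj₂ e) → ω₁-resp (≈sym e) o′ }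

      ω₁-top : ω₁ x → ω₁ y → ω₁ (top x y)
      ω₁-top o o′ = ω₁-suc (ω₁-∪ o o′)

      ⊆⇒∈suc : Ord x → Ord y → El x ⊆ El y → x ∈ ⌊ y ⌋⁺
      ⊆⇒∈suc o o′ s with ⊆⇒∈⊎≈ o o′ s
      ... | inj₁ p = ∪⁺ˡ p
      ... | inj₂ e = ∈-respˡ (≈sym e) self∈suc

      ∈topˡ : ω₁ x → ω₁ y → x ∈ top x y
      ∈topˡ o o′ = ⊆⇒∈suc (ω₁-Ord o) (ω₁-Ord (ω₁-∪ o o′)) ∪⁺ˡ

      ∈topʳ : ω₁ x → ω₁ y → y ∈ top x y
      ∈topʳ o o′ = ⊆⇒∈suc (ω₁-Ord o′) (ω₁-Ord (ω₁-∪ o o′)) ∪⁺ʳ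

      num : ℕ → 𝕍
      num n = suc^ n ∅ᵛ

    -- A member γ of ξ ∈ X is determined by two countable ordinals: i, the code of ξ, and j, the
    -- code of γ in ξ. To code this pair below ω₁, take a countable ordinal `top i j` above both and
    -- the numbers n and m of i and j under a fixed injection of it into ℕ; the code is ω ·
    -- `top i j` + `code n m`.
    ω₂-⋃ : El X ≼ ω₁ → El X ⊆ ω₂ → ω₂ (⋃ X)
    ω₂-⋃ {X} f s = Ord⇒IsOrdinal (Ord-⋃ λ y y∈ → ω₂-Ord (s y∈)) , rel-ω₁ R
        (λ e (ξ , p , q , j , o , r , n , m , a , b , k) →
          ξ , p , ∈-respˡ e q , j , o , E.respʸ e r , n , m , a , b , k)
        (λ e (ξ , p , q , j , o , r , n , m , a , b , k) → ξ , p , q , j , o , r , n , m , a , b , ≈trans (≈sym e) k)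
        tot inj
      where
      E : Codes X ω₁
      E = codes λ x x∈ → proj₂ (s x∈)
      module E = Codes E
      module f = Injection f
      R : 𝕍 → 𝕍 → Set L
      R γ k = ∃ λ ξ → Σ (ξ ∈ X) λ p → γ ∈ ξ × ∃ λ j → ω₁ j × E.E ξ γ j ×
              ∃ λ n → ∃ λ m → let i = proj₁ (f.to (ξ , p)) in
              N.E (top i j) i (num n) × N.E (top i j) j (num m) × k ≈ suc^ (code n m) (ω· top i j)
      tot : ∀ γ → γ ∈ ⋃ X → ∃ λ k → ω₁ k × R γ k
      tot γ γ∈ with ⋃⁻ γ∈
      ... | ξ , p , q with E.total p q
      ...   | j , oj , r with N.total (proj₂ Ω≐ (ω₁-top (proj₂ (f.to (ξ , p))) oj)) (∈topˡ (proj₂ (f.to (ξ , p))) oj)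
                            | N.total (proj₂ Ω≐ (ω₁-top (proj₂ (f.to (ξ , p))) oj)) (∈topʳ (proj₂ (f.to (ξ , p))) oj)
      ...     | _ , lift (n , e) , a | _ , lift (m , e′) , b =
        _ , ω₁-suc^ (code n m) (ω₁-ω· (ω₁-top (proj₂ (f.to (ξ , p))) oj)) ,
        ξ , p , q , j , oj , r , n , m , N.respᶻ e a , N.respᶻ e′ b , ≈refl
      inj : ∀ {γ γ′ k} → γ ∈ ⋃ X → γ′ ∈ ⋃ X → R γ k → R γ′ k → γ ≈ γ′
      inj _ _ (ξ , p , q , j , oj , r , n , m , a , b , e) (ξ′ , p′ , q′ , j′ , oj′ , r′ , n′ , m′ , a′ , b′ , e′) =
        E.inj p q (∈-respʳ (≈sym ξ≈ξ′) q′) r (E.respˣ (≈sym ξ≈ξ′) (E.respᶻ (≈sym j≈j′) r′))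
        where
        oi  = proj₂ (f.to (ξ , p))
        oi′ = proj₂ (f.to (ξ′ , p′))
        both = ω·-injective {m = code n m} {code n′ m′} (ω₁-Ord (ω₁-top oi oj)) (ω₁-Ord (ω₁-top oi′ oj′)) (≈trans (≈sym e) e′)
        nm = code-injective {n} {m} {n′} {m′} (proj₂ both)
        top∈ = proj₂ Ω≐ (ω₁-top oi oj)
        fix : ∀ {n n′ v} → n ≡ n′ → N.E (top (proj₁ (f.to (ξ′ , p′))) j′) v (num n′) → N.E (top (proj₁ (f.to (ξ , p))) j) v (num n)
        fix refl c = N.respˣ (≈sym (proj₁ both)) c
        i≈i′ = N.inj top∈ (∈topˡ oi oj) (∈-respʳ (≈sym (proj₁ both)) (∈topˡ oi′ oj′)) a (fix (proj₁ nm) a′)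
        j≈j′ = N.inj top∈ (∈topʳ oi oj) (∈-respʳ (≈sym (proj₁ both)) (∈topʳ oi′ oj′)) b (fix (proj₂ nm) b′)
        ξ≈ξ′ : ξ ≈ ξ′
        ξ≈ξ′ = f.injective i≈i′

    ⊆ω₂⇒⊆suc⋃ : El X ⊆ ω₂ → ω₂ (⋃ X) → El X ⊆ El ⌊ ⋃ X ⌋⁺
    ⊆ω₂⇒⊆suc⋃ s o p = ⊆⇒∈suc (ω₂-Ord (s p)) (ω₂-Ord o) (⋃⁺ p)

    opaque
      ω₂-bound : El X ≼ ω₁ → (g : Func ∣ El X ∣ 𝕍-setoid) → (∀ p → ω₂ (Func.to g p)) →
                 ∃ λ ζ → ω₂ ζ × ∀ p → El (Func.to g p) ⊆ El ζ
      ω₂-bound {X} f g h = ⋃ image , ω₂-⋃ small ⊆ω₂ , λ p {z} z∈ → ⋃⁺ (image⁺ p) z∈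
        where
        open Func g renaming (cong to cong′)
        value : Ix X → 𝕍
        value i = to (at X i , at∈ X i)
        image : 𝕍
        image = fam value
        image⁺ : ∀ p → to p ∈ image
        image⁺ (x , x∈) = let i , e = ix x∈ in ∈-respˡ (cong′ {x = at X i , at∈ X i} {y = x , x∈} (≈sym e)) (fam⁺ value i)
        ⊆ω₂ : El image ⊆ ω₂
        ⊆ω₂ p = let i , e = fam⁻ p in ω₂-resp (≈sym e) (h _)
        small : El image ≼ ω₁
        small = rel-ω₁ (λ ξ k → ∃ λ p → to p ≈ ξ × proj₁ (Injection.to f p) ≈ k)
          (λ e (p , q , r) → p , ≈trans q e , r) (λ e (p , q , r) → p , q , ≈trans r e)
          (λ ξ ξ∈ → let i , e = fam⁻ ξ∈ in _ , proj₂ (Injection.to f (at X i , at∈ X i)) , (at X i , at∈ X i) , ≈sym e , ≈refl)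
          (λ _ _ (p , q , r) (p′ , q′ , r′) →
            ≈trans (≈sym q) (≈trans (cong′ {x = p} {y = p′} (Injection.injective f (≈trans r (≈sym r′)))) q′))

-- A perfect tree of bounded sets in a club of [ω₂]^ω.

module PerfectTree (ℓ : Level) (em : ExcludedMiddle (lsuc ℓ)) (ac : SetTheory.Choice ℓ) where
  open import Data.List.Base using (List; []; _∷_)
  open import Data.Nat.Base using (ℕ; zero; suc; _<_; _≤_; _≤′_; ≤′-refl; ≤′-step)
  open import Data.Nat.Induction using (<-rec)
  open import Data.Nat.Properties using (n<1+n; m<n⇒m<1+n; ≤⇒≤′; ≤-total)
  open import Data.Unit.Polymorphic.Base using (⊤; tt)
  open SetTheory ℓ
  open Sets ℓ em
  open Ordinals ℓ em
  open Collapse ℓ em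
  open Choosing ℓ em ac
  open Coding

  []^ω-∪ : ∀ {a} {X : Pred 𝕍 a} {x y} → [ X ]^ω x → [ X ]^ω y → [ X ]^ω (x ∪ y)
  []^ω-∪ (s , f) (s′ , g) = (λ p → [ s , s′ ]′ (∪⁻ p)) , countable-∪ f g

  module PerfectTreeOf {Ω Ω₂ : 𝕍} (Ω≐ : El Ω ≐ ω₁) (Ω₂≐ : El Ω₂ ≐ ω₂) {C : 𝕍} (club : IsClub ω₂ C)
           (closure : 𝕍 → 𝕍) (closure-[]^ω : ∀ {y} → [ ω₂ ]^ω y → [ ω₂ ]^ω (closure y)) where
    open IsClub club
    open Regularity Ω≐

    private
      I : Set ℓ
      I = Ix Ω₂

      pt : I → 𝕍
      pt = at Ω₂

      pt-ω₂ : ∀ b → ω₂ (pt b)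
      pt-ω₂ b = proj₁ Ω₂≐ (at∈ Ω₂ b)

      sing-[]^ω : ∀ b → [ ω₂ ]^ω (upair (pt b) (pt b))
      sing-[]^ω b = (λ p → ω₂-resp (≈sym (sing⁻ p)) (pt-ω₂ b)) , countable-sing

      -- Each node also absorbs `closure` of its predecessor, so the limit of a branch contains the
      -- closure of each of its stages.
      next : 𝕍 → I → 𝕍
      next y b = y ∪ upair (pt b) (pt b) ∪ closure y

      next-[]^ω : ∀ {y} b → [ ω₂ ]^ω y → [ ω₂ ]^ω (next y b)
      next-[]^ω b p = []^ω-∪ p ([]^ω-∪ (sing-[]^ω b) (closure-[]^ω p))

      node : List I → ∃ (El C)
      node [] = let z , z∈ , _ = cofinal ∅ᵛ ((λ p → contradiction p ∉∅) , countable-∅ ∉∅) in z , z∈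
      node (b ∷ t) =
        let y , y∈ = node t ; z , z∈ , _ = cofinal (next y b) (next-[]^ω b (subset y∈)) in z , z∈

      opaque
        Y : List I → 𝕍
        Y t = proj₁ (node t)

        Y∈C : ∀ t → Y t ∈ C
        Y∈C t = proj₂ (node t)

        next⊆ : ∀ b t → El (next (Y t) b) ⊆ El (Y (b ∷ t))
        next⊆ b t = proj₂ (proj₂ (cofinal (next (Y t) b) (next-[]^ω b (subset (proj₂ (node t))))))

      Y-mono : ∀ b t → El (Y t) ⊆ El (Y (b ∷ t))
      Y-mono b t p = next⊆ b t (∪⁺ˡ p)

      Y-pt : ∀ b t → pt b ∈ Y (b ∷ t)
      Y-pt b t = next⊆ b t (∪⁺ʳ (∪⁺ˡ upair⁺ˡ))

      Y-closure : ∀ b t → El (closure (Y t)) ⊆ El (Y (b ∷ t))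
      Y-closure b t p = next⊆ b t (∪⁺ʳ (∪⁺ʳ p))

      -- Unboundedly many successors in ω₂ is the notion of largeness that all thinnings of the tree
      -- preserve. Sequences grow at the head.
      Branching : (List I → Set L) → Set L
      Branching T = ∀ t → T t → ∀ ξ → ω₂ ξ → ∃ λ b → El ξ ⊆ El (pt b) × T (b ∷ t)

      -- Two players extend t ∈ T in turn: the first names ξ < ω₂, the second
      -- a point b ≥ ξ that keeps the sequence in T.  Win ρ a t says that the
      -- first player can force a into Y t, as witnessed by the rank ρ.
      module Game (T : List I → Set L) (branching : Branching T) where

        Win : 𝕍 → 𝕍 → List I → Set L
        Win (sup A r) a t = Lift L (a ∈ Y t) ⊎ ∃ λ ξ → ω₂ ξ ×
          (∀ b → El ξ ⊆ El (pt b) → T (b ∷ t) → Σ A λ i → Win (r i) a (b ∷ t))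

        Win-respᵃ : ∀ ρ {a a′ t} → a ≈ a′ → Win ρ a t → Win ρ a′ t
        Win-respᵃ (sup A r) e (inj₁ (lift p)) = inj₁ (lift (∈-respˡ e p))
        Win-respᵃ (sup A r) e (inj₂ (ξ , o , h)) = inj₂ (ξ , o , λ b s q →
          let i , w = h b s q in i , Win-respᵃ (r i) e w)

        Win-respʳ : ∀ ρ ρ′ {a t} → ρ ≈ ρ′ → Win ρ a t → Win ρ′ a t
        Win-respʳ (sup A r) (sup B s) e (inj₁ p) = inj₁ p
        Win-respʳ (sup A r) (sup B s) e (inj₂ (ξ , o , h)) = inj₂ (ξ , o , λ b q q′ →
          let i , w = h b q q′ ; j , e′ = proj₁ e i in j , Win-respʳ (r i) (s j) e′ w)

        hit : ∀ ρ {a t} → a ∈ Y t → Win ρ a t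
        hit (sup A r) p = inj₁ (lift p)

        move : ∀ ρ {a t} → Win ρ a t → a ∈ Y t ⊎ ∃ λ ξ → ω₂ ξ ×
               (∀ b → El ξ ⊆ El (pt b) → T (b ∷ t) → ∃ λ σ → σ ∈ ρ × Win σ a (b ∷ t))
        move (sup A r) (inj₁ (lift p)) = inj₁ p
        move (sup A r) (inj₂ (ξ , o , h)) = inj₂ (ξ , o , λ b s q →
          let i , w = h b s q in r i , (i , ≈-refl (r i)) , w)

        Lose : 𝕍 → List I → Set L
        Lose a t = ¬ ∃ λ ρ → Win ρ a t

        Lose-∉ : ∀ {a t} → Lose a t → ¬ a ∈ Y t
        Lose-∉ l p = l (∅ᵛ , hit ∅ᵛ p)

        opaque
          -- If from some ξ on every legal point led to a position won by the first player, naming ξ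
          -- would win at t: `rank n` has the ranks of all these positions as members.
          Lose-branching : ∀ a → Branching (λ t → T t × Lose a t)
          Lose-branching a t (q , l) ξ o = stable λ n → l (rank n , inj₂ (ξ , o , λ b s q′ →
            (b , squash {Legal b} (s , q′)) , proj₂ (wins n b (unsquash (squash {Legal b} (s , q′))))))
            where
            Legal : I → Set L
            Legal b = El ξ ⊆ El (pt b) × T (b ∷ t)
            wins : ¬ (∃ λ b → El ξ ⊆ El (pt b) × T (b ∷ t) × Lose a (b ∷ t)) →
                   ∀ b → Legal b → ∃ λ ρ → Win ρ a (b ∷ t)
            wins n b (s , q′) = stable λ m → n (b , s , q′ , m)
            rank : ¬ (∃ λ b → El ξ ⊆ El (pt b) × T (b ∷ t) × Lose a (b ∷ t)) → 𝕍
            rank n = sup (Σ I λ b → Squash (Legal b)) λ (b , s) → proj₁ (wins n b (unsquash s))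

        -- If the first player wins for every a ∈ B, where |B| ≤ ω₁, one run
        -- beats all these strategies at once and puts B into a countable set.
        module Run {B : 𝕍} (B≼ω₁ : El B ≼ ω₁) where

          record State : Set (lsuc L) where
            field
              t   : List I
              t∈T : T t
              r   : Func ∣ El B ∣ 𝕍-setoid
              win : ∀ p → Win (Func.to r p) (proj₁ p) t
          open State

          module _ (s : State) where
            private
              module r = Func (r s)
              u = t s

              Step : 𝕍 → 𝕍 → Set L
              Step a ξ = ω₂ ξ × ((p : a ∈ B) → ∀ b → El ξ ⊆ El (pt b) → T (b ∷ u) →
                a ∈ Y (b ∷ u) ⊎ ∃ λ σ → σ ∈ r.to (a , p) × Win σ a (b ∷ u))

              r-irr : ∀ {a a′ σ} (e : a ≈ a′) p p′ → σ ∈ r.to (a , p) → σ ∈ r.to (a′ , p′)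
              r-irr {a} {a′} e p p′ = ∈-respʳ {x = r.to (a , p)} {r.to (a′ , p′)} (r.cong {a , p} {a′ , p′} e)

              Step-respˡ : ∀ {a a′ ξ} → a ≈ a′ → Step a ξ → Step a′ ξ
              Step-respˡ {a} {a′} {ξ} e (o , h) = o , λ p b s′ q → [ inj₁ ∘ ∈-respˡ {x = a} {a′} e , (λ (σ , σ∈ , w) →
                inj₂ (σ , r-irr e (∈-respˡ (≈sym e) p) p σ∈ , Win-respᵃ σ {a} {a′} {b ∷ u} e w)) ]′ (h (∈-respˡ (≈sym e) p) b s′ q)

              Step-respʳ : ∀ {a ξ ξ′} → ξ ≈ ξ′ → Step a ξ → Step a ξ′
              Step-respʳ {a} {ξ} {ξ′} e (o , h) = ω₂-resp e o , λ p b s′ q → h p b (λ z∈ → s′ (∈-respʳ {x = ξ} {ξ′} e z∈)) q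

              Step-total : ∀ a → a ∈ B → ∃ (Step a)
              Step-total a p with move (r.to (a , p)) (win s (a , p))
              ... | inj₁ p′ = ∅ᵛ , ω₁⊆ω₂ ω₁-∅ , λ _ b _ _ → inj₁ (Y-mono b u p′)
              ... | inj₂ (ξ , o , h) = ξ , o , λ p′ b s′ q → let σ , σ∈ , w = h b s′ q in inj₂ (σ , r-irr ≈refl p p′ σ∈ , w)

              strategy : Σ (Func ∣ El B ∣ 𝕍-setoid) λ g → ∀ p → Step (proj₁ p) (Func.to g p)
              strategy = choose B Step Step-respˡ Step-respʳ Step-total

              -- Here |B| ≤ ω₁ enters: one ζ < ω₂ exceeds the moves of all strategies, so a single
              -- point b answers all of them.
              bounded : ∃ λ ζ → ω₂ ζ × ∀ p → El (Func.to (proj₁ strategy) p) ⊆ El ζ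
              bounded = ω₂-bound B≼ω₁ (proj₁ strategy) (proj₁ ∘ proj₂ strategy)

              extension : ∃ λ b → El (proj₁ bounded) ⊆ El (pt b) × T (b ∷ u)
              extension = branching u (t∈T s) (proj₁ bounded) (proj₁ (proj₂ bounded))

              b = proj₁ extension

              -- The rank of a has to drop only until a is caught; afterwards it is unconstrained.
              Rank : 𝕍 → 𝕍 → Set L
              Rank a σ = Win σ a (b ∷ u) × (a ∈ Y (b ∷ u) ⊎ ((p : a ∈ B) → σ ∈ r.to (a , p)))

              Rank-respˡ : ∀ {a a′ σ} → a ≈ a′ → Rank a σ → Rank a′ σ
              Rank-respˡ {a} {a′} {σ} e (w , inj₁ p) = Win-respᵃ σ {a} {a′} {b ∷ u} e w , inj₁ (∈-respˡ e p)
              Rank-respˡ {a} {a′} {σ} e (w , inj₂ h) = Win-respᵃ σ {a} {a′} {b ∷ u} e w , inj₂ λ p →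
                r-irr e (∈-respˡ (≈sym e) p) p (h (∈-respˡ (≈sym e) p))

              Rank-respʳ : ∀ {a σ σ′} → σ ≈ σ′ → Rank a σ → Rank a σ′
              Rank-respʳ {a} {σ} {σ′} e (w , inj₁ p) = Win-respʳ σ σ′ {a} {b ∷ u} e w , inj₁ p
              Rank-respʳ {a} {σ} {σ′} e (w , inj₂ h) = Win-respʳ σ σ′ {a} {b ∷ u} e w , inj₂ λ p → ∈-respˡ e (h p)

              Rank-total : ∀ a → a ∈ B → ∃ (Rank a)
              Rank-total a p with proj₂ (proj₂ strategy (a , p)) p b
                (λ z∈ → proj₁ (proj₂ extension) (proj₂ (proj₂ bounded) (a , p) z∈)) (proj₂ (proj₂ extension))
              ... | inj₁ p′ = ∅ᵛ , hit ∅ᵛ p′ , inj₁ p′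
              ... | inj₂ (σ , σ∈ , w) = σ , w , inj₂ λ p′ → r-irr ≈refl p p′ σ∈

              ranks : Σ (Func ∣ El B ∣ 𝕍-setoid) λ g → ∀ p → Rank (proj₁ p) (Func.to g p)
              ranks = choose B Rank Rank-respˡ Rank-respʳ Rank-total

            next-state : State
            next-state = record { t = b ∷ u ; t∈T = proj₂ (proj₂ extension) ; r = proj₁ ranks ; win = λ p → proj₁ (proj₂ ranks p) }

            descend : ∀ p → proj₁ p ∈ Y (t next-state) ⊎ Func.to (r next-state) p ∈ Func.to (r s) p
            descend (a , p) = case proj₂ (proj₂ ranks (a , p)) of λ
              { (inj₁ q) → inj₁ q ; (inj₂ h) → inj₂ (h p) }

          module _ (s₀ : State) where
            run : ℕ → State
            run zero    = s₀
            run (suc n) = next-state (run n)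

            -- Otherwise the ranks attached to p would descend forever along ∈.
            caught : ∀ p → ∃ λ n → proj₁ p ∈ Y (t (run n))
            caught p = stableℓ λ never → ∈-ind (λ ρ → ∀ n → ¬ ρ ≈ Func.to (r (run n)) p)
              (λ ρ ih n e → [ (λ q → never (suc n , q))
                            , (λ q → ih _ (∈-respʳ (≈sym e) q) (suc n) ≈refl) ]′ (descend (run n) p))
              (Func.to (r s₀) p) 0 ≈refl

            countable : Countable (El B)
            countable = countable-⊆ (λ {x} p → let n , q = caught (x , p) in n , lift q)
              (countable-⋃ℕ {C = λ n z → Lift L (z ∈ Y (t (run n)))} (λ n e (lift p) → lift (∈-respˡ e p))
                λ n → countable-⊆ lower (proj₂ (subset (Y∈C (t (run n))))))

        opaque
          -- Otherwise the first player could, starting at s, force each point of the set B of legal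
          -- next points. Some B ∩ α is uncountable and of size at most ω₁, and `Run` would put it
          -- into a countable set.
          avoid : ∀ s → T s → ∃ λ b → T (b ∷ s) × Lose (pt b) s
          avoid s s∈T = stable λ n → unbounded λ α o → stable λ uncountable → uncountable
            (Run.countable (small α o) (record
              { t = s ; t∈T = s∈T ; r = proj₁ (strategies n α) ; win = proj₂ (strategies n α) }))
            where
            B : 𝕍
            B = sep Ω₂ λ z → ∃ λ b → z ≈ pt b × T (b ∷ s)
            B-resp : Resp λ z → ∃ λ b → z ≈ pt b × T (b ∷ s)
            B-resp e (b , e′ , q) = b , ≈trans (≈sym e) e′ , q
            In : 𝕍 → 𝕍 → Set L
            In α z = Lift L (z ∈ α)
            In-resp : ∀ α → Resp (In α)
            In-resp α e (lift p) = lift (∈-respˡ e p)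
            _∩ᵛ_ : 𝕍 → 𝕍 → 𝕍
            x ∩ᵛ α = sep x (In α)
            wins : ¬ (∃ λ b → T (b ∷ s) × Lose (pt b) s) → ∀ {α} (p : ∃ (El (B ∩ᵛ α))) → ∃ λ ρ → Win ρ (proj₁ p) s
            wins n (a , p) = let b , e , q = sep⁻ B-resp (sep⊆ p) ; ρ , w = stable λ l → n (b , q , l)
                             in ρ , Win-respᵃ ρ (≈sym e) w
            strategies : ¬ (∃ λ b → T (b ∷ s) × Lose (pt b) s) → ∀ α →
                         Σ (Func ∣ El (B ∩ᵛ α) ∣ 𝕍-setoid) λ g → ∀ p → Win (Func.to g p) (proj₁ p) s
            strategies n α = choose (B ∩ᵛ α) (λ a ρ → Win ρ a s) (λ {a} {a′} {ρ} e → Win-respᵃ ρ {a} {a′} {s} e)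
                               (λ {a} {ρ} {ρ′} e → Win-respʳ ρ ρ′ {a} {s} e) (λ a p → wins n {α} (a , p))
            small : ∀ α → ω₂ α → El (B ∩ᵛ α) ≼ ω₁
            small α o = ≼-trans {D = El α} (≼-⊆ λ p → lower (sep⁻ (In-resp α) p)) (proj₂ o)
            -- If all proper initial segments of B were countable, collapsing B would embed it into
            -- ω₁. Then B would be bounded in ω₂, against branching at s.
            unbounded : ¬ (∀ α → ω₂ α → Countable (El (B ∩ᵛ α)))
            unbounded h =
              let b , s′ , q = branching s s∈T ⌊ ⋃ B ⌋⁺ (ω₂-suc ⋃B-ω₂)
              in ∈-irrefl (⋃⁺ (sep⁺ B-resp (at∈ Ω₂ b) (b , ≈refl , q)) (s′ self∈suc))
              where
              B⊆ω₂ : El B ⊆ ω₂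
              B⊆ω₂ p = proj₁ Ω₂≐ (sep⊆ p)
              collapse-ω₁ : ∀ {β} → β ∈ B → ω₁ (π B β)
              collapse-ω₁ {β} p = Ord⇒IsOrdinal (Ord-π (ω₂-Ord (B⊆ω₂ p))) ,
                countable-img {C = λ γ → Lift L (γ ∈ B ∩ᵛ β)} (λ γ z → Lift L (z ≈ π B γ))
                  (λ e (lift q) → lift (≈trans (≈sym e) q))
                  (λ _ _ e (lift q) (lift q′) → ≈trans q (≈trans (π-cong ≈refl e) (≈sym q′)))
                  (countable-⊆ lower (h β (B⊆ω₂ p)))
                  (λ z z∈ → let γ , γ∈ , γ∈B , e = π⁻ z∈ in γ , lift (sep⁺ (In-resp β) γ∈B (lift γ∈)) , lift e)
              B≼ω₁ : El B ≼ ω₁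
              B≼ω₁ = ≼-by (λ (β , p) → π B β , collapse-ω₁ p) (λ _ _ e → π-cong ≈refl e)
                (λ (β , p) (γ , q) e → π-inj (ω₂-Ord (B⊆ω₂ p)) (ω₂-Ord (B⊆ω₂ q)) p q e)
              ⋃B-ω₂ : ω₂ (⋃ B)
              ⋃B-ω₂ = ω₂-⋃ B≼ω₁ B⊆ω₂

      record Tree : Set (lsuc L) where
        field
          T         : List I → Set L
          branching : Branching T
          root      : List I
          root∈     : T root
      open Tree

      module _ (𝕋 : Tree) where
        open Game (T 𝕋) (branching 𝕋)

        private
          split = avoid (root 𝕋) (root∈ 𝕋)

        splitter : 𝕍
        splitter = pt (proj₁ split)

        -- In the `true` half the splitter enters already at the root. In the `false` half the tree
        -- is thinned to the positions where the first player cannot force the splitter, so no node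
        -- there contains it.
        child : Bool → Tree
        child true = record { T = T 𝕋 ; branching = branching 𝕋 ; root = proj₁ split ∷ root 𝕋 ; root∈ = proj₁ (proj₂ split) }
        child false =
          -- Any successor in the thinned tree serves as the new root, whence the trivial lower
          -- bound `∅ᵛ`.
          let b , _ , q = Lose-branching splitter (root 𝕋) (root∈ 𝕋 , proj₂ (proj₂ split)) ∅ᵛ (ω₁⊆ω₂ ω₁-∅)
          in record { T = λ t → T 𝕋 t × Lose splitter t ; branching = Lose-branching splitter ; root = b ∷ root 𝕋 ; root∈ = q }

        child-root : ∀ c → ∃ λ b → root (child c) ≡ b ∷ root 𝕋
        child-root true  = _ , refl
        child-root false = _ , refl

        child-⊆ : ∀ c {t} → T (child c) t → T 𝕋 t
        child-⊆ true  = id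
        child-⊆ false = proj₁

        splitter∈ : splitter ∈ Y (root (child true))
        splitter∈ = Y-pt _ _

        splitter∉ : ∀ {t} → T (child false) t → ¬ splitter ∈ Y t
        splitter∉ (_ , l) = Lose-∉ l

      whole : Tree
      whole = record
        { T = λ _ → ⊤ ; root = [] ; root∈ = tt
        ; branching = λ _ _ ξ o → let b , e = ix (proj₂ Ω₂≐ o) in b , ∈-respʳ e , tt }

      subtree : List Bool → Tree
      subtree []       = whole
      subtree (c ∷ cs) = child (subtree cs) c

      prefix : (ℕ → Bool) → ℕ → List Bool
      prefix f zero    = []
      prefix f (suc n) = f n ∷ prefix f n

      stage : (ℕ → Bool) → ℕ → List I
      stage f n = root (subtree (prefix f n))

      stage-mono : ∀ f {m n} → m ≤′ n → El (Y (stage f m)) ⊆ El (Y (stage f n))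
      stage-mono f ≤′-refl p = p
      stage-mono f {n = suc n} (≤′-step le) p with child-root (subtree (prefix f n)) (f n)
      ... | b , e = subst (λ s → _ ∈ Y s) (sym e) (Y-mono b _ (stage-mono f le p))

      stage-closure : ∀ f n → El (closure (Y (stage f n))) ⊆ El (Y (stage f (suc n)))
      stage-closure f n p with child-root (subtree (prefix f n)) (f n)
      ... | b , e = subst (λ s → _ ∈ Y s) (sym e) (Y-closure b _ p)

      subtree-mono : ∀ f {m n} → m ≤′ n → ∀ {t} → T (subtree (prefix f n)) t → T (subtree (prefix f m)) t
      subtree-mono f ≤′-refl q = q
      subtree-mono f {n = suc n} (≤′-step le) q = subtree-mono f le (child-⊆ (subtree (prefix f n)) (f n) q)

    branch : (ℕ → Bool) → ℕ → 𝕍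
    branch f n = Y (stage f n)

    private
      closed-branch : ∀ f → (λ b → ∃ λ i → b ∈ branch f i) ∈ᶜ C
      closed-branch f = closed (branch f) (λ n → Y∈C (stage f n)) (λ n → stage-mono f (≤′-step ≤′-refl))

    limit : (ℕ → Bool) → 𝕍
    limit f = proj₁ (closed-branch f)

    limit∈ : ∀ f → limit f ∈ C
    limit∈ f = proj₁ (proj₂ (closed-branch f))

    limit≐ : ∀ f → El (limit f) ≐ λ b → ∃ λ i → b ∈ branch f i
    limit≐ f = proj₂ (proj₂ (closed-branch f))

    branch-mono : ∀ f {m n} → m ≤ n → El (branch f m) ⊆ El (branch f n)
    branch-mono f le = stage-mono f (≤⇒≤′ le)

    branch-closure : ∀ f n → El (closure (branch f n)) ⊆ El (branch f (suc n))
    branch-closure = stage-closure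

    -- There are continuum many limits, but all are unions of nodes, and the nodes are indexed by
    -- finite binary sequences. So the union of all nodes is countable.
    limit-bounded : ∃ λ α → ω₂ α × ∀ f → El (limit f) ⊆ El α
    limit-bounded = ⌊ ⋃ all ⌋⁺ , ω₂-suc ⋃-ω₂ , λ f p →
      let n , q = proj₁ (limit≐ f) p in ⊆ω₂⇒⊆suc⋃ all⊆ω₂ ⋃-ω₂ (all⁺ (prefix f n) q)
      where
      all : 𝕍
      all = ⋃ (fam {Lift ℓ (List Bool)} λ (lift cs) → Y (root (subtree cs)))
      all⁺ : ∀ cs → El (Y (root (subtree cs))) ⊆ El all
      all⁺ cs p = ⋃⁺ (fam⁺ _ (lift cs)) p
      all⁻ : ∀ {z} → z ∈ all → ∃ λ cs → z ∈ Y (root (subtree cs))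
      all⁻ p = let y , y∈ , q = ⋃⁻ p ; lift cs , e = fam⁻ y∈ in cs , ∈-respʳ e q
      all⊆ω₂ : El all ⊆ ω₂
      all⊆ω₂ p = let cs , q = all⁻ p in proj₁ (subset (Y∈C (root (subtree cs)))) q
      ⋃-ω₂ : ω₂ (⋃ all)
      ⋃-ω₂ = ω₂-⋃ (countable⇒≼ω₁ (countable-⊆ (λ p → let cs , q = all⁻ p in cs , lift q)
        (countable-⋃-ix codeList codeList-injective {λ cs z → Lift L (z ∈ Y (root (subtree cs)))}
          (λ cs e (lift p) → lift (∈-respˡ e p))
          (λ cs → countable-⊆ lower (proj₂ (subset (Y∈C (root (subtree cs))))))))) all⊆ω₂

    -- At the first place where f and g differ, the splitter of their common subtree lies in one
    -- limit and in no stage of the other branch.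
    limit-injective : ∀ {f g} → limit f ≈ limit g → ∀ n → f n ≡ g n
    limit-injective {f} {g} e = <-rec (λ n → f n ≡ g n) λ n ih → agree n (same-prefix n λ m lt → ih lt)
      where
      same-prefix : ∀ n → (∀ m → m < n → f m ≡ g m) → prefix f n ≡ prefix g n
      same-prefix zero    h = refl
      same-prefix (suc n) h = cong₂ _∷_ (h n (n<1+n n)) (same-prefix n λ m lt → h m (m<n⇒m<1+n lt))
      differ : ∀ {f g} n → limit f ≈ limit g → prefix f n ≡ prefix g n → f n ≡ true → ¬ g n ≡ false
      differ {f} {g} n e ep ef eg = go (proj₁ (limit≐ g) (∈-respʳ e (proj₂ (limit≐ f) (suc n , a∈))))
        where
        a = splitter (subtree (prefix f n))
        a∈ : a ∈ branch f (suc n)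
        a∈ = subst (λ c → a ∈ Y (root (child (subtree (prefix f n)) c))) (sym ef) (splitter∈ (subtree (prefix f n)))
        low : ∀ {t} → T (subtree (prefix g (suc n))) t → ¬ a ∈ Y t
        low {t} q = splitter∉ (subtree (prefix f n)) {t} (subst (λ cs → T (child (subtree cs) false) t) (sym ep)
                      (subst (λ c → T (child (subtree (prefix g n)) c) t) eg q))
        go : ¬ ∃ λ i → a ∈ branch g i
        go (i , p) with ≤-total i (suc n)
        ... | inj₁ le = low {stage g (suc n)} (root∈ (subtree (prefix g (suc n)))) (branch-mono g le p)
        ... | inj₂ le = low {stage g i} (subtree-mono g {suc n} {i} (≤⇒≤′ le) {stage g i} (root∈ (subtree (prefix g i)))) p
      agree : ∀ n → prefix f n ≡ prefix g n → f n ≡ g n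
      agree n ep with f n in ef | g n in eg
      ... | true  | true  = refl
      ... | false | false = refl
      ... | true  | false = contradiction eg (differ {f} {g} n e ep ef)
      ... | false | true  = contradiction ef (differ {g} {f} n (≈sym e) (sym ep) eg)

-- Absoluteness, and collapsing inside transitive models of ZF⁻.

module Models (ℓ : Level) (em : ExcludedMiddle (lsuc ℓ)) where
  open import Data.Fin.Base using (Fin; zero; suc)
  open import Data.Nat.Base using (ℕ; zero; suc)
  open import Data.Vec.Functional using (_∷_; [])
  open SetTheory ℓ
  open Sets ℓ em
  open Ordinals ℓ em
  open Collapse ℓ em
  open Equivalence using (to; from)

  private
    pattern v0 = zero
    pattern v1 = suc zero
    pattern v2 = suc (suc zero)
    pattern v3 = suc (suc (suc zero))
    pattern v4 = suc (suc (suc (suc zero)))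
    pattern v5 = suc (suc (suc (suc (suc zero))))

  ∨-out : {A B : Set L} → ¬ (¬ A × ¬ B) → A ⊎ B
  ∨-out n = stable λ m → n (m ∘ inj₁ , m ∘ inj₂)

  ∨-in : ∀ {a b} {A : Set a} {B : Set b} → A ⊎ B → ¬ (¬ A × ¬ B)
  ∨-in (inj₁ x) (n , _) = n x
  ∨-in (inj₂ y) (_ , m) = m y

  ∃-in : ∀ {a b} {A : Set a} {B : A → Set b} → ∃ B → ¬ (∀ x → ¬ B x)
  ∃-in (x , p) n = n x p

  module Transitive {K : 𝕍} (K-trans : IsTransitive K) where

    private variable
      n : ℕ
      i j k : Fin n
      ρ : Fin n → ∃ (El K)

    infix 8 ⟪_⟫
    ⟪_⟫ : ∃ (El K) → 𝕍
    ⟪_⟫ = proj₁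

    down : ∀ {x} (p : ∃ (El K)) → x ∈ ⟪ p ⟫ → ∃ (El K)
    down p x∈ = _ , K-trans _ (proj₂ p) x∈

    ⊨UPair⁻ : El K ⊨ isUPair i j k [ ρ ] → ⟪ ρ i ⟫ ≈ upair ⟪ ρ j ⟫ ⟪ ρ k ⟫
    ⊨UPair⁻ {i = i} {j} {k} {ρ} f = ext
      (λ p → case ∨-out (¬×¬⇒→ (proj₁ (f (down (ρ i) p))) (lift p)) of λ
        { (inj₁ (lift e)) → ∈-respˡ (≈sym e) upair⁺ˡ
        ; (inj₂ (lift e)) → ∈-respˡ (≈sym e) upair⁺ʳ })
      (λ p → case upair⁻ p of λ
        { (inj₁ e) → ∈-respˡ (≈sym e) (lower (¬×¬⇒→ (proj₂ (f (ρ j))) (∨-in (inj₁ (lift ≈refl)))))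
        ; (inj₂ e) → ∈-respˡ (≈sym e) (lower (¬×¬⇒→ (proj₂ (f (ρ k))) (∨-in (inj₂ (lift ≈refl))))) })

    ⊨UPair⁺ : ⟪ ρ i ⟫ ≈ upair ⟪ ρ j ⟫ ⟪ ρ k ⟫ → El K ⊨ isUPair i j k [ ρ ]
    ⊨UPair⁺ e w =
        →⇒¬×¬ (λ (lift p) → ∨-in (case upair⁻ (∈-respʳ e p) of λ
          { (inj₁ q) → inj₁ (lift q) ; (inj₂ q) → inj₂ (lift q) }))
      , →⇒¬×¬ (λ p → lift (∈-respʳ (≈sym e) (case ∨-out p of λ
          { (inj₁ (lift q)) → ∈-respˡ (≈sym q) upair⁺ˡ ; (inj₂ (lift q)) → ∈-respˡ (≈sym q) upair⁺ʳ })))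

    ⊨Pair⁻ : El K ⊨ isPair i j k [ ρ ] → ⟪ ρ i ⟫ ≈ pair ⟪ ρ j ⟫ ⟪ ρ k ⟫
    ⊨Pair⁻ {i = i} {j} {k} {ρ} f =
      let s , g = ¬∀¬⇒∃ f ; d , us , ud , up = ¬∀¬⇒∃ g
      in ≈trans (⊨UPair⁻ {i = suc (suc i)} {v1} {v0} {d ∷ s ∷ ρ} up)
           (upair-cong (⊨UPair⁻ {i = v1} {suc (suc j)} {suc (suc j)} {d ∷ s ∷ ρ} us)
                       (⊨UPair⁻ {i = v0} {suc (suc j)} {suc (suc k)} {d ∷ s ∷ ρ} ud))

    ⊨Pair⁺ : ⟪ ρ i ⟫ ≈ pair ⟪ ρ j ⟫ ⟪ ρ k ⟫ → El K ⊨ isPair i j k [ ρ ]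
    ⊨Pair⁺ {ρ = ρ} {i} {j} {k} e = ∃-in (s , ∃-in (d ,
        ⊨UPair⁺ {ρ = d ∷ s ∷ ρ} {v1} {suc (suc j)} {suc (suc j)} ≈refl ,
        ⊨UPair⁺ {ρ = d ∷ s ∷ ρ} {v0} {suc (suc j)} {suc (suc k)} ≈refl ,
        ⊨UPair⁺ {ρ = d ∷ s ∷ ρ} {suc (suc i)} {v1} {v0} e))
      where
      s = down (ρ i) (∈-respʳ (≈sym e) upair⁺ˡ)
      d = down (ρ i) (∈-respʳ (≈sym e) upair⁺ʳ)

    ⊨maps⁻ : El K ⊨ maps i j k [ ρ ] → pair ⟪ ρ j ⟫ ⟪ ρ k ⟫ ∈ ⟪ ρ i ⟫
    ⊨maps⁻ {i = i} {j} {k} {ρ} f =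
      let p , lift p∈ , g = ¬∀¬⇒∃ f in ∈-respˡ (⊨Pair⁻ {i = v0} {suc j} {suc k} {p ∷ ρ} g) p∈

    ⊨maps⁺ : pair ⟪ ρ j ⟫ ⟪ ρ k ⟫ ∈ ⟪ ρ i ⟫ → El K ⊨ maps i j k [ ρ ]
    ⊨maps⁺ {ρ = ρ} {j} {k} {i} p = ∃-in (down (ρ i) p , lift p , ⊨Pair⁺ {ρ = down (ρ i) p ∷ ρ} {v0} {suc j} {suc k} ≈refl)

    ⊨transitive⁻ : El K ⊨ isTransitive i [ ρ ] → IsTransitive ⟪ ρ i ⟫
    ⊨transitive⁻ {i = i} {ρ} f y y∈ z∈ =
      lower (¬×¬⇒→ (¬×¬⇒→ (f (down (ρ i) y∈)) (lift y∈) (down (down (ρ i) y∈) z∈)) (lift z∈))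

    ⊨transitive⁺ : IsTransitive ⟪ ρ i ⟫ → El K ⊨ isTransitive i [ ρ ]
    ⊨transitive⁺ t y = →⇒¬×¬ λ (lift y∈) z → →⇒¬×¬ λ (lift z∈) → lift (t _ y∈ z∈)

    ⊨Ord⁻ : El K ⊨ isOrdinal i [ ρ ] → Ord ⟪ ρ i ⟫
    ⊨Ord⁻ {i = i} {ρ} (t , h) = ⊨transitive⁻ {i = i} {ρ} t , λ y y∈ →
      ⊨transitive⁻ {i = v0} {down (ρ i) y∈ ∷ ρ} (¬×¬⇒→ (h (down (ρ i) y∈)) (lift y∈))

    ⊨Ord⁺ : Ord ⟪ ρ i ⟫ → El K ⊨ isOrdinal i [ ρ ]
    ⊨Ord⁺ {ρ = ρ} {i} (t , h) = ⊨transitive⁺ {ρ = ρ} {i} t , λ y → →⇒¬×¬ λ (lift y∈) → ⊨transitive⁺ {ρ = y ∷ ρ} {v0} (h _ y∈)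

    ⊨successor⁺ : ⟪ ρ i ⟫ ≈ ⌊ ⟪ ρ j ⟫ ⌋⁺ → El K ⊨ isSuccessor i j [ ρ ]
    ⊨successor⁺ e w =
        →⇒¬×¬ (λ (lift p) → ∨-in (case suc⁻ (∈-respʳ e p) of λ
          { (inj₁ q) → inj₁ (lift q) ; (inj₂ q) → inj₂ (lift q) }))
      , →⇒¬×¬ (λ p → lift (∈-respʳ (≈sym e) (case ∨-out p of λ
          { (inj₁ (lift q)) → ∪⁺ˡ q ; (inj₂ (lift q)) → ∈-respˡ (≈sym q) self∈suc })))

    -- By ∈-induction: a nonempty m below the ω of K is not a limit, so some v ∈ m has no successor
    -- in m, which forces m = v + 1.
    ω-numeral : ∀ (ρ : Fin n → ∃ (El K)) i → El K ⊨ isOmega i [ ρ ] → ∀ m → m ∈ ⟪ ρ i ⟫ → ∃ λ k → m ≈ suc^ k ∅ᵛ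
    ω-numeral ρ i ((o , _) , h) = ∈-ind (λ m → m ∈ ⟪ ρ i ⟫ → ∃ λ k → m ≈ suc^ k ∅ᵛ) step
      where
      oi : Ord ⟪ ρ i ⟫
      oi = ⊨Ord⁻ {i = i} {ρ} o
      step : ∀ m → (∀ v → v ∈ m → v ∈ ⟪ ρ i ⟫ → ∃ λ k → v ≈ suc^ k ∅ᵛ) → m ∈ ⟪ ρ i ⟫ → ∃ λ k → m ≈ suc^ k ∅ᵛ
      step m ih m∈ with em {∃ λ v → v ∈ m}
      ... | no empty = 0 , ext (λ p → contradiction (_ , p) empty) (λ p → contradiction p ∉∅)
      ... | yes (v₀ , v₀∈) =
        let m̂ = down (ρ i) m∈
            om = Ord-∈ oi m∈
            v , n = ¬∀⇒∃¬ λ a → ¬×¬⇒→ (h m̂) (lift m∈) (⊨Ord⁺ {ρ = m̂ ∷ ρ} {v0} om , ∃-in (down m̂ v₀∈ , lift v₀∈) , a)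
            v∈ : ⟪ v ⟫ ∈ m
            v∈ = stableℓ λ q → n (→⇒¬×¬ λ (lift p) → contradiction p q)
            k , e = ih _ v∈ (Ord-trans oi m∈ v∈)
            sub : El ⌊ ⟪ v ⟫ ⌋⁺ ⊆ El m
            sub p = case suc⁻ p of λ { (inj₁ q) → Ord-trans om v∈ q ; (inj₂ q) → ∈-respˡ (≈sym q) v∈ }
        in case ⊆⇒∈⊎≈ (Ord-suc (Ord-∈ om v∈)) om sub of λ
          { (inj₁ p) → contradiction (→⇒¬×¬ λ _ → ∃-in (down m̂ p , lift p ,
              ⊨successor⁺ {ρ = down m̂ p ∷ v ∷ m̂ ∷ ρ} {v0} {v1} ≈refl)) n
          ; (inj₂ p) → suc k , ≈trans (≈sym p) (suc-cong e) }

    -- The ω of K consists of true numerals, so an injection into it that belongs to K can be read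
    -- as an injection into ℕ.
    ⊨countable⁻ : ∀ z → El K ⊨ isCountable zero [ z ∷ [] ] → Countable (El ⟪ z ⟫)
    ⊨countable⁻ z c =
      let w , c′ = ¬∀¬⇒∃ c ; f , om , (_ , fun) , inj = ¬∀¬⇒∃ c′
          ρ = f ∷ w ∷ z ∷ []
      in rel-ℕ (λ a k → Lift L (pair a (suc^ k ∅ᵛ) ∈ ⟪ f ⟫))
        (λ e (lift p) → lift (∈-respˡ (pair-cong e ≈refl) p))
        (λ a a∈ →
          let â = down z a∈
              m , lift m∈ , mp , _ = ¬∀¬⇒∃ (¬×¬⇒→ (fun â) (lift a∈))
              k , e = ω-numeral ρ v1 om ⟪ m ⟫ m∈
          in k , lift (∈-respˡ (pair-cong ≈refl e) (⊨maps⁻ {i = v2} {v1} {v0} {m ∷ â ∷ ρ} mp)))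
        (λ {a} {a′} {k} a∈ a′∈ (lift p) (lift q) →
          let â = down z a∈ ; â′ = down z a′∈
              k̂ : ∃ (El K)
              k̂ = down (down (down f p) upair⁺ʳ) upair⁺ʳ
              σ = k̂ ∷ â′ ∷ â ∷ ρ
          in lower (¬×¬⇒→ (¬×¬⇒→ (¬×¬⇒→ (inj â) (lift a∈) â′) (lift a′∈) k̂)
               (⊨maps⁺ {ρ = σ} {v2} {v0} {v3} p , ⊨maps⁺ {ρ = σ} {v1} {v0} {v3} q)))

    module Closure (zf : El K ⊨ZF⁻) where
      open _⊨ZF⁻ zf

      upair∈ : ∀ {x y} → x ∈ K → y ∈ K → upair x y ∈ K
      upair∈ x∈ y∈ = let z , h = pairing (_ , x∈) (_ , y∈) in ∈-respˡ (ext
        (λ p → case to (h (down z p)) p of λ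
          { (inj₁ e) → ∈-respˡ (≈sym e) upair⁺ˡ ; (inj₂ e) → ∈-respˡ (≈sym e) upair⁺ʳ })
        (λ p → case upair⁻ p of λ
          { (inj₁ e) → ∈-respˡ (≈sym e) (from (h (_ , x∈)) (inj₁ ≈refl))
          ; (inj₂ e) → ∈-respˡ (≈sym e) (from (h (_ , y∈)) (inj₂ ≈refl)) })) (proj₂ z)

      ⋃∈ : ∀ {x} → x ∈ K → ⋃ x ∈ K
      ⋃∈ x∈ = let u , h = union (_ , x∈) in ∈-respˡ (ext
        (λ p → let y , y∈ , q = to (h (down u p)) p in ⋃⁺ y∈ q)
        (λ p → let y , y∈ , q = ⋃⁻ p ; ŷ = down (_ , x∈) y∈ in from (h (down ŷ q)) (ŷ , y∈ , q))) (proj₂ u)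

      ∪∈ : ∀ {x y} → x ∈ K → y ∈ K → x ∪ y ∈ K
      ∪∈ x∈ y∈ = ⋃∈ (upair∈ x∈ y∈)

      suc∈ : ∀ {x} → x ∈ K → ⌊ x ⌋⁺ ∈ K
      suc∈ x∈ = ∪∈ x∈ (upair∈ x∈ x∈)

      pair∈ : ∀ {x y} → x ∈ K → y ∈ K → pair x y ∈ K
      pair∈ x∈ y∈ = upair∈ (upair∈ x∈ x∈) (upair∈ x∈ y∈)

      ∩∈ : ∀ {x y} → x ∈ K → y ∈ K → (El x ∩ El y) ∈ᶜ K
      ∩∈ x∈ y∈ = let z , h = separation (v0 ∈̇ v1) ((_ , y∈) ∷ []) (_ , x∈) in ⟪ z ⟫ , proj₂ z ,
        (λ p → let q , lift r = to (h (down z p)) p in q , r) , (λ (q , r) → from (h (down (_ , x∈) q)) (q , lift r))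

    -- The collapse b = π y a is defined over K by a set g of pairs ⟨d , e⟩
    -- containing ⟨a , b⟩ in which always e = {e′ : ⟨d′ , e′⟩ ∈ g , d′ ∈ d ∩ y}.
    IsCollapse : 𝕍 → 𝕍 → Set L
    IsCollapse y g = ∀ d e → pair d e ∈ g →
        (∀ e′ → e′ ∈ e → ∃ λ d′ → d′ ∈ d × d′ ∈ y × pair d′ e′ ∈ g)
      × (∀ d′ → d′ ∈ d → d′ ∈ y → ∃ λ e′ → e′ ∈ e × pair d′ e′ ∈ g)

    IsCollapse⇒π : ∀ {y g} → IsCollapse y g → ∀ d e → pair d e ∈ g → e ≈ π y d
    IsCollapse⇒π {y} {g} c = ∈-ind (λ d → ∀ e → pair d e ∈ g → e ≈ π y d) λ d ih e p → ext
      (λ {e′} q → let d′ , d′∈ , d′∈y , r = proj₁ (c d e p) e′ q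
                  in ∈-respˡ (≈sym (ih d′ d′∈ e′ r)) (π⁺ d′∈ d′∈y))
      (λ q → let d′ , d′∈ , d′∈y , f = π⁻ q ; e′ , e′∈ , r = proj₂ (c d e p) d′ d′∈ d′∈y
             in ∈-respˡ (≈trans (ih d′ d′∈ e′ r) (≈sym f)) e′∈)

    private
      ↑2 : Fin n → Fin (suc (suc n))
      ↑2 i = suc (suc i)

    isCollapseᶠ : (g y : Fin n) → Formula n
    isCollapseᶠ g y = ∀̇ ∀̇ (maps (↑2 g) v1 v0 ⇒̇
        ∀∈̇ v0 (∃∈̇ v2 (v0 ∈̇ ↑2 (↑2 y) ∧̇ maps (↑2 (↑2 g)) v0 v1))
      ∧̇ ∀∈̇ v1 (v0 ∈̇ suc (↑2 y) ⇒̇ ∃∈̇ v1 (maps (↑2 (↑2 g)) v1 v0)))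

    πᶠ : (a b y : Fin n) → Formula n
    πᶠ a b y = ∃̇ (isCollapseᶠ v0 (suc y) ∧̇ maps v0 (suc a) (suc b))

    ⊨isCollapse⁻ : ∀ i j → El K ⊨ isCollapseᶠ i j [ ρ ] → IsCollapse ⟪ ρ j ⟫ ⟪ ρ i ⟫
    ⊨isCollapse⁻ {ρ = ρ} i j f d e p =
        (λ e′ e′∈ →
          let ê′ = down ê e′∈
              d′ , lift d′∈ , lift d′∈y , m = ¬∀¬⇒∃ (¬×¬⇒→ (proj₁ body ê′) (lift e′∈))
          in ⟪ d′ ⟫ , d′∈ , d′∈y , ⊨maps⁻ {i = ↑2 (↑2 i)} {v0} {v1} {d′ ∷ ê′ ∷ ê ∷ d̂ ∷ ρ} m)
      , (λ d′ d′∈ d′∈y →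
          let d̂′ = down d̂ d′∈
              e′ , lift e′∈ , m = ¬∀¬⇒∃ (¬×¬⇒→ (¬×¬⇒→ (proj₂ body d̂′) (lift d′∈)) (lift d′∈y))
          in ⟪ e′ ⟫ , e′∈ , ⊨maps⁻ {i = ↑2 (↑2 i)} {v1} {v0} {e′ ∷ d̂′ ∷ ê ∷ d̂ ∷ ρ} m)
      where
      u = down (ρ i) p
      d̂ ê : ∃ (El K)
      d̂ = down (down u upair⁺ʳ) upair⁺ˡ
      ê = down (down u upair⁺ʳ) upair⁺ʳ
      body = ¬×¬⇒→ (f d̂ ê) (⊨maps⁺ {ρ = ê ∷ d̂ ∷ ρ} {v1} {v0} {↑2 i} p)

    ⊨isCollapse⁺ : ∀ i j → IsCollapse ⟪ ρ j ⟫ ⟪ ρ i ⟫ → El K ⊨ isCollapseᶠ i j [ ρ ]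
    ⊨isCollapse⁺ {ρ = ρ} i j c d e = →⇒¬×¬ λ m →
      let h , k = c ⟪ d ⟫ ⟪ e ⟫ (⊨maps⁻ {i = ↑2 i} {v1} {v0} {e ∷ d ∷ ρ} m)
      in (λ e′ → →⇒¬×¬ λ (lift e′∈) → let d′ , d′∈ , d′∈y , p = h ⟪ e′ ⟫ e′∈ in
           ∃-in (down d d′∈ , lift d′∈ , lift d′∈y , ⊨maps⁺ {ρ = down d d′∈ ∷ e′ ∷ e ∷ d ∷ ρ} {v0} {v1} {↑2 (↑2 i)} p))
       , (λ d′ → →⇒¬×¬ λ (lift d′∈) → →⇒¬×¬ λ (lift d′∈y) → let e′ , e′∈ , p = k ⟪ d′ ⟫ d′∈ d′∈y in
           ∃-in (down e e′∈ , lift e′∈ , ⊨maps⁺ {ρ = down e e′∈ ∷ d′ ∷ e ∷ d ∷ ρ} {v1} {v0} {↑2 (↑2 i)} p))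

    ⊨π⁻ : ∀ a b y → El K ⊨ πᶠ a b y [ ρ ] → ⟪ ρ b ⟫ ≈ π ⟪ ρ y ⟫ ⟪ ρ a ⟫
    ⊨π⁻ {ρ = ρ} a b y f = let g , c , m = ¬∀¬⇒∃ f in
      IsCollapse⇒π (⊨isCollapse⁻ {ρ = g ∷ ρ} v0 (suc y) c) _ _ (⊨maps⁻ {i = v0} {suc a} {suc b} {g ∷ ρ} m)

    ⊨π⁺ : ∀ a b y g → g ∈ K → IsCollapse ⟪ ρ y ⟫ g → pair ⟪ ρ a ⟫ ⟪ ρ b ⟫ ∈ g → El K ⊨ πᶠ a b y [ ρ ]
    ⊨π⁺ {ρ = ρ} a b y g g∈ c p = ∃-in ((g , g∈) , ⊨isCollapse⁺ {ρ = (g , g∈) ∷ ρ} v0 (suc y) c ,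
      ⊨maps⁺ {ρ = (g , g∈) ∷ ρ} {suc a} {suc b} {v0} p)

    module CollapseClosure (zf : El K ⊨ZF⁻) {y : 𝕍} (y∈K : y ∈ K) where
      open _⊨ZF⁻ zf using (separation; replacement)
      open Closure zf

      private
        ŷ : ∃ (El K)
        ŷ = y , y∈K

        Collapsible : 𝕍 → Set L
        Collapsible a = π y a ∈ K × ∃ λ g → g ∈ K × IsCollapse y g × pair a (π y a) ∈ g

        -- Variables: d , π y d , y and d , ⟨d , π y d⟩ , y.
        valueᶠ graphᶠ : Formula 3
        valueᶠ = v0 ∈̇ v2 ∧̇ πᶠ v0 v1 v2
        graphᶠ = v0 ∈̇ v2 ∧̇ ∃̇ (πᶠ v1 v0 v3 ∧̇ isPair v2 v1 v0)

        value⁻ : ∀ d b → El K ⊨ valueᶠ [ d ∷ b ∷ ŷ ∷ [] ] → ⟪ d ⟫ ∈ y × ⟪ b ⟫ ≈ π y ⟪ d ⟫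
        value⁻ d b (lift p , f) = p , ⊨π⁻ {ρ = d ∷ b ∷ ŷ ∷ []} v0 v1 v2 f

        value⁺ : ∀ d b → Collapsible ⟪ d ⟫ → ⟪ d ⟫ ∈ y → ⟪ b ⟫ ≈ π y ⟪ d ⟫ → El K ⊨ valueᶠ [ d ∷ b ∷ ŷ ∷ [] ]
        value⁺ d b (_ , g , g∈ , c , p) d∈y e = lift d∈y ,
          ⊨π⁺ {ρ = d ∷ b ∷ ŷ ∷ []} v0 v1 v2 g g∈ c (∈-respˡ (pair-cong ≈refl (≈sym e)) p)

        graph⁻ : ∀ d p → El K ⊨ graphᶠ [ d ∷ p ∷ ŷ ∷ [] ] → ⟪ d ⟫ ∈ y × ⟪ p ⟫ ≈ pair ⟪ d ⟫ (π y ⟪ d ⟫)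
        graph⁻ d p (lift q , f) = let b , g , h = ¬∀¬⇒∃ f ; ρ = b ∷ d ∷ p ∷ ŷ ∷ [] in q ,
          ≈trans (⊨Pair⁻ {i = v2} {v1} {v0} {ρ} h) (pair-cong ≈refl (⊨π⁻ {ρ = ρ} v1 v0 v3 g))

        graph⁺ : ∀ d p → Collapsible ⟪ d ⟫ → ⟪ d ⟫ ∈ y → ⟪ p ⟫ ≈ pair ⟪ d ⟫ (π y ⟪ d ⟫) → El K ⊨ graphᶠ [ d ∷ p ∷ ŷ ∷ [] ]
        graph⁺ d p (b∈ , g , g∈ , c , q) d∈y e = lift d∈y , ∃-in ((_ , b∈) ,
          ⊨π⁺ {ρ = (_ , b∈) ∷ d ∷ p ∷ ŷ ∷ []} v1 v0 v3 g g∈ c q , ⊨Pair⁺ {ρ = (_ , b∈) ∷ d ∷ p ∷ ŷ ∷ []} {v2} {v1} {v0} e)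

        values : ∀ u → (∀ d → d ∈ ⟪ u ⟫ → d ∈ y → Collapsible d) → ∃ λ v → v ∈ K ×
                 (∀ d → d ∈ ⟪ u ⟫ → d ∈ y → π y d ∈ v) × (∀ b → b ∈ v → ∃ λ d → d ∈ ⟪ u ⟫ × d ∈ y × b ≈ π y d)
        values u h =
          let v , r = replacement valueᶠ (ŷ ∷ [])
                        (λ d b b′ f f′ → ≈trans (proj₂ (value⁻ d b f)) (≈sym (proj₂ (value⁻ d b′ f′)))) u
          in ⟪ v ⟫ , proj₂ v
           , (λ d d∈ d∈y → let c = h d d∈ d∈y ; b = _ , proj₁ c in
               from (r b) (down u d∈ , d∈ , value⁺ (down u d∈) b c d∈y ≈refl))
           , (λ b b∈ → let d , d∈ , f = to (r (down v b∈)) b∈ ; p , e = value⁻ d (down v b∈) f in ⟪ d ⟫ , d∈ , p , e)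

        graphs : ∀ u → (∀ d → d ∈ ⟪ u ⟫ → d ∈ y → Collapsible d) → ∃ λ v → v ∈ K ×
                 (∀ d → d ∈ ⟪ u ⟫ → d ∈ y → pair d (π y d) ∈ v) ×
                 (∀ p → p ∈ v → ∃ λ d → d ∈ ⟪ u ⟫ × d ∈ y × p ≈ pair d (π y d))
        graphs u h =
          let v , r = replacement graphᶠ (ŷ ∷ [])
                        (λ d p p′ f f′ → ≈trans (proj₂ (graph⁻ d p f)) (≈sym (proj₂ (graph⁻ d p′ f′)))) u
          in ⟪ v ⟫ , proj₂ v
           , (λ d d∈ d∈y → let c = h d d∈ d∈y ; p = _ , pair∈ (proj₂ (down u d∈)) (proj₁ c) in
               from (r p) (down u d∈ , d∈ , graph⁺ (down u d∈) p c d∈y ≈refl))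
           , (λ p p∈ → let d , d∈ , f = to (r (down v p∈)) p∈ ; q , e = graph⁻ d (down v p∈) f in ⟪ d ⟫ , d∈ , q , e)

        -- Replacement collects the values π y d and the pairs ⟨d , π y d⟩ for d ∈ a ∩ y, and adding
        -- the pair for a itself gives the witness. Since a is transitive, the members of its
        -- members are already provided for.
        collapsible : ∀ a → a ∈ K → Ord a → Collapsible a
        collapsible = ∈-ind (λ a → a ∈ K → Ord a → Collapsible a) λ a ih a∈ o →
          let h : ∀ d → d ∈ a → d ∈ y → Collapsible d
              h d d∈ _ = ih d d∈ (K-trans a a∈ d∈) (Ord-∈ o d∈)
              v , v∈ , v⁺ , v⁻ = values (a , a∈) h
              e : v ≈ π y a
              e = ext (λ p → let d , d∈ , d∈y , q = v⁻ _ p in ∈-respˡ (≈sym q) (π⁺ d∈ d∈y))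
                      (λ p → let d , d∈ , d∈y , q = π⁻ p in ∈-respˡ (≈sym q) (v⁺ d d∈ d∈y))
              πa∈ = ∈-respˡ e v∈
              g , g∈ , g⁺ , g⁻ = graphs (a , a∈) h
              p∈ = pair∈ a∈ πa∈
          in πa∈ , g ∪ upair (pair a (π y a)) (pair a (π y a)) , ∪∈ g∈ (upair∈ p∈ p∈) ,
             isCollapse o g⁺ g⁻ , ∪⁺ʳ upair⁺ˡ
          where
          isCollapse : ∀ {a g} → Ord a → (∀ d → d ∈ a → d ∈ y → pair d (π y d) ∈ g) →
                       (∀ p → p ∈ g → ∃ λ d → d ∈ a × d ∈ y × p ≈ pair d (π y d)) →
                       IsCollapse y (g ∪ upair (pair a (π y a)) (pair a (π y a)))
          isCollapse {a} {g} o g⁺ g⁻ d e p = let e≈ , sub = entry in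
              (λ e′ e′∈ → let d′ , d′∈ , d′∈y , q = π⁻ (∈-respʳ e≈ e′∈) in
                 d′ , d′∈ , d′∈y , ∪⁺ˡ (∈-respˡ (pair-cong ≈refl (≈sym q)) (g⁺ d′ (sub d′∈) d′∈y)))
            , (λ d′ d′∈ d′∈y → π y d′ , ∈-respʳ (≈sym e≈) (π⁺ d′∈ d′∈y) , ∪⁺ˡ (g⁺ d′ (sub d′∈) d′∈y))
            where
            entry : e ≈ π y d × El d ⊆ El a
            entry with ∪⁻ p
            ... | inj₁ q = let d₀ , d₀∈ , _ , r = g⁻ _ q in
              ≈trans (pair-injʳ r) (π-cong ≈refl (≈sym (pair-injˡ r))) , λ z∈ → Ord-trans o d₀∈ (∈-respʳ (pair-injˡ r) z∈)
            ... | inj₂ q = let r = sing⁻ q in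
              ≈trans (pair-injʳ r) (π-cong ≈refl (≈sym (pair-injˡ r))) , ∈-respʳ (pair-injˡ r)

      module _ (ordinals : ∀ a → a ∈ y → Ord a) where

        -- Together with `π-preimage` in another model that contains y, this transports subsets of y
        -- from model to model by way of their images in the collapse of y.
        π-image : ∀ x → x ∈ K → El x ⊆ El y → ∃ λ s → s ∈ K ×
                  (∀ a → a ∈ x → π y a ∈ s) × (∀ z → z ∈ s → ∃ λ a → a ∈ x × z ≈ π y a)
        π-image x x∈ sub =
          let s , s∈ , s⁺ , s⁻ = values (x , x∈) λ d d∈ d∈y → collapsible d (K-trans x x∈ d∈) (ordinals d d∈y)
          in s , s∈ , (λ a a∈ → s⁺ a a∈ (sub a∈)) , λ z z∈ → let d , d∈ , _ , e = s⁻ z z∈ in d , d∈ , e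

        π-preimage : ∀ s → s ∈ K → ∃ λ x → x ∈ K × El x ⊆ El y ×
                     (∀ a → a ∈ y → π y a ∈ s → a ∈ x) × (∀ a → a ∈ x → π y a ∈ s)
        π-preimage s s∈ =
          let x , h = separation (∃∈̇ v1 (πᶠ v1 v0 v3)) ((s , s∈) ∷ ŷ ∷ []) ŷ
              ŝ = s , s∈
          in ⟪ x ⟫ , proj₂ x , (λ p → proj₁ (to (h (down x p)) p))
           , (λ a a∈ p → let â = down ŷ a∈ ; b = down ŝ p ; _ , g , g∈ , c , q = collapsible a (proj₂ â) (ordinals a a∈) in
               from (h â) (a∈ , ∃-in (b , lift p , ⊨π⁺ {ρ = b ∷ â ∷ ŝ ∷ ŷ ∷ []} v1 v0 v3 g g∈ c q)))
           , (λ a a∈ → let â = down x a∈ ; _ , f = to (h â) a∈ ; b , lift b∈ , f′ = ¬∀¬⇒∃ f in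
               ∈-respˡ (⊨π⁻ {ρ = b ∷ â ∷ ŝ ∷ ŷ ∷ []} v1 v0 v3 f′) b∈)

-- Collapses of guessing, internally club sets, and their bounded subsets of ω₁.

module Guessing (ℓ : Level) (em : ExcludedMiddle (lsuc ℓ)) where
  open import Data.Fin.Base using (zero; suc)
  open import Data.Nat.Base using (ℕ; zero; suc)
  open import Data.Vec.Functional using (_∷_; [])
  open SetTheory ℓ
  open Sets ℓ em
  open Ordinals ℓ em
  open Collapse ℓ em
  open Models ℓ em
  open Equivalence using (to; from)

  private variable
    x y z w K K′ M α β : 𝕍

  In : 𝕍 → 𝕍 → Set L
  In α z = Lift L (z ∈ α)

  In-resp : Resp (In α)
  In-resp e (lift p) = lift (∈-respˡ e p)

  infixr 7 _∩ᵛ_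
  _∩ᵛ_ : 𝕍 → 𝕍 → 𝕍
  x ∩ᵛ α = sep x (In α)

  ∩ᵛ⁻ : z ∈ x ∩ᵛ y → z ∈ x × z ∈ y
  ∩ᵛ⁻ p = sep⊆ p , lower (sep⁻ In-resp p)

  ∩ᵛ⁺ : z ∈ x → z ∈ y → z ∈ x ∩ᵛ y
  ∩ᵛ⁺ p q = sep⁺ In-resp p (lift q)

  -- The properties of the collapse of an M in `GIC` on which coherence and reflection rest.
  record Good (K : 𝕍) : Set (lsuc ℓ) where
    field
      K-trans : IsTransitive K
      zf      : El K ⊨ZF⁻
      small   : El K ≼ ω₁
      D       : 𝕍
      D⊆K     : El D ⊆ El K
      club    : IsClub (El K) D

  Bounded : 𝕍 → Set L
  Bounded a = ∃ λ β → ω₁ β × El a ⊆ El β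

  countable⊆ω₁⇒Bounded : ∀ {a} → Countable (El a) → El a ⊆ ω₁ → Bounded a
  countable⊆ω₁⇒Bounded {a} c s = ⌊ ⋃ a ⌋⁺ , ω₁-suc o , λ {z} p →
    case ⊆⇒∈⊎≈ (ω₁-Ord (s p)) (ω₁-Ord o) (⋃⁺ p) of λ
      { (inj₁ q) → ∪⁺ˡ q ; (inj₂ e) → ∈-respˡ (≈sym e) self∈suc }
    where
    o : ω₁ (⋃ a)
    o = ω₁-⋃ c s

  -- The clubs of K and K′ are interleaved to find y ∈ K ∩ K′ covering x; the
  -- subsets of y in K and K′ are then coded by bounded subsets of ω₁.
  module Absorb (G : Good K) (G′ : Good K′) (agree : ∀ a → Bounded a → a ∈ K′ → a ∈ K)
                (x∈K′ : x ∈ K′) (cx : Countable (El x)) (oα : Ord α) (α∈K : α ∈ K) (x⊆α : El x ⊆ El α) where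
    private
      module G  = Good G
      module G′ = Good G′
      open Transitive G.K-trans using () renaming (module Closure to ClosureK; module CollapseClosure to CollapseK)
      open Transitive G′.K-trans using () renaming (module Closure to ClosureK′; module CollapseClosure to CollapseK′)
      module C  = IsClub G.club
      module C′ = IsClub G′.club
      module Z  = ClosureK G.zf
      module Z′ = ClosureK′ G′.zf

      -- The ordinal sup x + 1 takes the place of α, which need not belong to `K′`.
      η : 𝕍
      η = ⌊ ⋃ x ⌋⁺
      ord-x : ∀ a → a ∈ x → Ord a
      ord-x a a∈ = Ord-∈ oα (x⊆α a∈)
      ord-⋃ : Ord (⋃ x)
      ord-⋃ = Ord-⋃ ord-x
      η∈K′ : η ∈ K′
      η∈K′ = Z′.suc∈ (Z′.⋃∈ x∈K′)
      ⋃∈K : ⋃ x ∈ K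
      ⋃∈K = case ⊆⇒∈⊎≈ ord-⋃ oα (λ p → let u , u∈ , q = ⋃⁻ p in Ord-trans oα (x⊆α u∈) q) of λ
        { (inj₁ p) → G.K-trans _ α∈K p ; (inj₂ e) → ∈-respˡ (≈sym e) α∈K }
      η∈K : η ∈ K
      η∈K = Z.suc∈ ⋃∈K
      x⊆η : El x ⊆ El η
      x⊆η p = case ⊆⇒∈⊎≈ (ord-x _ p) ord-⋃ (⋃⁺ p) of λ
        { (inj₁ q) → ∪⁺ˡ q ; (inj₂ e) → ∈-respˡ (≈sym e) self∈suc }
      η⊆K : El η ⊆ El K
      η⊆K = G.K-trans _ η∈K
      η⊆K′ : El η ⊆ El K′
      η⊆K′ = G′.K-trans _ η∈K′

      State : Set L
      State = ∃ (El G.D) × ∃ (El G′.D)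

      start : ∃ λ (s : State) → El x ⊆ El (proj₁ (proj₁ s))
      start =
        let d , d∈ , s = C.cofinal x ((λ p → η⊆K (x⊆η p)) , cx)
            d′ , d′∈ , s′ = C′.cofinal x ((λ p → η⊆K′ (x⊆η p)) , cx)
        in ((d , d∈) , (d′ , d′∈)) , s

      step : (s : State) → ∃ λ (t : State) → let (d , _) , (d′ , _) = s ; (e , _) , (e′ , _) = t in
             (El d ⊆ El e × El (d′ ∩ᵛ η) ⊆ El e) × (El d′ ⊆ El e′ × El (d ∩ᵛ η) ⊆ El e′)
      step ((d , d∈) , (d′ , d′∈)) =
        let sd , cd = C.subset d∈ ; sd′ , cd′ = C′.subset d′∈
            e , e∈ , s = C.cofinal (d ∪ (d′ ∩ᵛ η))
              ((λ p → [ sd , (λ q → η⊆K (proj₂ (∩ᵛ⁻ q))) ]′ (∪⁻ p)) , countable-∪ cd (countable-⊆ sep⊆ cd′))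
            e′ , e′∈ , s′ = C′.cofinal (d′ ∪ (d ∩ᵛ η))
              ((λ p → [ sd′ , (λ q → η⊆K′ (proj₂ (∩ᵛ⁻ q))) ]′ (∪⁻ p)) , countable-∪ cd′ (countable-⊆ sep⊆ cd))
        in ((e , e∈) , (e′ , e′∈)) , ((λ p → s (∪⁺ˡ p)) , (λ p → s (∪⁺ʳ p))) , (λ p → s′ (∪⁺ˡ p)) , (λ p → s′ (∪⁺ʳ p))

      opaque
        next : State → State
        next s = proj₁ (step s)

        next⊇ : (s : State) → let (d , _) , (d′ , _) = s ; (e , _) , (e′ , _) = next s in
                (El d ⊆ El e × El (d′ ∩ᵛ η) ⊆ El e) × (El d′ ⊆ El e′ × El (d ∩ᵛ η) ⊆ El e′)
        next⊇ s = proj₂ (step s)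

        s₀ : State
        s₀ = proj₁ start

        s₀⊇ : El x ⊆ El (proj₁ (proj₁ s₀))
        s₀⊇ = proj₂ start

      seq : ℕ → State
      seq zero    = s₀
      seq (suc n) = next (seq n)

      d d′ : ℕ → 𝕍
      d n = proj₁ (proj₁ (seq n))
      d′ n = proj₁ (proj₂ (seq n))

      union : (λ b → ∃ λ i → b ∈ d i) ∈ᶜ G.D
      union = C.closed d (λ n → proj₂ (proj₁ (seq n))) (λ n → proj₁ (proj₁ (next⊇ (seq n))))

      union′ : (λ b → ∃ λ i → b ∈ d′ i) ∈ᶜ G′.D
      union′ = C′.closed d′ (λ n → proj₂ (proj₂ (seq n))) (λ n → proj₁ (proj₂ (next⊇ (seq n))))

      u u′ cov : 𝕍
      u = proj₁ union
      u′ = proj₁ union′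
      cov = u ∩ᵛ η

      y∈K : cov ∈ K
      y∈K = ∈ᶜ⇒∈ (∩ᵛ⁻ , λ (p , q) → ∩ᵛ⁺ p q) (Z.∩∈ (G.D⊆K (proj₁ (proj₂ union))) η∈K)

      -- Because each step absorbs the part below η of the other side, the unions u and u′ agree
      -- below η.
      y∈K′ : cov ∈ K′
      y∈K′ = ∈ᶜ⇒∈ ((λ p → let q , r = ∩ᵛ⁻ p ; n , q′ = proj₁ (proj₂ (proj₂ union)) q
                           in proj₂ (proj₂ (proj₂ union′)) (suc n , proj₂ (proj₂ (next⊇ (seq n))) (∩ᵛ⁺ q′ r)) , r)
                  , λ (p , r) → let n , p′ = proj₁ (proj₂ (proj₂ union′)) p
                                in ∩ᵛ⁺ (proj₂ (proj₂ (proj₂ union)) (suc n , proj₂ (proj₁ (next⊇ (seq n))) (∩ᵛ⁺ p′ r))) r)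
                 (Z′.∩∈ (G′.D⊆K (proj₁ (proj₂ union′))) η∈K′)

      x⊆y : El x ⊆ El cov
      x⊆y p = ∩ᵛ⁺ (proj₂ (proj₂ (proj₂ union)) (0 , s₀⊇ p)) (x⊆η p)

      ord-y : ∀ a → a ∈ cov → Ord a
      ord-y a a∈ = Ord-∈ (Ord-suc ord-⋃) (proj₂ (∩ᵛ⁻ a∈))

      countable-y : Countable (El cov)
      countable-y = countable-⊆ sep⊆ (proj₂ (C.subset (proj₁ (proj₂ union))))

      collapse-ω₁ : ω₁ (collapse cov)
      collapse-ω₁ = Ord⇒IsOrdinal (collapse-transitive , λ z z∈ →
          let a , a∈ , e = collapse⁻ z∈ in IsTransitive-resp (≈sym e) (proj₁ (Ord-π (ord-y a a∈))))
        , countable-img {C = In cov} (λ a z → Lift L (z ≈ π cov a)) (λ e (lift p) → lift (≈trans (≈sym e) p))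
            (λ _ _ e (lift p) (lift q) → ≈trans p (≈trans (π-cong ≈refl e) (≈sym q)))
            (countable-⊆ lower countable-y) (λ z z∈ → let a , a∈ , e = collapse⁻ z∈ in a , lift a∈ , lift e)

    opaque
      absorb : x ∈ K
      absorb =
        let s , s∈ , s⁺ , s⁻ = CollapseK′.π-image G′.zf y∈K′ ord-y x x∈K′ x⊆y
            s∈K = agree s (collapse cov , collapse-ω₁ , λ p → let a , a∈ , e = s⁻ _ p
                                                            in ∈-respˡ (≈sym e) (collapse⁺ (x⊆y a∈))) s∈
            v , v∈ , v⊆y , v⁺ , v⁻ = CollapseK.π-preimage G.zf y∈K ord-y s s∈K
        in ∈-respˡ (ext
             (λ {a} p → let b , b∈ , e = s⁻ _ (v⁻ a p)
                        in ∈-respˡ (π-inj (ord-y b (x⊆y b∈)) (ord-y a (v⊆y p)) (x⊆y b∈) (v⊆y p) (≈sym e)) b∈)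
             (λ {a} p → v⁺ a (x⊆y p) (s⁺ a p))) v∈

  H-transitive : ∀ {θ} → H θ x → y ∈ x → H θ y
  H-transitive (β , β∈ , f) y∈x = β , β∈ , ≼-trans (≼-⊆ λ z∈ → transitiveᵗ _∈_ z∈ [ y∈x ]ᵗ) f

  collapse-injective : El M ⊨ZF⁻ → ∀ x y → x ∈ M → y ∈ M → π M x ≈ π M y → x ≈ y
  collapse-injective {M} zf = ∈-ind (λ x → ∀ y → x ∈ M → y ∈ M → π M x ≈ π M y → x ≈ y) λ x ih y x∈ y∈ e →
    _⊨ZF⁻.extensionality zf (x , x∈) (y , y∈) λ (z , z∈M) → mk⇔
      (λ z∈x → let w , w∈y , w∈M , e′ = π⁻ (∈-respʳ e (π⁺ z∈x z∈M)) in ∈-respˡ (≈sym (ih z z∈x w z∈M w∈M e′)) w∈y)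
      (λ z∈y → let w , w∈x , w∈M , e′ = π⁻ (∈-respʳ (≈sym e) (π⁺ z∈y z∈M)) in ∈-respˡ (ih w w∈x z w∈M z∈M (≈sym e′)) w∈x)

  collapse-≼ : El M ⊨ZF⁻ → El (collapse M) ≼ El M
  collapse-≼ {M} zf = ≼-by (λ (z , p) → let x , x∈ , _ = collapse⁻ p in x , x∈)
    (λ (z , p) (z′ , p′) e → let x , x∈ , q = collapse⁻ p ; x′ , x′∈ , q′ = collapse⁻ p′
                             in collapse-injective zf x x′ x∈ x′∈ (≈trans (≈sym q) (≈trans e q′)))
    (λ (z , p) (z′ , p′) e → let x , x∈ , q = collapse⁻ p ; x′ , x′∈ , q′ = collapse⁻ p′
                             in ≈trans q (≈trans (π-cong ≈refl e) (≈sym q′)))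

  bounded-collapse⁺ : ω₁ ⊆ El M → Bounded x → x ∈ M → x ∈ collapse M
  bounded-collapse⁺ s (β , o , sub) x∈ =
    ∈-respˡ (π-id-⊆ (ω₁-Ord o) (λ p → s (ω₁-∈ o p)) sub) (collapse⁺ x∈)

  -- By elementarity the subset relation between elements of M is absolute.
  bounded-collapse⁻ : G M → El M ⊨ZF⁻ → Bounded x → x ∈ collapse M → x ∈ M
  bounded-collapse⁻ {M} {x} ((s , (θ , _ , _ , M⊆H , elem) , _) , _) zf (β , o , sub) x∈ =
    let b , b∈ , e = collapse⁻ x∈
        fix : ∀ {γ} → γ ∈ β → π M γ ≈ γ
        fix p = π-id (ω₁-Ord (ω₁-∈ o p)) (λ q → s (ω₁-∈ (ω₁-∈ o p) q))
        b∩M⊆β : ∀ w → w ∈ M → w ∈ b → w ∈ β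
        b∩M⊆β w w∈M w∈b =
          let p = sub (∈-respʳ (≈sym e) (π⁺ w∈b w∈M))
              γ∈M = s (ω₁-∈ o p)
          in ∈-respˡ (≈sym (collapse-injective zf w (π M w) w∈M γ∈M (≈sym (fix p)))) p
        φ = ∀̇ (zero ∈̇ suc zero ⇒̇ zero ∈̇ suc (suc zero))
        h = to (elem φ ((b , b∈) ∷ (β , s o) ∷ [])) λ (w , w∈M) → →⇒¬×¬ λ (lift p) → lift (b∩M⊆β w w∈M p)
        b⊆β : El b ⊆ El β
        b⊆β p = lower (¬×¬⇒→ (h (_ , H-transitive (M⊆H b∈) p)) (lift p))
    in ∈-respˡ (≈sym (≈trans e (π-id-⊆ (ω₁-Ord o) (λ p → s (ω₁-∈ o p)) b⊆β))) b∈

  -- Extensionality in M makes π injective on M, so countable subsets of the collapse pull back to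
  -- countable subsets of M, where the internal club applies.
  GIC⇒Good : GIC M → Good (collapse M)
  GIC⇒Good {M} (((_ , _ , approx) , _) , zfM , _ , M≅ω₁ , C , C⊆M , club) = record
    { K-trans = transitive ; zf = zf⁻ ; small = ≼-trans (collapse-≼ zfM) (≅⇒≼ M≅ω₁)
    ; D = D
    ; D⊆K = λ p → let i , e = fam⁻ p in ∈-respˡ (≈sym e) (collapse⁺ (C⊆M (at∈ C i)))
    ; club = record { subset = D-subset ; cofinal = D-cofinal ; closed = D-closed } }
    where
    open Hasω₁Approximation approx
    module C = IsClub club

    -- Members of C are subsets of M, so π maps each of them to its pointwise image.
    D : 𝕍
    D = fam {Ix C} λ i → π M (at C i)

    D⁺ : ∀ {z} → z ∈ C → π M z ∈ D
    D⁺ z∈ = let i , e = ix z∈ in ∈-respˡ (π-cong ≈refl (≈sym e)) (fam⁺ _ i)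

    D⁻ : ∀ {z} → z ∈ D → ∃ λ c → c ∈ C × z ≈ π M c
    D⁻ p = let i , e = fam⁻ p in at C i , at∈ C i , e

    π-mem : ∀ {c a} → c ∈ C → a ∈ M → π M a ∈ π M c → a ∈ c
    π-mem c∈ a∈ p = let b , b∈ , b∈M , e = π⁻ p in ∈-respˡ (≈sym (collapse-injective zfM _ b a∈ b∈M e)) b∈

    D-subset : El D ⊆ [ El (collapse M) ]^ω
    D-subset p = let c , c∈ , e = D⁻ p in
        (λ q → let w , _ , w∈M , e′ = π⁻ (∈-respʳ e q) in ∈-respˡ (≈sym e′) (collapse⁺ w∈M))
      , countable-img {C = In c} (λ a z → Lift L (z ≈ π M a)) (λ e (lift p) → lift (≈trans (≈sym e) p))
          (λ _ _ e (lift p) (lift q) → ≈trans p (≈trans (π-cong ≈refl e) (≈sym q)))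
          (countable-⊆ lower (proj₂ (C.subset c∈)))
          (λ z z∈ → let a , a∈ , _ , e′ = π⁻ (∈-respʳ e z∈) in a , lift a∈ , lift e′)

    D-cofinal : ∀ y → [ El (collapse M) ]^ω y → ∃ λ z → z ∈ D × El y ⊆ El z
    D-cofinal y (s , c) =
      let z , z∈ , sub = C.cofinal pre (sep⊆ , countable-pre)
      in π M z , D⁺ z∈ , λ p → let a , a∈ , e = collapse⁻ (s p)
                               in ∈-respˡ (≈sym e) (π⁺ (sub (sep⁺ R-resp a∈ (lift (∈-respˡ e p)))) a∈)
      where
      R : 𝕍 → Set L
      R a = Lift L (π M a ∈ y)
      R-resp : Resp R
      R-resp e (lift p) = lift (∈-respˡ (π-cong ≈refl e) p)
      pre : 𝕍
      pre = sep M R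
      countable-pre : Countable (El pre)
      countable-pre = ≼-countable {D = El y}
        (≼-by (λ (a , p) → π M a , lower (sep⁻ R-resp p)) (λ _ _ e → π-cong ≈refl e)
              (λ (a , p) (b , q) e → collapse-injective zfM a b (sep⊆ p) (sep⊆ q) e)) c

    D-closed : (c : ℕ → 𝕍) → (∀ i → c i ∈ D) → (∀ i → El (c i) ⊆ El (c (suc i))) → (λ b → ∃ λ i → b ∈ c i) ∈ᶜ D
    D-closed c c∈ mono =
      let z , z∈ , f , g = C.closed b b∈ b-mono
      in π M z , D⁺ z∈
       , (λ p → let w , w∈ , w∈M , e = π⁻ p ; i , q = f w∈
                in i , ∈-respʳ (≈sym (c≈ i)) (∈-respˡ (≈sym e) (π⁺ q w∈M)))
       , (λ (i , p) → let w , w∈ , w∈M , e = π⁻ (∈-respʳ (c≈ i) p) in ∈-respˡ (≈sym e) (π⁺ (g (i , w∈)) w∈M))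
      where
      b : ℕ → 𝕍
      b i = proj₁ (D⁻ (c∈ i))
      b∈ : ∀ i → b i ∈ C
      b∈ i = proj₁ (proj₂ (D⁻ (c∈ i)))
      c≈ : ∀ i → c i ≈ π M (b i)
      c≈ i = proj₂ (proj₂ (D⁻ (c∈ i)))
      b-mono : ∀ i → El (b i) ⊆ El (b (suc i))
      b-mono i p =
        let w∈M = proj₁ (C.subset (b∈ i)) p
        in π-mem (b∈ (suc i)) w∈M (∈-respʳ (c≈ (suc i)) (mono i (∈-respʳ (≈sym (c≈ i)) (π⁺ p w∈M))))

  -- If M contains every bounded subset of ω₁, then by approximation its
  -- collapse contains every subset of ω₁, which is too many.
  GIC-omits-bounded : GIC M → ¬ (∀ a → Bounded a → a ∈ M)
  GIC-omits-bounded {M} (((ω₁⊆M , _ , approx) , _) , zfM , _ , M≅ω₁ , _) all = diagonal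
    where
    open Hasω₁Approximation approx
    Ω = proj₁ ω₁∈
    Ω∈K = proj₁ (proj₂ ω₁∈)
    Ω≐ = proj₂ (proj₂ ω₁∈)

    subsets : ∀ A → El A ⊆ El Ω → A ∈ collapse M
    subsets A s = approximate Ω A Ω∈K s λ z z∈K c →
      let cz = Transitive.⊨countable⁻ transitive (z , z∈K) c
          bd = countable⊆ω₁⇒Bounded (countable-⊆ sep⊆ cz) (λ p → proj₁ Ω≐ (s (proj₂ (∩ᵛ⁻ p))))
      in z ∩ᵛ A , bounded-collapse⁺ ω₁⊆M bd (all _ bd) , ∩ᵛ⁻ , λ (p , q) → ∩ᵛ⁺ p q

    f : El (collapse M) ≼ ω₁
    f = ≼-trans (collapse-≼ zfM) (≅⇒≼ M≅ω₁)
    module f = Injection f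

    Diag : 𝕍 → Set L
    Diag i = ∃ λ (p : ∃ (El (collapse M))) → proj₁ (f.to p) ≈ i × ¬ i ∈ proj₁ p

    Diag-resp : Resp Diag
    Diag-resp e (p , q , n) = p , ≈trans q e , λ r → n (∈-respˡ (≈sym e) r)

    diagonal : ⊥
    diagonal = i∉ (sep⁺ Diag-resp (proj₂ Ω≐ (proj₂ (f.to (A , A∈)))) ((A , A∈) , ≈refl , i∉))
      where
      A = sep Ω Diag
      A∈ = subsets A sep⊆
      i∉ : ¬ proj₁ (f.to (A , A∈)) ∈ A
      i∉ r = let p , e , n = sep⁻ Diag-resp r in n (∈-respʳ (≈sym (f.injective {p} {A , A∈} e)) r)

-- From reflection and a coherent family of models to an injection of the reals into ω₁.

module Reflection (ℓ : Level) (em : ExcludedMiddle (lsuc ℓ)) (ac : SetTheory.Choice ℓ) where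
  open import Data.Nat.Base using (ℕ; zero; suc)
  open import Data.Nat.Properties using (≤-total)
  open SetTheory ℓ
  open Sets ℓ em
  open Ordinals ℓ em
  open Models ℓ em
  open Guessing ℓ em
  open Choosing ℓ em ac
  open PerfectTree ℓ em ac
  open Coding

  private variable
    x y z K X : 𝕍

  ω₁-lub : (i : ℕ → 𝕍) → (∀ n → ω₁ (i n)) → ω₁ (⋃ (fam {Lift ℓ ℕ} (i ∘ lower)))
  ω₁-lub i o = ω₁-⋃
    (rel-ℕ (λ z n → Lift L (z ≈ i n)) (λ e (lift p) → lift (≈trans (≈sym e) p))
      (λ z p → let lift n , e = fam⁻ {f = i ∘ lower} p in n , lift e) (λ _ _ (lift p) (lift q) → ≈trans p (≈sym q)))
    (λ p → let lift n , e = fam⁻ {f = i ∘ lower} p in ω₁-resp (≈sym e) (o n))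

  -- An injection e of K into ω₁ splits K into an increasing chain of countable
  -- sets, on which a club of [K]^ω restricts to a club.
  module Chain (G : Good K) (X⊆K : El X ⊆ El K) where
    open Good G
    private
      module e = Injection small
      module D = IsClub club

      Below : 𝕍 → 𝕍 → Set ℓ
      Below i k = ∃ λ (p : k ∈ K) → proj₁ (e.to (k , p)) ∈ i

      Below-resp : ∀ {i} → Resp (Lift L ∘ Below i)
      Below-resp {i} eq (lift (p , q)) = lift (∈-respˡ eq p , ∈-respˡ (e.cong eq) q)

    opaque
      w : 𝕍 → 𝕍
      w i = sep K (Lift L ∘ Below i)

      w⁻ : ∀ {i} → z ∈ w i → Below i z
      w⁻ p = lower (sep⁻ Below-resp p)

      w⁺ : ∀ {i} → Below i z → z ∈ w i
      w⁺ p = sep⁺ Below-resp (proj₁ p) (lift p)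

    w⊆K : ∀ {i} → El (w i) ⊆ El K
    w⊆K p = proj₁ (w⁻ p)

    w-mono : ∀ {i j} → El i ⊆ El j → El (w i) ⊆ El (w j)
    w-mono s p = let q , r = w⁻ p in w⁺ (q , s r)

    w-countable : ∀ {i} → ω₁ i → Countable (El (w i))
    w-countable {i} (_ , c) = ≼-countable {D = El i}
      (≼-by (λ (z , p) → let q , r = w⁻ p in _ , r)
        (λ (z , p) (z′ , p′) eq → e.cong eq) (λ (z , p) (z′ , p′) eq → e.injective eq)) c

    w-⋃ : (i : ℕ → 𝕍) → El (w (⋃ (fam {Lift ℓ ℕ} (i ∘ lower)))) ≐ λ z → ∃ λ n → z ∈ w (i n)
    w-⋃ i = (λ p → let q , r = w⁻ p ; u , u∈ , s = ⋃⁻ r ; lift n , eq = fam⁻ {f = i ∘ lower} u∈ in n , w⁺ (q , ∈-respʳ eq s))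
          , (λ (n , p) → let q , r = w⁻ p in w⁺ (q , ⋃⁺ (fam⁺ _ (lift n)) r))

    w-cover : El y ⊆ El K → Countable (El y) → ∃ λ i → ω₁ i × El y ⊆ El (w i)
    w-cover {y} s c = let β , o , sub = countable⊆ω₁⇒Bounded countable-image image⊆ω₁
                      in β , o , λ p → w⁺ (s p , sub (image⁺ p))
      where
      value : Ix y → 𝕍
      value i = proj₁ (e.to (at y i , s (at∈ y i)))
      image : 𝕍
      image = fam value
      image⁺ : ∀ {k} (p : k ∈ y) → proj₁ (e.to (k , s p)) ∈ image
      image⁺ p = let i , eq = ix p in ∈-respˡ (e.cong (≈sym eq)) (fam⁺ value i)
      image⊆ω₁ : El image ⊆ ω₁
      image⊆ω₁ p = let i , eq = fam⁻ p in ω₁-resp (≈sym eq) (proj₂ (e.to (at y i , s (at∈ y i))))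
      countable-image : Countable (El image)
      countable-image = countable-img {C = In y} (λ k z → Σ (k ∈ K) λ p → Lift L (z ≈ proj₁ (e.to (k , p))))
        (λ eq (p , lift q) → p , lift (≈trans (≈sym eq) q))
        (λ _ _ eq (p , lift q) (p′ , lift q′) → ≈trans q (≈trans (e.cong eq) (≈sym q′)))
        (countable-⊆ lower c)
        (λ z p → let i , eq = fam⁻ p in at y i , lift (at∈ y i) , s (at∈ y i) , lift eq)

    Trace : 𝕍 → Set L
    Trace z = ∃ λ i → ω₁ i × w i ∈ D × z ≈ w i ∩ᵛ X

    Trace-resp : Resp Trace
    Trace-resp eq (i , o , p , q) = i , o , p , ≈trans (≈sym eq) q

    traces : 𝕍
    traces = sep (𝒫 X) Trace

    traces⁺ : ∀ {i} → ω₁ i → w i ∈ D → (w i ∩ᵛ X) ∈ traces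
    traces⁺ o p = sep⁺ Trace-resp (𝒫⁺ (λ q → proj₂ (∩ᵛ⁻ q))) (_ , o , p , ≈refl)

    traces-subset : El traces ⊆ [ El X ]^ω
    traces-subset p = let i , o , _ , eq = sep⁻ Trace-resp p in
      𝒫⁻ (sep⊆ p) , countable-⊆ (λ q → proj₁ (∩ᵛ⁻ (∈-respʳ eq q))) (w-countable o)

    -- Sets w i of the chain are interleaved with members d of the club. Both sequences have the
    -- same union, which belongs to the chain by `w-⋃` and to D by closure.
    traces-cofinal : ∀ y → [ El X ]^ω y → ∃ λ z → z ∈ traces × El y ⊆ El z
    traces-cofinal y (s , c) =
      w (⋃ (fam (i ∘ lower))) ∩ᵛ X , traces⁺ (ω₁-lub i (λ n → proj₂ (i′ n))) lim∈ ,
      λ p → ∩ᵛ⁺ (proj₂ (w-⋃ i) (0 , proj₂ (proj₂ start) p)) (s p)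
      where
      start : ∃ λ j → ω₁ j × El y ⊆ El (w j)
      start = w-cover (X⊆K ∘ s) c
      opaque
        next : (j : ∃ ω₁) → ∃ λ d → d ∈ D × El (w (proj₁ j)) ⊆ El d × ∃ λ (j′ : ∃ ω₁) → El d ⊆ El (w (proj₁ j′))
        next (j , o) =
          let d , d∈ , q = D.cofinal (w j) (w⊆K , w-countable o)
              j′ , o′ , q′ = w-cover (proj₁ (D.subset d∈)) (proj₂ (D.subset d∈))
          in d , d∈ , q , (j′ , o′) , q′
      i′ : ℕ → ∃ ω₁
      i′ zero    = proj₁ start , proj₁ (proj₂ start)
      i′ (suc n) = proj₁ (proj₂ (proj₂ (proj₂ (next (i′ n)))))
      i d : ℕ → 𝕍
      i n = proj₁ (i′ n)
      d n = proj₁ (next (i′ n))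
      w⊆d : ∀ n → El (w (i n)) ⊆ El (d n)
      w⊆d n = proj₁ (proj₂ (proj₂ (next (i′ n))))
      d⊆w : ∀ n → El (d n) ⊆ El (w (i (suc n)))
      d⊆w n = proj₂ (proj₂ (proj₂ (proj₂ (next (i′ n)))))
      lim∈ : w (⋃ (fam (i ∘ lower))) ∈ D
      lim∈ = ∈ᶜ⇒∈ ((λ p → let n , q = proj₁ (w-⋃ i) p in n , w⊆d n q)
                  , (λ (n , p) → proj₂ (w-⋃ i) (suc n , d⊆w n p)))
        (D.closed d (λ n → proj₁ (proj₂ (next (i′ n)))) (λ n p → w⊆d (suc n) (d⊆w n p)))

    -- The traces increase, but their indices need not, since w i ∩ X may stay the same while i
    -- grows. The running maxima j of the indices do increase, and they have the same traces in the
    -- limit.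
    traces-closed : (c : ℕ → 𝕍) → (∀ n → c n ∈ traces) → (∀ n → El (c n) ⊆ El (c (suc n))) → (λ b → ∃ λ n → b ∈ c n) ∈ᶜ traces
    traces-closed c c∈ _ = w (⋃ (fam (j ∘ lower))) ∩ᵛ X , traces⁺ (ω₁-lub j (λ n → proj₁ (proj₂ (proj₂ (j′ n))))) lim∈
      , (λ p → let q , r = ∩ᵛ⁻ p ; n , q′ = proj₁ (w-⋃ j) q ; m , eq = proj₂ (proj₂ (proj₂ (j′ n)))
               in m , ∈-respʳ (≈sym eq) (∩ᵛ⁺ q′ r))
      , (λ (n , p) → let q , r = ∩ᵛ⁻ (∈-respʳ (proj₂ (proj₂ (proj₂ (tr n)))) p)
                     in ∩ᵛ⁺ (proj₂ (w-⋃ j) (n , w-mono (i⊆j n) q)) r)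
      where
      tr : ∀ n → Trace (c n)
      tr n = sep⁻ Trace-resp (c∈ n)
      Stage : Set L
      Stage = ∃ λ j → w j ∈ D × ω₁ j × ∃ λ m → c m ≈ w j ∩ᵛ X
      stage : ℕ → Stage
      stage n = let j , o , p , eq = tr n in j , p , o , n , eq
      larger : (s t : Stage) → ∃ λ (u : Stage) → El (proj₁ s) ⊆ El (proj₁ u) × El (proj₁ t) ⊆ El (proj₁ u)
      larger s t with emℓ {proj₁ t ∈ proj₁ s}
      ... | yes p = s , id , Ord-trans (ω₁-Ord (proj₁ (proj₂ (proj₂ s)))) p
      ... | no n  = t , ∉⇒⊇ (ω₁-Ord (proj₁ (proj₂ (proj₂ t)))) (ω₁-Ord (proj₁ (proj₂ (proj₂ s)))) n , id
      j′ : ℕ → Stage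
      j′ zero    = stage zero
      j′ (suc n) = proj₁ (larger (j′ n) (stage (suc n)))
      j : ℕ → 𝕍
      j n = proj₁ (j′ n)
      i⊆j : ∀ n → El (proj₁ (stage n)) ⊆ El (j n)
      i⊆j zero    p = p
      i⊆j (suc n) p = proj₂ (proj₂ (larger (j′ n) (stage (suc n)))) p
      lim∈ : w (⋃ (fam (j ∘ lower))) ∈ D
      lim∈ = ∈ᶜ⇒∈ (w-⋃ j) (D.closed (w ∘ j) (λ n → proj₁ (proj₂ (j′ n)))
        (λ n → w-mono (λ p → proj₁ (proj₂ (larger (j′ n) (stage (suc n)))) p)))

    club-traces : IsClub (El X) traces
    club-traces = record { subset = traces-subset ; cofinal = traces-cofinal ; closed = traces-closed }

  module _ {Ω Ω₂ : 𝕍} (Ω≐ : El Ω ≐ ω₁) (Ω₂≐ : El Ω₂ ≐ ω₂) (rp : RP[ω₂]^ω)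
           (F : 𝕍 → Set L) (good : ∀ {K} → F K → Good K)
           (agree : ∀ {K K′} → F K → F K′ → ∀ a → Bounded a → a ∈ K′ → a ∈ K)
           (unbounded : ∀ ξ → ω₂ ξ → ∃ λ K → F K × ξ ∈ K) where

    private
      E : Codes Ω₂ ω₁
      E = codes λ x p → proj₂ (proj₁ Ω₂≐ p)
      module E = Codes E

      Covered : 𝕍 → Set L
      Covered x = ∃ λ K → F K × x ∈ K

      -- A set closed in this sense that contains ω₁ is transitive.
      Closed : 𝕍 → Set L
      Closed z = ∀ α β γ → α ∈ z → β ∈ α → γ ∈ z → E.E α β γ → β ∈ z

      Bad : 𝕍 → Set L
      Bad z = Countable (El z) × ¬ Covered z × Closed z

      Bad-resp : Resp Bad
      Bad-resp e (c , n , h) = countable-⊆ (∈-respʳ (≈sym e)) c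
        , (λ (K , f , p) → n (K , f , ∈-respˡ (≈sym e) p))
        , λ α β γ p q r s → ∈-respʳ e (h α β γ (∈-respʳ (≈sym e) p) q (∈-respʳ (≈sym e) r) s)

      bad : 𝕍
      bad = sep (𝒫 Ω₂) Bad

      bad-subset : El bad ⊆ [ ω₂ ]^ω
      bad-subset p = (λ q → proj₁ Ω₂≐ (𝒫⁻ (sep⊆ p) q)) , proj₁ (sep⁻ Bad-resp p)

      module Reflected {X : 𝕍} (X⊆ω₂ : El X ⊆ ω₂) (ω₁⊆X : ω₁ ⊆ El X) (X≅ω₁ : El X ≅ ω₁)
                       (stationary : IsStationary (El X) (El bad ∩ [ El X ]^ω)) where

        -- For β ∈ α ∈ X let γ be the code of β in α; it lies in X because ω₁ ⊆ X. The countable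
        -- subsets of X that contain α and γ form a club, so some bad set contains both, and being
        -- closed it contains β.
        transitive : IsTransitive X
        transitive α α∈ {β} β∈ =
          let γ , oγ , e = E.total (proj₂ Ω₂≐ (X⊆ω₂ α∈)) β∈
              z , z∈C , z∈bad , z∈X = proj₂ stationary (containing γ) (club γ (ω₁⊆X oγ))
              αz , γz = sep⁻ (P-resp γ) z∈C
          in proj₁ z∈X (proj₂ (proj₂ (sep⁻ Bad-resp z∈bad)) α β γ (proj₁ αz) β∈ (proj₂ αz) e)
          where
          P : 𝕍 → 𝕍 → Set L
          P γ z = (α ∈ z × γ ∈ z) × Countable (El z)
          P-resp : ∀ γ → Resp (P γ)
          P-resp γ e ((p , q) , c) = (∈-respʳ e p , ∈-respʳ e q) , countable-⊆ (∈-respʳ (≈sym e)) c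
          containing : 𝕍 → 𝕍
          containing γ = sep (𝒫 X) (P γ)
          club : ∀ γ → γ ∈ X → IsClub (El X) (containing γ)
          club γ γ∈ = record
            { subset = λ p → 𝒫⁻ (sep⊆ p) , proj₂ (sep⁻ (P-resp γ) p)
            ; cofinal = λ y (s , c) →
                let sub : El (y ∪ upair α γ) ⊆ El X
                    sub p = [ s , (λ q → [ (λ e → ∈-respˡ (≈sym e) α∈) , (λ e → ∈-respˡ (≈sym e) γ∈) ]′ (upair⁻ q)) ]′ (∪⁻ p)
                in y ∪ upair α γ , sep⁺ (P-resp γ) (𝒫⁺ sub) ((∪⁺ʳ upair⁺ˡ , ∪⁺ʳ upair⁺ʳ) , countable-∪ c countable-upair) , ∪⁺ˡ
            ; closed = λ c c∈ _ →
                let u = ⋃ (fam {Lift ℓ ℕ} (c ∘ lower))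
                    u⁻ : ∀ {b} → b ∈ u → ∃ λ n → b ∈ c n
                    u⁻ p = let v , v∈ , q = ⋃⁻ p ; lift n , e = fam⁻ {f = c ∘ lower} v∈ in n , ∈-respʳ e q
                    u⁺ : ∀ {b} → (∃ λ n → b ∈ c n) → b ∈ u
                    u⁺ (n , p) = ⋃⁺ (fam⁺ _ (lift n)) p
                    (p , q) , _ = sep⁻ (P-resp γ) (c∈ 0)
                in u , sep⁺ (P-resp γ) (𝒫⁺ λ p → let n , r = u⁻ p in 𝒫⁻ (sep⊆ (c∈ n)) r)
                         ((u⁺ (0 , p) , u⁺ (0 , q))
                         , countable-⊆ (λ p → let n , r = u⁻ p in n , lift r)
                             (countable-⋃ℕ {C = λ n z → Lift L (z ∈ c n)} (λ n e (lift p) → lift (∈-respˡ e p))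
                               λ n → countable-⊆ lower (proj₂ (sep⁻ (P-resp γ) (c∈ n)))))
                     , u⁻ , u⁺ }

        X-ω₂ : ω₂ X
        X-ω₂ = Ord⇒IsOrdinal (transitive , λ y y∈ → proj₁ (ω₂-Ord (X⊆ω₂ y∈))) , ≅⇒≼ X≅ω₁

        -- As an ordinal below ω₂, X belongs to some K of the family. The club of traces of K on X
        -- meets `bad`, yet each trace is the intersection of two members of K and therefore
        -- covered.
        contradictory : ⊥
        contradictory =
          let K , f , X∈K = unbounded X X-ω₂
              module G = Good (good f)
              module Ch = Chain (good f) (G.K-trans X X∈K)
              z , z∈traces , z∈bad , _ = proj₂ stationary Ch.traces Ch.club-traces
              i , _ , w∈D , e = sep⁻ Ch.Trace-resp z∈traces
              z∈K = ∈ᶜ⇒∈ {x = z} ((λ p → ∩ᵛ⁻ (∈-respʳ e p)) , λ (p , q) → ∈-respʳ (≈sym e) (∩ᵛ⁺ p q))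
                      (Transitive.Closure.∩∈ G.K-trans G.zf (G.D⊆K w∈D) X∈K)
          in proj₁ (proj₂ (sep⁻ Bad-resp z∈bad)) (K , f , z∈K)

    opaque
      avoiding-club : ∃ λ C → IsClub ω₂ C × (∀ z → z ∈ C → ¬ z ∈ bad)
      avoiding-club = stable λ n →
        let X , s , t , u , v = rp bad (bad-subset , λ C club → stable λ m → n (C , club , λ z p q → m (z , p , q)))
        in Reflected.contradictory s t u v

    private
      C = proj₁ avoiding-club
      module C = IsClub (proj₁ (proj₂ avoiding-club))

      -- One round of decoding; the branches of the tree perform ω rounds, so their limits are
      -- `Closed`.
      Generated : 𝕍 → 𝕍 → Set L
      Generated y β = ∃ λ α → α ∈ y × β ∈ α × ∃ λ γ → γ ∈ y × E.E α β γ

      Generated-resp : ∀ {y} → Resp (Generated y)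
      Generated-resp e (α , p , q , γ , r , s) = α , p , ∈-respˡ e q , γ , r , E.respʸ e s

      closure : 𝕍 → 𝕍
      closure y = sep (⋃ y) (Generated y)

      closure-[]^ω : ∀ {y} → [ ω₂ ]^ω y → [ ω₂ ]^ω (closure y)
      closure-[]^ω {y} (s , c) = (λ p → let u , u∈ , q = ⋃⁻ (sep⊆ p) in ω₂-∈ (s u∈) q) , rel-ℕ R
          (λ e (α , p , q , γ , r , t , u) → α , p , ∈-respˡ e q , γ , r , E.respʸ e t , u)
          (λ β p → let α , p , q , γ , r , t = sep⁻ {P = Generated y} Generated-resp p in _ , α , p , q , γ , r , t , refl)
          (λ _ _ (α , p , q , γ , r , t , u) (α′ , p′ , q′ , γ′ , r′ , t′ , u′) →
            let m , n = code-injective {c.to (α , p)} {c.to (γ , r)} {c.to (α′ , p′)} {c.to (γ′ , r′)} (trans (sym u) u′)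
                α≈ = c.injective {α , p} {α′ , p′} m
                γ≈ = c.injective {γ , r} {γ′ , r′} n
            in E.inj (proj₂ Ω₂≐ (s p)) q (∈-respʳ (≈sym α≈) q′) t (E.respˣ (≈sym α≈) (E.respᶻ (≈sym γ≈) t′)))
        where
        module c = Injection c
        R : 𝕍 → ℕ → Set L
        R β n = ∃ λ α → Σ (α ∈ y) λ p → β ∈ α × ∃ λ γ → Σ (γ ∈ y) λ r → E.E α β γ × n ≡ code (c.to (α , p)) (c.to (γ , r))

    private
      module P = PerfectTreeOf Ω≐ Ω₂≐ (proj₁ (proj₂ avoiding-club)) closure closure-[]^ω

      limit-closed : ∀ f → Closed (P.limit f)
      limit-closed f α β γ α∈ β∈α γ∈ e =
        let m , p = proj₁ (P.limit≐ f) α∈ ; n , q = proj₁ (P.limit≐ f) γ∈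
            k , p′ , q′ = common m n p q
        in proj₂ (P.limit≐ f) (suc k , P.branch-closure f k
             (sep⁺ Generated-resp (⋃⁺ p′ β∈α) (α , p′ , β∈α , γ , q′ , e)))
        where
        common : ∀ m n → α ∈ P.branch f m → γ ∈ P.branch f n → ∃ λ k → α ∈ P.branch f k × γ ∈ P.branch f k
        common m n p q = [ (λ le → n , P.branch-mono f {m} {n} le p , q)
                         , (λ le → m , p , P.branch-mono f {n} {m} le q) ]′ (≤-total m n)

      limit-covered : ∀ f → Covered (P.limit f)
      limit-covered f = stable λ n → proj₂ (proj₂ avoiding-club) (P.limit f) (P.limit∈ f)
        (sep⁺ Bad-resp (𝒫⁺ λ p → proj₂ Ω₂≐ (proj₁ (C.subset (P.limit∈ f)) p))
          (proj₂ (C.subset (P.limit∈ f)) , n , limit-closed f))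

    private
      α : 𝕍
      α = proj₁ P.limit-bounded

      α-ω₂ : ω₂ α
      α-ω₂ = proj₁ (proj₂ P.limit-bounded)

      opaque
        Kα : 𝕍
        Kα = proj₁ (unbounded α α-ω₂)

        F-Kα : F Kα
        F-Kα = proj₁ (proj₂ (unbounded α α-ω₂))

        α∈Kα : α ∈ Kα
        α∈Kα = proj₂ (proj₂ (unbounded α α-ω₂))

      -- Different limits may be covered by different models. All limits are subsets of the one
      -- ordinal α, so coherence moves them into the single model `Kα`, of size at most ω₁.
      limit∈Kα : ∀ f → P.limit f ∈ Kα
      limit∈Kα f =
        let K′ , f′ , p = limit-covered f
        in Absorb.absorb (good F-Kα) (good f′) (agree F-Kα f′) p
             (proj₂ (C.subset (P.limit∈ f))) (ω₂-Ord α-ω₂) α∈Kα (proj₂ (proj₂ P.limit-bounded) f)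

      small : El Kα ≼ ω₁
      small = Good.small (good F-Kα)

      value : (ℕ → Bool) → ∃ (El Kα)
      value f = P.limit f , limit∈Kα f

    opaque
      reals : Σ ((ℕ → Bool) → ∃ ω₁) λ r → ∀ f g → proj₁ (r f) ≈ proj₁ (r g) → ∀ n → f n ≡ g n
      reals = (λ f → Injection.to small (value f))
            , λ f g e → P.limit-injective {f} {g} (Injection.injective small {value f} {value g} e)

-- The tower, its poset, and the consequences of presaturation.

module Presaturation (ℓ : Level) (em : ExcludedMiddle (lsuc ℓ)) (ac : SetTheory.Choice ℓ) where
  open import Data.Bool.Base using (T)
  open import Data.Fin.Base using (zero; suc)
  open import Data.Nat.Base using (ℕ; zero; suc)
  open import Data.Vec.Functional using (_∷_; [])
  open SetTheory ℓ
  open Sets ℓ em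
  open Ordinals ℓ em
  open Collapse ℓ em
  open Guessing ℓ em
  open Choosing ℓ em ac

  private variable
    x y M N β : 𝕍

  trcl-⊆ : IsTransitive β → El x ⊆ El β → trcl x ⊆ El β
  trcl-⊆ t s [ p ]ᵗ = s p
  trcl-⊆ t s (p ∷ᵗ q) = t _ (trcl-⊆ t s q) p

  H-mono : ∀ {ν ν′} → El ν ⊆ El ν′ → H ν ⊆ H ν′
  H-mono s (β , β∈ , f) = β , s β∈ , f

  H-resp : ∀ {ν} → Resp (H ν)
  H-resp e (β , β∈ , f) = β , β∈ , ≼-trans (≼-⊆ (trcl-resp e)) f
    where
    trcl-resp : x ≈ y → trcl y ⊆ trcl x
    trcl-resp e [ p ]ᵗ = [ ∈-respʳ (≈sym e) p ]ᵗ
    trcl-resp e (p ∷ᵗ q) = p ∷ᵗ trcl-resp e q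

  H-⊆ : ∀ {ν} → IsTransitive β → β ∈ ν → El x ⊆ El β → H ν x
  H-⊆ t β∈ s = _ , β∈ , ≼-⊆ (trcl-⊆ t s)

  SameBounded : 𝕍 → 𝕍 → Set L
  SameBounded M N = ∀ a → Bounded a → (a ∈ M → a ∈ N) × (a ∈ N → a ∈ M)

  SameBounded-sym : SameBounded M N → SameBounded N M
  SameBounded-sym s a b = proj₂ (s a b) , proj₁ (s a b)

  SameBounded-trans : ∀ {M N K} → SameBounded M N → SameBounded N K → SameBounded M K
  SameBounded-trans s t a b = proj₁ (t a b) ∘ proj₁ (s a b) , proj₂ (s a b) ∘ proj₂ (t a b)

  module _ (𝕋 : Tower) (conc : TowerConcentratesOn 𝕋 GIC) where
    open Tower 𝕋

    ord-δ : Ord δ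
    ord-δ = IsOrdinal⇒Ord δ-ordinal

    index∈δ : ∀ (ν : Index) → proj₁ ν ∈ δ
    index∈δ (ν , p) = index⊆δ p

    ord-index : ∀ (ν : Index) → Ord (proj₁ ν)
    ord-index ν = Ord-∈ ord-δ (index∈δ ν)

    module Ideal (ν : Index) where
      open IsIdeal (ideals ν) public

      A : 𝕍
      A = proj₁ (conc ν)

      A⊆Z : El A ⊆ Z ν
      A⊆Z = proj₁ (proj₂ (conc ν))

      A⊆GIC : El A ⊆ GIC
      A⊆GIC = proj₁ (proj₂ (proj₂ (conc ν)))

      Aᶜ : 𝕍
      Aᶜ = proj₁ (proj₂ (proj₂ (proj₂ (conc ν))))

      Aᶜ∈I : Aᶜ ∈ I ν
      Aᶜ∈I = proj₁ (proj₂ (proj₂ (proj₂ (proj₂ (conc ν)))))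

      Aᶜ≐ : El Aᶜ ≐ λ M → Z ν M × ¬ M ∈ A
      Aᶜ≐ = proj₂ (proj₂ (proj₂ (proj₂ (proj₂ (conc ν)))))

      -- `Z ν` is given as a class; concentration exhibits it as the union of two sets.
      Zᵛ : 𝕍
      Zᵛ = A ∪ Aᶜ

      Zᵛ≐ : El Zᵛ ≐ Z ν
      Zᵛ≐ = (λ p → [ A⊆Z , (λ q → proj₁ (proj₁ Aᶜ≐ q)) ]′ (∪⁻ p))
          , (λ {M} p → case emℓ {M ∈ A} of λ { (yes q) → ∪⁺ˡ q ; (no n) → ∪⁺ʳ (proj₂ Aᶜ≐ (p , n)) })

      Zᵛ∉I : ¬ Zᵛ ∈ I ν
      Zᵛ∉I p = proper (Zᵛ , p , Zᵛ≐)

      I-∪ : x ∈ I ν → y ∈ I ν → x ∪ y ∈ I ν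
      I-∪ {x} {y} p q = ∈ᶜ⇒∈ ((λ r → [ (λ s → 0 , s) , (λ s → 1 , s) ]′ (∪⁻ r))
                             , λ { (zero , r) → ∪⁺ˡ r ; (suc _ , r) → ∪⁺ʳ r })
        (σ-closed S λ { zero → p ; (suc _) → q })
        where
        S : ℕ → 𝕍
        S zero    = x
        S (suc _) = y

      inhabited : ¬ x ∈ I ν → ∃ (El x)
      inhabited {x} n = stable λ m → n (let e , e∈ , s , _ = empty in downward e x e∈ λ p → contradiction (_ , p) m)

      -- As ω₁ ⊆ M for M ∈ GIC, choosing i is a regressive function.
      press : ∀ S → El S ⊆ El A → ¬ S ∈ I ν → (R : 𝕍 → 𝕍 → Set L) →
              (∀ {M N i} → M ≈ N → R M i → R N i) → (∀ {M i j} → i ≈ j → R M i → R M j) →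
              (∀ M → M ∈ S → ∃ λ i → ω₁ i × R M i) →
              ∃ λ S′ → El S′ ⊆ El S × ¬ S′ ∈ I ν × ∃ λ i → ω₁ i × (∀ M → M ∈ S′ → R M i)
      press S S⊆A pos R Rˡ Rʳ h =
        let g , spec = choose S (λ M i → ω₁ i × R M i) (λ e (o , r) → o , Rˡ e r) (λ e (o , r) → ω₁-resp e o , Rʳ e r) h
            S′ , S′⊆S , pos′ , c , const = normal S (A⊆Z ∘ S⊆A) pos g
              (λ (M , p) → let ((_ , _ , ω₁⊆M) , _) = A⊆GIC (S⊆A p) in ω₁⊆M (proj₁ (spec (M , p))))
            M , M∈ = inhabited pos′
        in S′ , S′⊆S , pos′ , c , ω₁-resp (const (M , S′⊆S M∈) M∈) (proj₁ (spec (M , S′⊆S M∈)))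
         , λ N N∈ → Rʳ (const (N , S′⊆S N∈) N∈) (proj₂ (spec (N , S′⊆S N∈)))

    open Ideal using (A; A⊆Z; A⊆GIC; Zᵛ; Zᵛ≐; Zᵛ∉I; inhabited; press)

    ≤ᴾ-refl : ∀ {p : Condition 𝕋} → p ≤ᴾ p
    ≤ᴾ-refl {p} = id , λ M M∈ → S⊆Z M∈ , M , M∈ , (λ z∈ → z∈ , proj₁ (S⊆Z M∈) z∈) , proj₁
      where open Condition p

    ≤ᴾ-trans : ∀ {p q r : Condition 𝕋} → p ≤ᴾ q → q ≤ᴾ r → p ≤ᴾ r
    ≤ᴾ-trans (s , f) (t , g) = s ∘ t , λ M M∈ →
      let zM , N , N∈ , N⊆ , ⊆N = f M M∈ ; _ , K , K∈ , K⊆ , ⊆K = g N N∈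
      in zM , K , K∈ , (λ z∈ → proj₁ (N⊆ (proj₁ (K⊆ z∈))) , proj₂ (K⊆ z∈))
       , λ (z∈ , h) → ⊆K (⊆N (z∈ , H-mono t h) , h)

    ≈⇒≤ᴾ : ∀ {p q : Condition 𝕋} → proj₁ (Condition.ν q) ≈ proj₁ (Condition.ν p) → Condition.S q ≈ Condition.S p → p ≤ᴾ q
    ≈⇒≤ᴾ {p} {q} e f = ∈-respʳ e , λ M M∈ → p.S⊆Z M∈ , M , ∈-respʳ (≈sym f) M∈
      , (λ z∈ → z∈ , H-mono (∈-respʳ (≈sym e)) (proj₁ (p.S⊆Z M∈) z∈)) , proj₁
      where module p = Condition p

    -- Conditions form a large type. This small type represents them up to equivalence in the order,
    -- as `Bound` requires.
    Code : Set ℓ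
    Code = Σ (Ix index) λ i → Σ (Ix (𝒫 (Zᵛ (at index i , at∈ index i)))) λ j → ¬ at _ j ∈ I (at index i , at∈ index i)

    decode : Code → Condition 𝕋
    decode (i , j , n) = record { ν = _ ; S = at _ j ; S⊆Z = λ p → proj₁ (Zᵛ≐ _) (𝒫⁻ (at∈ _ j) p) ; positive = n }

    Z-resp : ∀ {μ ν : Index} → proj₁ μ ≈ proj₁ ν → Z μ ⊆ Z ν
    Z-resp e (s , h) = (λ p → H-mono (∈-respʳ e) (s p)) , h

    encode : ∀ q → ∃ λ c → q ≤ᴾ decode c × decode c ≤ᴾ q
    encode q =
      let i , e = ix (proj₂ ν)
          j , f = ix (𝒫⁺ {x = Zᵛ (at index i , at∈ index i)} λ p → proj₂ (Zᵛ≐ _) (Z-resp {ν} {at index i , at∈ index i} e (S⊆Z p)))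
          c = i , j , λ p → positive (∈-respʳ (Func.cong ideal {at index i , at∈ index i} {ν} (≈sym e)) (∈-respˡ (≈sym f) p))
      in c , ≈⇒≤ᴾ {q} {decode c} (≈sym e) (≈sym f) , ≈⇒≤ᴾ {decode c} {q} e f
      where open Condition q

    module _ (presat : IsPresaturated 𝕋) (rp : RP[ω₂]^ω) where
      open ForcingRelation ℓ em {Condition 𝕋} (_≤ᴾ_ {𝕋}) (λ {p} → ≤ᴾ-refl {p}) (λ {p} {q} {r} → ≤ᴾ-trans {p} {q} {r})
        using (_⊩_≈_; check; ∃-elim; check-∈-elim; ≤refl; module Bound)

      opaque
        δ-inhabited : ∃ λ o → o ∈ δ
        δ-inhabited =
          let r , _ , τ , τ∈ = ∃-elim (zero ∈̇ suc zero) {check δ ∷ []} (proj₁ (proj₂ (proj₁ presat))) ⊤⁺ ≤refl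
              _ , _ , y , y∈ , _ = check-∈-elim δ τ∈ r ≤refl
          in y , y∈

      ν₀ : Index
      ν₀ = let ν , ν∈ , _ = unbounded _ (proj₂ δ-inhabited) in ν , ν∈

      p₀ : Condition 𝕋
      p₀ = record { ν = ν₀ ; S = Zᵛ ν₀ ; S⊆Z = proj₁ (Zᵛ≐ ν₀) ; positive = Zᵛ∉I ν₀ }

      opaque
        A-inhabited : ∀ ν → ∃ λ M → M ∈ A ν
        A-inhabited ν = stable λ n → Zᵛ∉I ν (Ideal.downward ν (Ideal.Aᶜ ν) (Zᵛ ν) (Ideal.Aᶜ∈I ν)
          λ p → [ (λ q → contradiction (_ , q) n) , id ]′ (∪⁻ p))

      private
        M₀ = proj₁ (A-inhabited ν₀)
        M₀∈ = proj₂ (A-inhabited ν₀)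

      opaque
        -- The collapse of any guessing set has ω₁ as a member, which supplies ω₁ as a set.
        Ω : 𝕍
        Ω = proj₁ (Hasω₁Approximation.ω₁∈ (proj₂ (proj₂ (proj₁ (proj₁ (A⊆GIC ν₀ M₀∈))))))

        Ω≐ : El Ω ≐ ω₁
        Ω≐ = proj₂ (proj₂ (Hasω₁Approximation.ω₁∈ (proj₂ (proj₂ (proj₁ (proj₁ (A⊆GIC ν₀ M₀∈)))))))

      ord-Ω : Ord Ω
      ord-Ω = (λ y y∈ z∈ → proj₂ Ω≐ (ω₁-∈ (proj₁ Ω≐ y∈) z∈)) , λ y y∈ → proj₁ (ω₁-Ord (proj₁ Ω≐ y∈))

      uncountable-Ω : ¬ Countable (El Ω)
      uncountable-Ω c = ∈-irrefl (proj₂ Ω≐ (Ord⇒IsOrdinal ord-Ω , c))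

      opaque
        -- `M₀` embeds into some β < κ and includes ω₁, so β is uncountable.
        Ω⊆κ-element : ∃ λ β → β ∈ κ × Ord β × El Ω ⊆ El β
        Ω⊆κ-element =
          let (_ , β , β∈κ , f) = A⊆Z ν₀ M₀∈
              ord-β = Ord-∈ (ord-index ν₀) (κ≤ ν₀ β∈κ)
              (_ , _ , ω₁⊆M) , _ = A⊆GIC ν₀ M₀∈
          in β , β∈κ , ord-β , ∉⇒⊇ ord-β ord-Ω λ p →
               uncountable-Ω (≼-countable {D = El β} (≼-trans (≼-⊆ (ω₁⊆M ∘ proj₁ Ω≐)) f) (proj₂ (proj₁ Ω≐ p)))

      Ω∈index : ∀ (ν : Index) → Ω ∈ proj₁ ν
      Ω∈index ν = let β , β∈ , o , s = Ω⊆κ-element in case ⊆⇒∈⊎≈ ord-Ω o s of λ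
        { (inj₁ p) → Ord-trans (ord-index ν) (κ≤ ν β∈) p ; (inj₂ e) → ∈-respˡ (≈sym e) (κ≤ ν β∈) }

      Ω∈δ : Ω ∈ δ
      Ω∈δ = Ord-trans ord-δ (index∈δ ν₀) (Ω∈index ν₀)

      bounded∈H : ∀ (ν : Index) {a} → Bounded a → H (proj₁ ν) a
      bounded∈H ν (β , o , s) = H-⊆ (proj₁ (ω₁-Ord o)) (Ord-trans (ord-index ν) (Ω∈index ν) (proj₂ Ω≐ o)) s

      ⋃Z≐H : ∀ (ν : Index) → ⋃ᶜ (Z ν) ≐ H (proj₁ ν)
      ⋃Z≐H ν = (λ (M , (s , _) , z∈) → s z∈) , λ {x} h →
        upair x x , ((λ p → H-resp (≈sym (sing⁻ p)) h)
                    , (let β , β∈ , _ , s = Ω⊆κ-element in β , β∈ ,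
                       ≼-by (λ _ → ∅ᵛ , s (proj₂ Ω≐ ω₁-∅)) (λ _ _ _ → ≈refl) (λ (_ , p) (_ , q) _ → ≈trans (sing⁻ p) (≈sym (sing⁻ q))))) , upair⁺ˡ

      bound : (D : 𝕍 → 𝕍 → Condition 𝕋 → Set L) →
              (∀ {i i′ α α′ q} → i ≈ i′ → α ≈ α′ → D i α q → D i′ α′ q) →
              (∀ {i α q q′} → q′ ≤ᴾ q → D i α q → D i α q′) →
              (∀ {i α α′ q} → α ∈ δ → α′ ∈ δ → D i α q → D i α′ q → α ≈ α′) →
              ∃ λ β → β ∈ δ × ∃ λ p → ∀ q → q ≤ᴾ p → ∀ i α → i ∈ Ω → α ∈ δ → D i α q → α ∈ β
      bound D r m f = Bound.bound {Ω} {δ} {proj₁ δ-inhabited} Ω∈δ (proj₂ δ-inhabited) presat p₀ decode encode D r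
        (λ {i} {α} {q} {q′} → m {i} {α} {q} {q′}) (λ {i} {α} {α′} {q} → f {i} {α} {α′} {q})

      opaque
        -- The bound for the constant function with value ε lies above ε.
        δ-limit : ∀ ε → ε ∈ δ → ∃ λ β → β ∈ δ × ε ∈ β
        δ-limit ε ε∈ =
          let β , β∈ , p , h = bound (λ i α q → Lift L (α ≈ ε)) (λ { _ e (lift f) → lift (≈trans (≈sym e) f) })
                (λ _ d → d) (λ { _ _ (lift e) (lift f) → ≈trans e (≈sym f) })
          in β , β∈ , h p (≤ᴾ-refl {p}) ∅ᵛ ε (proj₂ Ω≐ ω₁-∅) ε∈ (lift ≈refl)

        -- Otherwise δ ⊆ α for some α < ω₂, and inverting an injection of α into ω₁ would give a map
        -- of a subset of ω₁ onto δ already in the ground model.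
        ω₂⊆δ : ω₂ ⊆ El δ
        ω₂⊆δ {α} o = stableℓ λ n →
          let s = ∉⇒⊇ (ω₂-Ord o) ord-δ n
              module f = Injection (proj₂ o)
              β , β∈ , p , h = bound (λ i γ q → ∃ λ (γ∈ : γ ∈ α) → Lift L (proj₁ (f.to (γ , γ∈)) ≈ i))
                (λ { e e′ (γ∈ , lift q) → ∈-respˡ e′ γ∈ , lift (≈trans (f.cong (≈sym e′)) (≈trans q e)) })
                (λ _ d → d) (λ { _ _ (_ , lift q) (_ , lift q′) → f.injective (≈trans q (≈sym q′)) })
          in ∈-irrefl (h p (≤ᴾ-refl {p}) _ β (proj₂ Ω≐ (proj₂ (f.to (β , s β∈)))) β∈ (s β∈ , lift ≈refl))

      opaque
        Ω₂ : 𝕍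
        Ω₂ = sep δ ω₂

        Ω₂≐ : El Ω₂ ≐ ω₂
        Ω₂≐ = sep⁻ ω₂-resp , λ o → sep⁺ ω₂-resp (ω₂⊆δ o) o

      opaque
        index-above : ∀ (ν : Index) β → β ∈ δ → ∃ λ (ν′ : Index) → El (proj₁ ν) ⊆ El (proj₁ ν′) × β ∈ proj₁ ν′
        index-above ν β β∈ with emℓ {β ∈ proj₁ ν}
        ... | yes p = ν , id , p
        ... | no n  =
          let γ , γ∈ , β∈γ = δ-limit β β∈
              ν′ , ν′∈ , s = unbounded γ γ∈
              ν⊆β = ∉⇒⊇ (Ord-∈ ord-δ β∈) (ord-index ν) n
          in (ν′ , ν′∈) , (λ p → Ord-trans (ord-index (ν′ , ν′∈)) (s β∈γ) (ν⊆β p)) , s β∈γ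

      module Refine (p : Condition 𝕋) (β : 𝕍) (β∈δ : β ∈ δ) where
        open Condition p

        private
          above = index-above ν β β∈δ

        ν′ : Index
        ν′ = proj₁ above

        ν≤ν′ : El (proj₁ ν) ⊆ El (proj₁ ν′)
        ν≤ν′ = proj₁ (proj₂ above)

        Refines : 𝕍 → Set L
        Refines M = (El M ∩ H (proj₁ ν)) ∈ᶜ S × M ∈ A ν′ × β ∈ M

        Refines-resp : Resp Refines
        Refines-resp e ((N , N∈ , s , t) , q , r) =
          (N , N∈ , (λ z∈ → ∈-respʳ e (proj₁ (s z∈)) , proj₂ (s z∈)) , λ (z∈ , h) → t (∈-respʳ (≈sym e) z∈ , h))
          , ∈-respˡ e q , ∈-respʳ e r

        S′ : 𝕍
        S′ = sep (Zᵛ ν′) Refines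

        S′⊆A : El S′ ⊆ El (A ν′)
        S′⊆A q = proj₁ (proj₂ (sep⁻ Refines-resp q))

        -- Otherwise the lift of S to ν′ would be null, being covered by `S′`, by the complement of
        -- `A ν′` and by the sets that omit β, which are null by fineness. By projection S would be
        -- null.
        positive′ : ¬ S′ ∈ I ν′
        positive′ S′∈I = positive (Equivalence.from (proj₂ (projections ν ν′ ν≤ν′) S) (S⊆Z ,
            (lift-S , Ideal.downward ν′ _ lift-S (Ideal.I-∪ ν′ S′∈I (Ideal.I-∪ ν′ (Ideal.Aᶜ∈I ν′) (proj₁ (proj₂ null)))) cover
            , (λ q → proj₁ (Zᵛ≐ ν′) (sep⊆ q) , sep⁻ R-resp q) , λ (z , r) → sep⁺ R-resp (proj₂ (Zᵛ≐ ν′) z) r)))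
          where
          null : (λ M → Z ν′ M × ¬ β ∈ M) ∈ᶜ I ν′
          null = Ideal.fine ν′ β (proj₂ (⋃Z≐H ν′) (H-⊆ (proj₁ ord-β) (proj₂ (proj₂ above)) id))
            where ord-β = Ord-∈ ord-δ β∈δ
          R : 𝕍 → Set L
          R M = (El M ∩ ⋃ᶜ (Z ν)) ∈ᶜ S
          R-resp : Resp R
          R-resp e (N , N∈ , s , t) = N , N∈ , (λ z∈ → ∈-respʳ e (proj₁ (s z∈)) , proj₂ (s z∈)) , λ (z∈ , h) → t (∈-respʳ (≈sym e) z∈ , h)
          lift-S : 𝕍
          lift-S = sep (Zᵛ ν′) R
          cover : El lift-S ⊆ El (S′ ∪ Ideal.Aᶜ ν′ ∪ proj₁ null)
          cover {M} q with emℓ {M ∈ A ν′} | emℓ {β ∈ M}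
          ... | no n  | _    = ∪⁺ʳ (∪⁺ˡ (proj₂ (Ideal.Aᶜ≐ ν′) (proj₁ (Zᵛ≐ ν′) (sep⊆ q) , n)))
          ... | yes _ | no n = ∪⁺ʳ (∪⁺ʳ (proj₂ (proj₂ (proj₂ null)) (proj₁ (Zᵛ≐ ν′) (sep⊆ q) , n)))
          ... | yes a | yes b =
            let N , N∈ , s , t = sep⁻ R-resp q
            in ∪⁺ˡ (sep⁺ Refines-resp (sep⊆ q) ((N , N∈ , (λ z∈ → proj₁ (s z∈) , proj₁ (⋃Z≐H ν) (proj₂ (s z∈)))
                 , λ (z∈ , h) → t (z∈ , proj₂ (⋃Z≐H ν) h)) , a , b))

        below : ∀ S″ → El S″ ⊆ El S′ → ¬ S″ ∈ I ν′ → ∃ λ (q : Condition 𝕋) → q ≤ᴾ p × Condition.S q ≡ S″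
        below S″ s n = record { ν = ν′ ; S = S″ ; S⊆Z = A⊆Z ν′ ∘ S′⊆A ∘ s ; positive = n }
          , (ν≤ν′ , λ M M∈ → A⊆Z ν′ (S′⊆A (s M∈)) , proj₁ (sep⁻ Refines-resp (s M∈))) , refl

      -- A name for a function from ω₁ onto δ.

      private
        E : Codes Ω₂ ω₁
        E = codes λ x p → proj₂ (proj₁ Ω₂≐ p)
        module E = Codes E

      -- Quantifying over all N with the same bounded subsets of ω₁ makes the bound depend on M only
      -- through these subsets. They belong to every `H ν` of the tower, so conditions with smaller
      -- index already determine the bound.
      HeightBound : 𝕍 → 𝕍 → Set L
      HeightBound M ξ = ω₂ ξ × (∀ N → GIC N → SameBounded M N → ∀ γ → Ord γ → γ ∈ collapse N → γ ∈ ξ)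

      HeightBound-resp : Resp (HeightBound M)
      HeightBound-resp e (o , h) = ω₂-resp e o , λ N g s γ o′ p → ∈-respʳ e (h N g s γ o′ p)

      HeightBound-same : ∀ {ξ} → SameBounded M N → HeightBound M ξ → HeightBound N ξ
      HeightBound-same {M} {N} s (o , h) = o , λ K g t → h K g (SameBounded-trans {M} {N} {K} s t)

      Least-HeightBound-same : ∀ {ξ} → SameBounded M N → Least (HeightBound M) ξ → Least (HeightBound N) ξ
      Least-HeightBound-same {M} {N} s (p , m) = HeightBound-same s p , λ y y∈ q →
        m y y∈ (HeightBound-same {N} {M} (SameBounded-sym {M} {N} s) q)

      -- The ordinal π M α is below the least bound of the heights of the
      -- collapses with the same bounded subsets of ω₁ as M, and i codes it.
      Coded : 𝕍 → 𝕍 → 𝕍 → Set L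
      Coded M α i = ∃ λ ξ → Least (HeightBound M) ξ × π M α ∈ ξ × E.E ξ (π M α) i

      Coded-same : ∀ {α β i} → SameBounded M N → π M α ≈ π N β → Coded M α i → Coded N β i
      Coded-same s e (ξ , l , p , q) = ξ , Least-HeightBound-same s l , ∈-respˡ e p , E.respʸ e q

      Decides : 𝕍 → 𝕍 → Condition 𝕋 → Set L
      Decides i α q = Ord α × (∀ M → M ∈ Condition.S q → α ∈ M × Coded M α i)

      Decides-resp : ∀ {i i′ α α′ q} → i ≈ i′ → α ≈ α′ → Decides i α q → Decides i′ α′ q
      Decides-resp e f (o , h) = Ord-resp f o , λ M M∈ →
        let p , ξ , l , q , r = h M M∈
            g = π-cong ≈refl f
        in ∈-respˡ f p , ξ , l , ∈-respˡ g q , E.respᶻ e (E.respʸ g r)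

      -- If N = M ∩ H_ν, then M and N have the same bounded subsets of ω₁, and, as members of α lie
      -- in H_ν with α, also the same collapse of α.
      Decides-mono : ∀ {i α q q′} → q′ ≤ᴾ q → Decides i α q → Decides i α q′
      Decides-mono {q = q} (_ , f) (o , h) = o , λ M M∈ →
        let _ , N , N∈ , N⊆ , ⊆N = f M M∈
            α∈N , c = h N N∈
        in proj₁ (N⊆ α∈N)
         , Coded-same {N} {M} (λ a b → (λ p → proj₁ (N⊆ p)) , λ p → ⊆N (p , bounded∈H (Condition.ν q) b))
             (π-local o (λ w _ p → proj₁ (N⊆ p)) (λ w w∈ p → ⊆N (p , H-transitive (proj₂ (N⊆ α∈N)) w∈))) c

      -- Any M in the condition determines the least bound ξ; then i determines the collapse of α
      -- through the injection of ξ, and the collapse is injective on the ordinals of M.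
      Decides-functional : ∀ {i α α′ q} → α ∈ δ → α′ ∈ δ → Decides i α q → Decides i α′ q → α ≈ α′
      Decides-functional {q = q} _ _ (o , h) (o′ , h′) =
        let M , M∈ = inhabited (Condition.ν q) (Condition.positive q)
            p , ξ , l , u , c = h M M∈
            p′ , ξ′ , l′ , u′ , c′ = h′ M M∈
            ξ≈ = Least-unique {P = HeightBound M} {HeightBound M} HeightBound-resp (ω₂-Ord ∘ proj₁) (ω₂-Ord ∘ proj₁) id id l l′
        in π-inj o o′ p p′ (E.inj (proj₂ Ω₂≐ (proj₁ (proj₁ l))) u (∈-respʳ (≈sym ξ≈) u′) c (E.respˣ (≈sym ξ≈) c′))

      SameBounded-resp : M ≈ N → SameBounded M N
      SameBounded-resp e a _ = ∈-respʳ e , ∈-respʳ (≈sym e)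

      module _ (short : ∀ M → GIC M → ∃ (HeightBound M)) where

        opaque
          coded : ∀ {M β} → GIC M → Ord β → β ∈ M → ∃ λ i → ω₁ i × Coded M β i
          coded {M} {β} g oβ β∈ =
            let ξ , l = ∈-min {HeightBound M} (short M g)
                u = proj₂ (proj₁ l) M g (λ a _ → id , id) (π M β) (Ord-π oβ) (collapse⁺ β∈)
                i , oi , c = E.total (proj₂ Ω₂≐ (proj₁ (proj₁ l))) u
            in i , oi , ξ , l , u , c

          -- `Refine` puts β into every M of the refined set, so that each M has a code for β;
          -- pressing down makes the code constant.
          decide : ∀ p β → β ∈ δ → ∃ λ q → q ≤ᴾ p × ∃ λ i → ω₁ i × Decides i β q
          decide p β β∈ =
            let S″ , sub , pos , i , oi , h = pressed
                q , q≤ , eq = below S″ sub pos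
            in q , q≤ , i , oi , ord-β , λ M M∈ →
              let M∈S″ = subst (M ∈_) eq M∈
              in proj₂ (proj₂ (sep⁻ Refines-resp (sub M∈S″))) , h M M∈S″
            where
            open Refine p β β∈
            ord-β : Ord β
            ord-β = Ord-∈ ord-δ β∈
            Codes-β : 𝕍 → 𝕍 → Set L
            Codes-β M i = Coded M β i
            pressed : ∃ λ S″ → El S″ ⊆ El S′ × ¬ S″ ∈ I ν′ × ∃ λ i → ω₁ i × (∀ M → M ∈ S″ → Codes-β M i)
            pressed = press ν′ S′ S′⊆A positive′ Codes-β
              (λ {M} {N} {i} e → Coded-same {M} {N} {β} {β} {i} (SameBounded-resp e) (π-cong e ≈refl))
              (λ e (ξ , l , u , c) → ξ , l , u , E.respᶻ e c)
              (λ M M∈ → let _ , M∈A , β∈M = sep⁻ Refines-resp M∈ in coded (A⊆GIC ν′ M∈A) ord-β β∈M)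

        -- Decides names a function of ω₁ onto δ.
        short⇒⊥ : ⊥
        short⇒⊥ =
          let β , β∈ , p , h = bound Decides (λ {i} {i′} {α} {α′} {q} → Decides-resp {i} {i′} {α} {α′} {q})
                (λ {i} {α} {q} {q′} → Decides-mono {i} {α} {q} {q′}) (λ {i} {α} {α′} {q} → Decides-functional {i} {α} {α′} {q})
              q , q≤ , i , oi , d = decide p β β∈
          in ∈-irrefl (h q q≤ i β (proj₂ Ω≐ oi) β∈ d)

      opaque
        tall : ∃ λ M → GIC M × (∀ ξ → ω₂ ξ → ¬ HeightBound M ξ)
        tall = stable λ n → short⇒⊥ λ M g → stable λ m → n (M , g , λ ξ _ b → m (ξ , b))

      -- The coherent family, and reals coded by countable ordinals.

      private
        M₁ = proj₁ tall

        Family : 𝕍 → Set L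
        Family K = ∃ λ M → GIC M × SameBounded M₁ M × K ≡ collapse M

        good : ∀ {K} → Family K → Good K
        good (M , g , _ , refl) = GIC⇒Good g

        agree : ∀ {K K′} → Family K → Family K′ → ∀ a → Bounded a → a ∈ K′ → a ∈ K
        agree (M , (_ , _ , ω₁⊆M , _) , s , refl) (M′ , (g′ , zf , _) , s′ , refl) a b a∈ =
          bounded-collapse⁺ ω₁⊆M b (proj₁ (s a b) (proj₂ (s′ a b) (bounded-collapse⁻ g′ zf b a∈)))

        -- As ξ does not bound the heights, the collapse of some N with the same bounded subsets has
        -- an ordinal γ ≥ ξ, and by transitivity it contains ξ.
        cofinal : ∀ ξ → ω₂ ξ → ∃ λ K → Family K × ξ ∈ K
        cofinal ξ o = stable λ n → proj₂ (proj₂ tall) ξ o (o , λ M g s γ oγ γ∈ → stableℓ λ γ∉ξ →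
          n (collapse M , (M , g , s , refl) , (case ⊆⇒∈⊎≈ (ω₂-Ord o) oγ (∉⇒⊇ oγ (ω₂-Ord o) γ∉ξ) of λ
            { (inj₁ p) → collapse-transitive γ γ∈ p ; (inj₂ e) → ∈-respˡ (≈sym e) γ∈ })))

        opaque
          embedding : Σ ((ℕ → Bool) → ∃ ω₁) λ r → ∀ f g → proj₁ (r f) ≈ proj₁ (r g) → ∀ n → f n ≡ g n
          embedding = Reflection.reals ℓ em ac Ω≐ Ω₂≐ rp Family good agree cofinal

        r : (ℕ → Bool) → ∃ ω₁
        r = proj₁ embedding

        r-injective : ∀ f g → proj₁ (r f) ≈ proj₁ (r g) → ∀ n → f n ≡ g n
        r-injective = proj₂ embedding

        -- An injection of β into ℕ turns subsets of β into reals, so `r` can index them by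
        -- countable ordinals.
        module Decode {β} (index-β : Countable (El β)) where
          open Injection index-β renaming (to to c; cong to c-cong; injective to c-inj)

          Digit : (ℕ → Bool) → 𝕍 → Set L
          Digit f γ = Lift L (Σ (γ ∈ β) λ p → f (c (γ , p)) ≡ true)

          Digit-resp : ∀ {f} → Resp (Digit f)
          Digit-resp {f} e (lift (p , q)) = lift (∈-respˡ e p , trans (cong f (c-cong (≈sym e))) q)

          set : (ℕ → Bool) → 𝕍
          set f = sep β (Digit f)

          set⊆ : ∀ {f} → El (set f) ⊆ El β
          set⊆ = sep⊆

          set-cong : ∀ {f g} → (∀ n → f n ≡ g n) → set f ≈ set g
          set-cong e = ext (half e) (half (sym ∘ e))
            where
            half : ∀ {f g} → (∀ n → f n ≡ g n) → El (set f) ⊆ El (set g)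
            half {f} {g} e p = let lift (q , t) = sep⁻ (Digit-resp {f}) p in sep⁺ (Digit-resp {g}) q (lift (q , trans (sym (e _)) t))

          Index∈ : 𝕍 → ℕ → Set L
          Index∈ a n = ∃ λ γ → γ ∈ a × Σ (γ ∈ β) λ p → c (γ , p) ≡ n

          digits : 𝕍 → ℕ → Bool
          digits a n = isYes (em {Index∈ a n})

          digits⁻ : ∀ {a n} → digits a n ≡ true → Index∈ a n
          digits⁻ {a} {n} e = toWitness {a? = em {Index∈ a n}} (subst T (sym e) _)

          digits⁺ : ∀ {a n} → Index∈ a n → digits a n ≡ true
          digits⁺ {a} {n} i with em {Index∈ a n}
          ... | yes _ = refl
          ... | no ¬i = contradiction i ¬i

          set-digits : ∀ {a} → El a ⊆ El β → set (digits a) ≈ a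
          set-digits {a} s = ext
            (λ p → let lift (q , t) = sep⁻ (Digit-resp {digits a}) p ; γ , γ∈ , q′ , e = digits⁻ {a} t
                   in ∈-respˡ (c-inj {γ , q′} {_ , q} e) γ∈)
            (λ p → sep⁺ (Digit-resp {digits a}) (s p) (lift (s p , digits⁺ {a} (_ , p , s p , refl))))

      -- The contradiction between CH and guessing.

      private
        A∉I : ¬ A ν₀ ∈ I ν₀
        A∉I p = Zᵛ∉I ν₀ (Ideal.I-∪ ν₀ p (Ideal.Aᶜ∈I ν₀))

        Omits : 𝕍 → 𝕍 → Set L
        Omits M β = ∃ λ a → (El a ⊆ El β) × ¬ a ∈ M

        omits : ∀ {a M} → ¬ (Bounded a → a ∈ M) → ∃ λ β → ω₁ β × Omits M β
        omits {a} {M} m = stable λ n → m λ (β , o , s) → stableℓ λ a∉ → n (β , o , a , (λ {z} → s {z}) , a∉)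

        opaque
          -- Every M in `GIC` omits some bounded subset of ω₁. Bounds of such subsets are members of
          -- M, so pressing down makes one bound work for positively many M.
          omitting : ∃ λ S → El S ⊆ El (A ν₀) × ¬ S ∈ I ν₀ × ∃ λ β → ω₁ β × (∀ M → M ∈ S → Omits M β)
          omitting = press ν₀ (A ν₀) id A∉I Omits
            (λ e (a , s , n) → a , s , n ∘ ∈-respʳ (≈sym e)) (λ e (a , s , n) → a , (λ p → ∈-respʳ e (s p)) , n)
            (λ M M∈ → omits (proj₂ (¬∀⇒∃¬ (GIC-omits-bounded (A⊆GIC ν₀ M∈)))))

        -- Since r maps the reals into ω₁, positively many M ∈ S omit the same
        -- subset of β, against fineness.
        module Omitted {S β : 𝕍} (S⊆A : El S ⊆ El (A ν₀)) (pos : ¬ S ∈ I ν₀) (oβ : ω₁ β)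
                       (h : ∀ M → M ∈ S → Omits M β) where
          open Decode (proj₂ oβ)

          OmitsReal : 𝕍 → 𝕍 → Set L
          OmitsReal M i = Lift L (∃ λ f → proj₁ (r f) ≈ i × ¬ set f ∈ M)

          omits-real : ∀ M → M ∈ S → ∃ λ i → ω₁ i × OmitsReal M i
          omits-real M M∈ = let a , s , n = h M M∈ in
            proj₁ (r (digits a)) , proj₂ (r (digits a)) , lift (digits a , ≈refl , n ∘ ∈-respˡ (set-digits s))

          opaque
            pressed : ∃ λ S′ → El S′ ⊆ El S × ¬ S′ ∈ I ν₀ × ∃ λ i → ω₁ i × (∀ M → M ∈ S′ → OmitsReal M i)
            pressed = press ν₀ S S⊆A pos OmitsReal
              (λ e (lift (f , p , n)) → lift (f , p , n ∘ ∈-respʳ (≈sym e)))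
              (λ e (lift (f , p , n)) → lift (f , ≈trans p e , n)) omits-real

          contradictory : ⊥
          contradictory =
            let S′ , S′⊆S , pos′ , i , _ , h′ = pressed
                M , M∈ = inhabited ν₀ pos′
                lift (f , e , _) = h′ M M∈
                null , null∈ , _ , ⊇ = Ideal.fine ν₀ (set f) (proj₂ (⋃Z≐H ν₀) (bounded∈H ν₀ (β , oβ , set⊆ {f})))
                S′⊆null : El S′ ⊆ El null
                S′⊆null {N} N∈ = let lift (g , e′ , m) = h′ N N∈ in
                  ⊇ (A⊆Z ν₀ (S⊆A (S′⊆S N∈)) , m ∘ ∈-respˡ (set-cong {f} {g} (r-injective f g (≈trans e (≈sym e′)))))
            in pos′ (Ideal.downward ν₀ null S′ null∈ S′⊆null)

      not-presaturated : ⊥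
      not-presaturated = let _ , S⊆A , pos , _ , oβ , h = omitting in Omitted.contradictory S⊆A pos oβ h

open import Level using (suc)

theorem1 : (ℓ : Level) → ExcludedMiddle (suc ℓ) → let open SetTheory ℓ in
    Choice → RP[ω₂]^ω →
    (T : Tower) → TowerConcentratesOn T GIC → ¬ IsPresaturated T
theorem1 ℓ em ac rp T conc presat = Presaturation.not-presaturated ℓ em ac T conc presat rp
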